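{- Let $k\geq t+2\geq 4$, $n\geq 7(k-t+1)k^2$, and let $\mathcal{F},\mathcal{G}\subseteq\binom{[n]}{k}$ be cross $t$-intersecting. Suppose that $$|\mathcal{F}|\geq|\mathcal{L}(n,k,t,u,v)|\quad\text{and}\quad|\mathcal{G}|\geq|\mathcal{L}(n,k,t,v,u)|$$ for some integers $u,v\in[3,k-t+1]$ with $(u,v)\neq(3,3)$. Then at least one of the following holds: (a) $\gamma_t(\mathcal{F})\leq\gamma_t(\mathcal{L}(n,k,t,u,v))$ and $\gamma_t(\mathcal{G})\leq\gamma_t(\mathcal{L}(n,k,t,v,u))$; (b) $u,v\leq t+2$ and $\mathcal{F},\mathcal{G}\subseteq\mathcal{A}(Z)$ for some $Z\in\binom{[n]}{t+2}$. Moreover, in case (a), if $\gamma_t(\mathcal{F})=\gamma_t(\mathcal{L}(n,k,t,u,v))$ or $\gamma_t(\mathcal{G})=\gamma_t(\mathcal{L}(n,k,t,v,u))$, then $\mathcal{F}=\mathcal{L}(X,U,V)$ and $\mathcal{G}=\mathcal{L}(X,V,U)$ for some $X\in\binom{[n]}{t}$, $U\in\binom{[n]}{t+u}$ and $V\in\binom{[n]}{t+v}$ with $X\subseteq U\cap V$ and $|U\cap V|\geq t+2$.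
   Context: $n,k,t$ are positive integers, $[n]=\{1,\dots,n\}$, $[i,j]=\{i,i+1,\dots,j\}$, and $\binom{[n]}{k}$ is the family of all $k$-subsets of $[n]$. Families $\mathcal{F},\mathcal{G}$ are cross $t$-intersecting if $|F\cap G|\ge t$ for all $F\in\mathcal{F}$, $G\in\mathcal{G}$. For a family $\mathcal{F}$ of subsets of $[n]$, $\Delta_t(\mathcal{F})=\max\{|\{F\in\mathcal{F}:S\subseteq F\}|:S\in\binom{[n]}{t}\}$ and the $t$-diversity is $\gamma_t(\mathcal{F}):=|\mathcal{F}|-\Delta_t(\mathcal{F})$. For $Z\in\binom{[n]}{t+2}$, $\mathcal{A}(Z)=\{F\in\binom{[n]}{k}:|F\cap Z|\geq t+1\}$. For $X\in\binom{[n]}{t}$, $U\in\binom{[n]}{t+u}$ and $V\in\binom{[n]}{t+v}$ with $X\subseteq U\cap V$, $$\mathcal{L}(X,U,V)=\left\{F\in\binom{[n]}{k}:X\subseteq F,\ F\cap(V\setminus X)\neq\emptyset\right\}\cup\left\{F\in\binom{[n]}{k}:F\cap U=U\setminus\{x\}\text{ for some }x\in X\right\},$$ and $\mathcal{L}(n,k,t,u,v)=\mathcal{L}([t],[t+u],[t+v])$. One has $|\mathcal{L}(n,k,t,u,v)|=\binom{n-t}{k-t}-\binom{n-v-t}{k-t}+t\binom{n-u-t}{k-u-t+1}$ and $\gamma_t(\mathcal{L}(n,k,t,u,v))=t\binom{n-u-t}{k-u-t+1}$. -}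

module Defs where

open import Data.Bool.Properties using () renaming (_≟_ to _≟ᵇ_)
open import Data.Fin using (toℕ)
open import Data.Fin.Properties using (any?)
open import Data.Fin.Subset using (Subset; inside; outside; _∈_; _⊆_; _∩_; _─_; _-_; ∣_∣; Nonempty)
open import Data.Fin.Subset.Properties using (_∈?_; _⊆?_; nonempty?)
open import Data.List using (List; []; _∷_; _++_; map; filter; length)
open import Data.List.Extrema.Nat using (max)
open import Data.Nat using (ℕ; zero; suc; _+_; _∸_; _≤_; _≟_; _<?_)
open import Data.Product using (∃; _×_)
open import Data.Sum using (_⊎_)
open import Data.Vec using ([]; _∷_; tabulate)
open import Data.Vec.Properties using (≡-dec)
open import Level using (0ℓ)
open import Relation.Binary.PropositionalEquality using (_≡_)
open import Relation.Nullary using (does; _×-dec_; _⊎-dec_)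
open import Relation.Unary using (Pred; Decidable)

-- The ground set [n] is Fin n.  A family of subsets of [n] is a decidable
-- predicate on Subset n; cardinalities are taken of its decision procedure.

Family : ℕ → Set₁
Family n = Pred (Subset n) 0ℓ

private
  variable
    n : ℕ

subsets : ∀ n → List (Subset n)
subsets zero    = [] ∷ []
subsets (suc n) = map (inside ∷_) (subsets n) ++ map (outside ∷_) (subsets n)

card : {𝓕 : Family n} → Decidable 𝓕 → ℕ
card {n} 𝓕? = length (filter 𝓕? (subsets n))

Sized : ℕ → Family n
Sized k F = ∣ F ∣ ≡ k

sized? : ∀ k → Decidable (Sized {n} k)
sized? k F = ∣ F ∣ ≟ k

CrossIntersecting : ℕ → Family n → Family n → Set
CrossIntersecting t 𝓕 𝓖 = ∀ {F G} → 𝓕 F → 𝓖 G → t ≤ ∣ F ∩ G ∣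

degree : {𝓕 : Family n} → Decidable 𝓕 → Subset n → ℕ
degree 𝓕? S = card (λ F → 𝓕? F ×-dec S ⊆? F)

-- The bottom element 0 supplied to max matters only when t > n.
Δ : {𝓕 : Family n} → ℕ → Decidable 𝓕 → ℕ
Δ {n} t 𝓕? = max 0 (map (degree 𝓕?) (filter (sized? t) (subsets n)))

-- Truncated subtraction is exact here, since Δ t 𝓕? ≤ card 𝓕?.
γ : {𝓕 : Family n} → ℕ → Decidable 𝓕 → ℕ
γ t 𝓕? = card 𝓕? ∸ Δ t 𝓕?

𝓐 : (k t : ℕ) → Subset n → Family n
𝓐 k t Z F = Sized k F × t + 1 ≤ ∣ F ∩ Z ∣

𝓛 : (k : ℕ) (X U V : Subset n) → Family n
𝓛 k X U V F =
    (Sized k F × X ⊆ F × Nonempty (F ∩ (V ─ X)))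
  ⊎ (Sized k F × ∃ λ x → x ∈ X × F ∩ U ≡ U - x)

𝓛? : (k : ℕ) (X U V : Subset n) → Decidable (𝓛 k X U V)
𝓛? k X U V F =
    (sized? k F ×-dec X ⊆? F ×-dec nonempty? (F ∩ (V ─ X)))
  ⊎-dec (sized? k F ×-dec any? λ x → x ∈? X ×-dec ≡-dec _≟ᵇ_ (F ∩ U) (U - x))

-- The subset [m] of [n], consisting of the first m elements (all if m ≥ n).
initial : ∀ n → ℕ → Subset n
initial n m = tabulate λ i → does (toℕ i <? m)

𝓛[_,_,_,_,_] : (n k t u v : ℕ) → Family n
𝓛[ n , k , t , u , v ] = 𝓛 k (initial n t) (initial n (t + u)) (initial n (t + v))

𝓛[_,_,_,_,_]? : (n k t u v : ℕ) → Decidable 𝓛[ n , k , t , u , v ]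
𝓛[ n , k , t , u , v ]? = 𝓛? k (initial n t) (initial n (t + u)) (initial n (t + v))

{-# OPTIONS --safe #-}
module Submission where

-- Write C_j for the number of k-sets through a fixed (t + j)-set; the bound on n gives
-- 7k² C_{j+1} ≤ C_j.  The proof peels 𝓕 and 𝓖: replace them by generating families 𝓑 and 𝓒
-- of smaller and smaller sets, cross t-intersecting all the time.  When every generator of 𝓖
-- has at most t + j elements, the members of 𝓕 containing no cover of these generators of size
-- below t + j are found by branching at most j + 1 ways at each of j steps, so at most
-- C(t+j, j) (j+1)^j C_j of them are lost.  These losses decrease geometrically, and down to
-- generators of size t + 1 they add up to at most ¾ C_1, whereas |𝓕| is about v C_1 and |𝓖|
-- about u C_1.  Hence there are at least v and u generators of size t + 1 (unless one has size
-- t), any two from different families are equal or adjacent in the Johnson graph, and since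
-- (u, v) ≠ (3, 3) all of them contain a common t-set X or lie in a common (t + 2)-set Z.
-- The second case is (b), and there the diversities are too large for (a).  In the first, the
-- members of 𝓖 through X, about u C_1 in number, meet F ∖ X for every F ∈ 𝓕 not containing X;
-- so these F miss one element of X each and share u elements outside X, which is the bound (a).

open import Defs
open import Data.Bool using (true; false)
open import Data.Bool.Properties using () renaming (_≟_ to _≟ᵇ_)
open import Data.Fin as Fin using (Fin; zero; suc)
import Data.Fin.Properties as Fin
open import Data.Fin.Subset
open import Data.Fin.Subset.Properties
open import Data.List as List using (List; []; _∷_; length; filter)
open import Data.List.Extrema.Nat using (xs≤max; max≤v⁺)
open import Data.List.Membership.Propositional using (find; lose) renaming (_∈_ to _∈ˡ_)
open import Data.List.Membership.Propositional.Properties using (∈-map⁺; ∈-map⁻; ∈-++⁺ˡ; ∈-++⁺ʳ; ∈-filter⁺; ∈-filter⁻)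
open import Data.List.Properties using (length-map; length-++; filter-++; filter-none)
open import Data.List.Relation.Unary.All as All using (All; []; _∷_)
open import Data.List.Relation.Unary.AllPairs using ([]; _∷_)
open import Data.List.Relation.Unary.Any as Any using (Any; here; there)
open import Data.List.Relation.Unary.Unique.Propositional using (Unique)
import Data.List.Relation.Unary.Unique.Propositional.Properties as Unique
open import Data.Nat using (ℕ; zero; suc; _+_; _*_; _∸_; _^_; _≤_; _<_; _≥_; z≤n; s≤s; _≤?_; _<?_; _≟_)
open import Data.Nat.Combinatorics using (_C_; nCk+nC[k+1]≡[n+1]C[k+1]; k>n⇒nCk≡0; nC1≡n; nCk≡nC[n∸k])
open import Data.Nat.Properties
open import Data.Nat.Tactic.RingSolver using (solve-∀)
open import Data.Product using (∃; _×_; _,_; proj₁; proj₂)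
open import Data.Sum as Sum using (_⊎_; inj₁; inj₂; [_,_]′)
open import Data.Vec using ([]; _∷_; here; there; tabulate)
import Data.Vec.Properties as Vec
open import Function using (_∘_; case_of_)
open import Level using (0ℓ)
open import Relation.Binary.PropositionalEquality using (_≡_; _≢_; refl; sym; trans; cong; cong₂; subst; subst₂; module ≡-Reasoning)
open import Relation.Nullary using (¬_; Dec; yes; no; does; contradiction; _×-dec_; ¬?)
open import Relation.Nullary.Decidable using (decidable-stable; dec-true)
open import Relation.Unary using (Pred; Decidable; _≐_) renaming (_⊆_ to _⊆ᶠ_)

-- The factor 7 in the bound on n leaves just enough room for integrality. A family as large as the
-- model has m C_1 members up to C_1/14, peeling loses at most 3/4 of C_1, and the members that are
-- forced to contain one element more than a (t + 1)-set number at most k² C_2, which is at most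
-- C_1/7. In all this is 2/28 + 21/28 + 4/28 = 27/28 of C_1, so comparing m C_1 with s C_1 up to
-- these errors still yields m ≤ s. The pair (3, 3) is a real obstacle. Over a (t - 1)-set Y, the
-- generators Yab, Ycd, Yac on one side and Yac, Yad, Ybc on the other are equal or adjacent across
-- the two sides, yet they have no common t-set and lie in no common (t + 2)-set. A fourth generator
-- on either side rules this out. Of the model families only bounds are used: lower bounds on size
-- and diversity for the comparison, and diversity at most t C_2 to keep (a) apart from (b).

private
  variable
    n : ℕ

-- Sizes of finite sets under intersection, union and difference

∣p∣≡∣p∩q∣+∣p─q∣ : ∀ (p q : Subset n) → ∣ p ∣ ≡ ∣ p ∩ q ∣ + ∣ p ─ q ∣
∣p∣≡∣p∩q∣+∣p─q∣ []            []            = refl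
∣p∣≡∣p∩q∣+∣p─q∣ (inside  ∷ p) (inside  ∷ q) = cong suc (∣p∣≡∣p∩q∣+∣p─q∣ p q)
∣p∣≡∣p∩q∣+∣p─q∣ (inside  ∷ p) (outside ∷ q) =
  trans (cong suc (∣p∣≡∣p∩q∣+∣p─q∣ p q)) (sym (+-suc ∣ p ∩ q ∣ ∣ p ─ q ∣))
∣p∣≡∣p∩q∣+∣p─q∣ (outside ∷ p) (inside  ∷ q) = ∣p∣≡∣p∩q∣+∣p─q∣ p q
∣p∣≡∣p∩q∣+∣p─q∣ (outside ∷ p) (outside ∷ q) = ∣p∣≡∣p∩q∣+∣p─q∣ p q

∣p∪q∣+∣p∩q∣≡∣p∣+∣q∣ : ∀ (p q : Subset n) → ∣ p ∪ q ∣ + ∣ p ∩ q ∣ ≡ ∣ p ∣ + ∣ q ∣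
∣p∪q∣+∣p∩q∣≡∣p∣+∣q∣ []            []            = refl
∣p∪q∣+∣p∩q∣≡∣p∣+∣q∣ (inside  ∷ p) (inside  ∷ q) = cong suc
  (trans (+-suc ∣ p ∪ q ∣ ∣ p ∩ q ∣)
    (trans (cong suc (∣p∪q∣+∣p∩q∣≡∣p∣+∣q∣ p q)) (sym (+-suc ∣ p ∣ ∣ q ∣))))
∣p∪q∣+∣p∩q∣≡∣p∣+∣q∣ (inside  ∷ p) (outside ∷ q) = cong suc (∣p∪q∣+∣p∩q∣≡∣p∣+∣q∣ p q)
∣p∪q∣+∣p∩q∣≡∣p∣+∣q∣ (outside ∷ p) (inside  ∷ q) =
  trans (cong suc (∣p∪q∣+∣p∩q∣≡∣p∣+∣q∣ p q)) (sym (+-suc ∣ p ∣ ∣ q ∣))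
∣p∪q∣+∣p∩q∣≡∣p∣+∣q∣ (outside ∷ p) (outside ∷ q) = ∣p∪q∣+∣p∩q∣≡∣p∣+∣q∣ p q

x∈p─q⇒x∉q : ∀ (p q : Subset n) {x} → x ∈ p ─ q → x ∉ q
x∈p─q⇒x∉q (_ ∷ p) (outside ∷ q) here        ()
x∈p─q⇒x∉q (_ ∷ p) (_       ∷ q) (there x∈) (there x∈q) = x∈p─q⇒x∉q p q x∈ x∈q

x∈p-y⇒x≢y : ∀ (p : Subset n) {x} y → x ∈ p - y → x ≢ y
x∈p-y⇒x≢y p y x∈ refl = x∈p─q⇒x∉q p ⁅ y ⁆ x∈ (x∈⁅x⁆ y)

0<∣p∣⇒Nonempty : ∀ {p : Subset n} → 0 < ∣ p ∣ → Nonempty p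
0<∣p∣⇒Nonempty {n} {p = p} 0<∣p∣ with nonempty? p
... | yes ne = ne
... | no  em = contradiction (subst (λ q → 0 < ∣ q ∣) (Empty-unique em) 0<∣p∣)
                             (λ 0<0 → n≮0 (subst (0 <_) (∣⊥∣≡0 n) 0<0))

Nonempty⇒0<∣p∣ : ∀ {p : Subset n} → Nonempty p → 0 < ∣ p ∣
Nonempty⇒0<∣p∣ {p = p} (x , x∈p) = m<n⇒0<n (x∈p⇒∣p-x∣<∣p∣ x∈p)

⊆-card⇒⊇ : ∀ {p q : Subset n} → p ⊆ q → ∣ q ∣ ≤ ∣ p ∣ → q ⊆ p
⊆-card⇒⊇ {p = p} {q} p⊆q ∣q∣≤∣p∣ {x} x∈q with x ∈? p
... | yes x∈p = x∈p
... | no  x∉p = contradiction ∣q∣≤∣p∣ (<⇒≱ (p⊂q⇒∣p∣<∣q∣ (p⊆q , x , x∈q , x∉p)))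

⊈⇒∃ : ∀ {p q : Subset n} → ¬ (p ⊆ q) → ∃ λ x → x ∈ p × x ∉ q
⊈⇒∃ {p = p} {q} p⊈q with nonempty? (p ─ q)
... | yes (x , x∈) = x , p─q⊆p p q x∈ , x∈p─q⇒x∉q p q x∈
... | no  em       = contradiction (λ {x} x∈p → decidable-stable (x ∈? q)
                       (λ x∉q → em (x , x∈p∧x∉q⇒x∈p─q x∈p x∉q))) p⊈q

p⊆q⇒p∩q≡p : ∀ {p q : Subset n} → p ⊆ q → p ∩ q ≡ p
p⊆q⇒p∩q≡p {p = p} {q} p⊆q =
  ⊆-antisym (p∩q⊆p p q) (λ x∈p → x∈p∩q⁺ (x∈p , p⊆q x∈p))

⊆-∩ : ∀ {p q r : Subset n} → p ⊆ q → p ⊆ r → p ⊆ q ∩ r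
⊆-∩ p⊆q p⊆r x∈p = x∈p∩q⁺ (p⊆q x∈p , p⊆r x∈p)

∪-⊆ : ∀ {p q r : Subset n} → p ⊆ r → q ⊆ r → p ∪ q ⊆ r
∪-⊆ {p = p} {q} p⊆r q⊆r x∈ = [ p⊆r , q⊆r ]′ (x∈p∪q⁻ p q x∈)

⁅⁆-⊆ : ∀ {x} {p : Subset n} → x ∈ p → ⁅ x ⁆ ⊆ p
⁅⁆-⊆ {x = x} {p} x∈p y∈ = subst (_∈ p) (sym (x∈⁅y⁆⇒x≡y x y∈)) x∈p

Disjoint : Subset n → Subset n → Set
Disjoint p q = ∀ {x} → x ∈ p → x ∉ q

Disjoint⇒∣p∩q∣≡0 : ∀ {p q : Subset n} → Disjoint p q → ∣ p ∩ q ∣ ≡ 0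
Disjoint⇒∣p∩q∣≡0 {n} {p} {q} p#q = trans
  (cong ∣_∣ (Empty-unique λ (x , x∈) → let x∈p , x∈q = x∈p∩q⁻ p q x∈ in p#q x∈p x∈q))
  (∣⊥∣≡0 n)

∣p∪q∣≡∣p∣+∣q∣ : ∀ {p q : Subset n} → Disjoint p q → ∣ p ∪ q ∣ ≡ ∣ p ∣ + ∣ q ∣
∣p∪q∣≡∣p∣+∣q∣ {p = p} {q} p#q = trans
  (sym (trans (cong (∣ p ∪ q ∣ +_) (Disjoint⇒∣p∩q∣≡0 p#q)) (+-identityʳ _)))
  (∣p∪q∣+∣p∩q∣≡∣p∣+∣q∣ p q)

∣p∪q∣≤∣p∣+∣q∣ : ∀ (p q : Subset n) → ∣ p ∪ q ∣ ≤ ∣ p ∣ + ∣ q ∣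
∣p∪q∣≤∣p∣+∣q∣ p q = subst (∣ p ∪ q ∣ ≤_) (∣p∪q∣+∣p∩q∣≡∣p∣+∣q∣ p q) (m≤m+n _ _)

∣p∪⁅x⁆∣≡1+∣p∣ : ∀ {p : Subset n} {x} → x ∉ p → ∣ p ∪ ⁅ x ⁆ ∣ ≡ suc ∣ p ∣
∣p∪⁅x⁆∣≡1+∣p∣ {p = p} {x} x∉p = trans
  (∣p∪q∣≡∣p∣+∣q∣ λ y∈p y∈⁅x⁆ → x∉p (subst (_∈ p) (x∈⁅y⁆⇒x≡y x y∈⁅x⁆) y∈p))
  (trans (cong (∣ p ∣ +_) (∣⁅x⁆∣≡1 x)) (+-comm ∣ p ∣ 1))

1+∣p-x∣≡∣p∣ : ∀ {p : Subset n} {x} → x ∈ p → suc ∣ p - x ∣ ≡ ∣ p ∣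
1+∣p-x∣≡∣p∣ {p = p} {x} x∈p = sym (trans (∣p∣≡∣p∩q∣+∣p─q∣ p ⁅ x ⁆)
  (cong (_+ ∣ p - x ∣) (trans (cong ∣_∣ p∩⁅x⁆≡⁅x⁆) (∣⁅x⁆∣≡1 x))))
  where
  p∩⁅x⁆≡⁅x⁆ : p ∩ ⁅ x ⁆ ≡ ⁅ x ⁆
  p∩⁅x⁆≡⁅x⁆ = ⊆-antisym (p∩q⊆q p ⁅ x ⁆) (⊆-∩ (⁅⁆-⊆ x∈p) ⊆-refl)

∣p∣≤1+∣p-x∣ : ∀ (p : Subset n) x → ∣ p ∣ ≤ suc ∣ p - x ∣
∣p∣≤1+∣p-x∣ p x = subst₂ _≤_ (sym (∣p∣≡∣p∩q∣+∣p─q∣ p ⁅ x ⁆)) refl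
  (+-monoˡ-≤ ∣ p - x ∣ (≤-trans (∣p∩q∣≤∣q∣ p ⁅ x ⁆) (≤-reflexive (∣⁅x⁆∣≡1 x))))

∣p∩q∣+∣q─p∣≡∣q∣ : ∀ (p q : Subset n) → ∣ p ∩ q ∣ + ∣ q ─ p ∣ ≡ ∣ q ∣
∣p∩q∣+∣q─p∣≡∣q∣ p q =
  trans (cong (λ r → ∣ r ∣ + ∣ q ─ p ∣) (∩-comm p q)) (sym (∣p∣≡∣p∩q∣+∣p─q∣ q p))

∣∁p∣+∣p∣≡n : ∀ (p : Subset n) → ∣ ∁ p ∣ + ∣ p ∣ ≡ n
∣∁p∣+∣p∣≡n p = trans (cong (_+ ∣ p ∣) (∣∁p∣≡n∸∣p∣ p)) (m∸n+n≡m (∣p∣≤n p))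

⊆-of-card : ∀ {m} (p : Subset n) → m ≤ ∣ p ∣ → ∃ λ q → q ⊆ p × ∣ q ∣ ≡ m
⊆-of-card {n} {zero} p _ = ⊥ , ⊥⊆ , ∣⊥∣≡0 n
⊆-of-card {m = suc m} (outside ∷ p) m<∣p∣ =
  let q , q⊆p , ∣q∣≡ = ⊆-of-card p m<∣p∣ in outside ∷ q , out⊆ q⊆p , ∣q∣≡
⊆-of-card {m = suc m} (inside ∷ p) (s≤s m≤∣p∣) =
  let q , q⊆p , ∣q∣≡ = ⊆-of-card p m≤∣p∣ in inside ∷ q , in⊆in q⊆p , cong suc ∣q∣≡

-- A set as a duplicate-free list, so that it can index the unions in `card-⋃` and `card-Any-≥`.
elements : Subset n → List (Fin n)
elements []            = []
elements (inside  ∷ p) = zero ∷ List.map suc (elements p)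
elements (outside ∷ p) = List.map suc (elements p)

length-elements : ∀ (p : Subset n) → length (elements p) ≡ ∣ p ∣
length-elements []            = refl
length-elements (inside  ∷ p) = cong suc (trans (length-map suc (elements p)) (length-elements p))
length-elements (outside ∷ p) = trans (length-map suc (elements p)) (length-elements p)

∈-elements⁺ : ∀ {p : Subset n} {x} → x ∈ p → x ∈ˡ elements p
∈-elements⁺ {p = inside  ∷ p} here       = here refl
∈-elements⁺ {p = inside  ∷ p} (there x∈) = there (∈-map⁺ suc (∈-elements⁺ x∈))
∈-elements⁺ {p = outside ∷ p} (there x∈) = ∈-map⁺ suc (∈-elements⁺ x∈)

∈-elements⁻ : ∀ (p : Subset n) {x} → x ∈ˡ elements p → x ∈ p
∈-elements⁻ (inside ∷ p) (here refl) = here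
∈-elements⁻ (inside ∷ p) (there x∈) with y , y∈ , refl ← ∈-map⁻ suc x∈ = there (∈-elements⁻ p y∈)
∈-elements⁻ (outside ∷ p) x∈        with y , y∈ , refl ← ∈-map⁻ suc x∈ = there (∈-elements⁻ p y∈)

elements-unique : ∀ (p : Subset n) → Unique (elements p)
elements-unique []            = []
elements-unique (inside  ∷ p) =
  All.tabulate (λ x∈ 0≡x → let _ , _ , x≡suc = ∈-map⁻ suc x∈ in Fin.0≢1+n (trans 0≡x x≡suc))
  ∷ Unique.map⁺ Fin.suc-injective (elements-unique p)
elements-unique (outside ∷ p) = Unique.map⁺ Fin.suc-injective (elements-unique p)

-- Cardinalities of families

∈-subsets : ∀ (F : Subset n) → F ∈ˡ subsets n
∈-subsets []            = here refl
∈-subsets (inside  ∷ F) = ∈-++⁺ˡ (∈-map⁺ (inside ∷_) (∈-subsets F))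
∈-subsets (outside ∷ F) = ∈-++⁺ʳ (List.map (inside ∷_) (subsets _)) (∈-map⁺ (outside ∷_) (∈-subsets F))

module _ {A : Set} {P Q : Pred A 0ℓ} (P? : Decidable P) (Q? : Decidable Q) where

  length-filter-mono : (∀ {x} → P x → Q x) → ∀ xs → length (filter P? xs) ≤ length (filter Q? xs)
  length-filter-mono P⊆Q [] = z≤n
  length-filter-mono P⊆Q (x ∷ xs) with ih ← length-filter-mono P⊆Q xs | P? x | Q? x
  ... | yes p | yes q = s≤s ih
  ... | yes p | no ¬q = contradiction (P⊆Q p) ¬q
  ... | no ¬p | yes q = m≤n⇒m≤1+n ih
  ... | no ¬p | no ¬q = ih

  length-filter-strict : (∀ {x} → P x → Q x) → ∀ {xs y} → y ∈ˡ xs → Q y → ¬ P y →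
                         length (filter P? xs) < length (filter Q? xs)
  length-filter-strict P⊆Q {x ∷ xs} y∈ qy ¬py with P? x | Q? x
  length-filter-strict P⊆Q {x ∷ xs} (here refl) qy ¬py | yes p | _     = contradiction p ¬py
  length-filter-strict P⊆Q {x ∷ xs} (here refl) qy ¬py | _     | no ¬q = contradiction qy ¬q
  length-filter-strict P⊆Q {x ∷ xs} (here refl) qy ¬py | no _  | yes _ = s≤s (length-filter-mono P⊆Q xs)
  length-filter-strict P⊆Q {x ∷ xs} (there y∈)  qy ¬py | yes p | yes q =
    s≤s (length-filter-strict P⊆Q y∈ qy ¬py)
  length-filter-strict P⊆Q {x ∷ xs} (there y∈)  qy ¬py | yes p | no ¬q = contradiction (P⊆Q p) ¬q
  length-filter-strict P⊆Q {x ∷ xs} (there y∈)  qy ¬py | no _  | yes _ =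
    m≤n⇒m≤1+n (length-filter-strict P⊆Q y∈ qy ¬py)
  length-filter-strict P⊆Q {x ∷ xs} (there y∈)  qy ¬py | no _  | no _  =
    length-filter-strict P⊆Q y∈ qy ¬py

module _ {A : Set} {P Q R : Pred A 0ℓ}
         (P? : Decidable P) (Q? : Decidable Q) (R? : Decidable R) where

  length-filter-∪ : (∀ {x} → P x → Q x ⊎ R x) → ∀ xs →
    length (filter P? xs) ≤ length (filter Q? xs) + length (filter R? xs)
  length-filter-∪ P⊆Q∪R [] = z≤n
  length-filter-∪ P⊆Q∪R (x ∷ xs)
    with ih ← length-filter-∪ P⊆Q∪R xs | P? x | Q? x | R? x
  ... | yes p | no ¬q | no ¬r = contradiction (P⊆Q∪R p) [ ¬q , ¬r ]′
  ... | yes p | yes _ | yes _ = s≤s (≤-trans ih (+-monoʳ-≤ _ (n≤1+n _)))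
  ... | yes p | yes _ | no  _ = s≤s ih
  ... | yes p | no  _ | yes _ = ≤-trans (s≤s ih) (≤-reflexive (sym (+-suc _ _)))
  ... | no  _ | yes _ | yes _ = m≤n⇒m≤1+n (≤-trans ih (+-monoʳ-≤ _ (n≤1+n _)))
  ... | no  _ | yes _ | no  _ = m≤n⇒m≤1+n ih
  ... | no  _ | no  _ | yes _ = ≤-trans ih (+-monoʳ-≤ _ (n≤1+n _))
  ... | no  _ | no  _ | no  _ = ih

  length-filter-⊎ : (∀ {x} → Q x → P x) → (∀ {x} → R x → P x) → (∀ {x} → Q x → ¬ R x) → ∀ xs →
    length (filter Q? xs) + length (filter R? xs) ≤ length (filter P? xs)
  length-filter-⊎ Q⊆P R⊆P Q#R [] = z≤n
  length-filter-⊎ Q⊆P R⊆P Q#R (x ∷ xs)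
    with ih ← length-filter-⊎ Q⊆P R⊆P Q#R xs | P? x | Q? x | R? x
  ... | _     | yes q | yes r = contradiction r (Q#R q)
  ... | no ¬p | yes q | no  _ = contradiction (Q⊆P q) ¬p
  ... | no ¬p | no  _ | yes r = contradiction (R⊆P r) ¬p
  ... | yes _ | yes _ | no  _ = s≤s ih
  ... | yes _ | no  _ | yes _ = ≤-trans (≤-reflexive (+-suc _ _)) (s≤s ih)
  ... | yes _ | no  _ | no  _ = m≤n⇒m≤1+n ih
  ... | no  _ | no  _ | no  _ = ih

module _ {P Q : Family n} (P? : Decidable P) (Q? : Decidable Q) where

  card-mono : P ⊆ᶠ Q → card P? ≤ card Q?
  card-mono P⊆Q = length-filter-mono P? Q? P⊆Q (subsets n)

  card-cong : P ≐ Q → card P? ≡ card Q?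
  card-cong (P⊆Q , Q⊆P) = ≤-antisym (card-mono P⊆Q)
    (length-filter-mono Q? P? Q⊆P (subsets n))

  -- The source of uniqueness: wherever a counting bound is attained, this turns it into an equality
  -- of families.
  card-≤⇒⊇ : P ⊆ᶠ Q → card Q? ≤ card P? → Q ⊆ᶠ P
  card-≤⇒⊇ P⊆Q ≤P {F} qF = decidable-stable (P? F) λ ¬pF →
    <⇒≱ (length-filter-strict P? Q? P⊆Q (∈-subsets F) qF ¬pF) ≤P

  card-split : card P? ≤ card (λ F → P? F ×-dec Q? F) + card (λ F → P? F ×-dec ¬? (Q? F))
  card-split = length-filter-∪ P? _ _ (λ {F} p → case F p) (subsets n)
    where
    case : ∀ F → P F → (P F × Q F) ⊎ (P F × ¬ Q F)
    case F p with Q? F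
    ... | yes q = inj₁ (p , q)
    ... | no ¬q = inj₂ (p , ¬q)

module _ {P Q R : Family n} (P? : Decidable P) (Q? : Decidable Q) (R? : Decidable R) where

  card-∪ : (∀ {F} → P F → Q F ⊎ R F) → card P? ≤ card Q? + card R?
  card-∪ P⊆Q∪R = length-filter-∪ P? Q? R? P⊆Q∪R (subsets n)

  card-⊎ : Q ⊆ᶠ P → R ⊆ᶠ P → (∀ {F} → Q F → ¬ R F) → card Q? + card R? ≤ card P?
  card-⊎ Q⊆P R⊆P Q#R = length-filter-⊎ P? Q? R? Q⊆P R⊆P Q#R (subsets n)

card-empty : {P : Family n} (P? : Decidable P) → (∀ F → ¬ P F) → card P? ≡ 0
card-empty {n} P? ¬P = cong length (filter-none P? (All.tabulate {xs = subsets n} (λ {F} _ → ¬P F)))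

card-Any-≤ : {A : Set} {Q : A → Family n} (Q? : ∀ a → Decidable (Q a)) {M : ℕ} (as : List A) →
             (∀ {a} → a ∈ˡ as → card (Q? a) ≤ M) →
             card (λ F → Any.any? (λ a → Q? a F) as) ≤ length as * M
card-Any-≤ Q? [] _ = ≤-reflexive (card-empty (λ F → Any.any? (λ a → Q? a F) []) (λ _ ()))
card-Any-≤ Q? (a ∷ as) bound = ≤-trans
  (card-∪ (λ F → Any.any? (λ b → Q? b F) (a ∷ as)) (Q? a) (λ F → Any.any? (λ b → Q? b F) as)
    (λ { (here q) → inj₁ q ; (there q) → inj₂ q }))
  (+-mono-≤ (bound (here refl)) (card-Any-≤ Q? as (bound ∘ there)))

-- The union bound in the form that branching needs: each member of `P` only has to name one index
-- that catches it.
card-⋃ : {A : Set} {P : Family n} {Q : A → Family n} (P? : Decidable P) (Q? : ∀ a → Decidable (Q a))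
         {M : ℕ} (as : List A) → (∀ {a} → a ∈ˡ as → card (Q? a) ≤ M) →
         (∀ {F} → P F → ∃ λ a → a ∈ˡ as × Q a F) → card P? ≤ length as * M
card-⋃ P? Q? as bound cover = ≤-trans
  (card-mono P? (λ F → Any.any? (λ a → Q? a F) as) (λ p → let _ , a∈ , q = cover p in lose a∈ q))
  (card-Any-≤ Q? as bound)

card-Any-≥ : {A : Set} {Q : A → Family n} (Q? : ∀ a → Decidable (Q a)) {M : ℕ} {as : List A} →
             Unique as → (∀ {a} → a ∈ˡ as → M ≤ card (Q? a)) →
             (∀ {a b F} → a ∈ˡ as → b ∈ˡ as → Q a F → Q b F → a ≡ b) →
             length as * M ≤ card (λ F → Any.any? (λ a → Q? a F) as)
card-Any-≥ Q? [] _ _ = z≤n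
card-Any-≥ Q? {as = a ∷ as} (a∉ ∷ uniq) bound disj = ≤-trans
  (+-mono-≤ (bound (here refl)) (card-Any-≥ Q? uniq (bound ∘ there) (λ a∈ b∈ → disj (there a∈) (there b∈))))
  (card-⊎ (λ F → Any.any? (λ b → Q? b F) (a ∷ as)) (Q? a) (λ F → Any.any? (λ b → Q? b F) as)
    here there (λ q any → let b , b∈ , q′ = find any in
      All.lookup a∉ b∈ (disj (here refl) (there b∈) q q′)))

length-filter-map : {A B : Set} {P : Pred B 0ℓ} (P? : Decidable P) (f : A → B) → ∀ xs →
                    length (filter P? (List.map f xs)) ≡ length (filter (P? ∘ f) xs)
length-filter-map P? f [] = refl
length-filter-map P? f (x ∷ xs) with does (P? (f x))
... | true  = cong suc (length-filter-map P? f xs)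
... | false = length-filter-map P? f xs

card-∷ : {P : Family (suc n)} (P? : Decidable P) →
         card P? ≡ card (P? ∘ (inside ∷_)) + card (P? ∘ (outside ∷_))
card-∷ {n} P? = begin
  length (filter P? (List.map (inside ∷_) (subsets n) List.++ List.map (outside ∷_) (subsets n)))
    ≡⟨ cong length (filter-++ P? (List.map (inside ∷_) (subsets n)) _) ⟩
  length (filter P? (List.map (inside ∷_) (subsets n)) List.++ filter P? (List.map (outside ∷_) (subsets n)))
    ≡⟨ length-++ (filter P? (List.map (inside ∷_) (subsets n))) ⟩
  length (filter P? (List.map (inside ∷_) (subsets n))) + length (filter P? (List.map (outside ∷_) (subsets n)))
    ≡⟨ cong₂ _+_ (length-filter-map P? (inside ∷_) (subsets n)) (length-filter-map P? (outside ∷_) (subsets n)) ⟩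
  card (P? ∘ (inside ∷_)) + card (P? ∘ (outside ∷_)) ∎
  where open ≡-Reasoning

-- Sets of fixed size with a prescribed trace

Trace : ℕ → Subset n → Subset n → Family n
Trace k U W F = Sized k F × F ∩ U ≡ W

trace? : ∀ k (U W : Subset n) → Decidable (Trace k U W)
trace? k U W F = sized? k F ×-dec Vec.≡-dec _≟ᵇ_ (F ∩ U) W

-- Induction on the coordinates: on `U` the trace decides membership, off `U` Pascal's rule applies.
-- Here `m` counts the coordinates off `U` and `r` the elements still to be chosen among them.
card-trace : ∀ (U W : Subset n) {m k r} → W ⊆ U → m + ∣ U ∣ ≡ n → ∣ W ∣ + r ≡ k →
             card (trace? k U W) ≡ m C r
card-trace [] [] {zero} {r = zero}  _ _ refl = refl
card-trace [] [] {zero} {r = suc r} _ _ refl = refl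
card-trace (inside ∷ U) (inside ∷ W) {m} {r = r} W⊆U m+ refl = begin
  card (trace? (suc (∣ W ∣ + r)) (inside ∷ U) (inside ∷ W))
    ≡⟨ card-∷ (trace? _ (inside ∷ U) (inside ∷ W)) ⟩
  card (trace? (suc (∣ W ∣ + r)) (inside ∷ U) (inside ∷ W) ∘ (inside ∷_)) +
  card (trace? (suc (∣ W ∣ + r)) (inside ∷ U) (inside ∷ W) ∘ (outside ∷_))
    ≡⟨ cong₂ _+_
         (card-cong _ (trace? (∣ W ∣ + r) U W)
           ( (λ (s , e) → suc-injective s , Vec.∷-injectiveʳ e)
           , (λ (s , e) → cong suc s , cong (inside ∷_) e)))
         (card-empty (trace? (suc (∣ W ∣ + r)) (inside ∷ U) (inside ∷ W) ∘ (outside ∷_))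
           (λ F (s , e) → case Vec.∷-injectiveˡ e of λ ())) ⟩
  card (trace? (∣ W ∣ + r) U W) + 0
    ≡⟨ +-identityʳ _ ⟩
  card (trace? (∣ W ∣ + r) U W)
    ≡⟨ card-trace U W (drop-∷-⊆ W⊆U) (suc-injective (trans (sym (+-suc m ∣ U ∣)) m+)) refl ⟩
  m C r ∎
  where open ≡-Reasoning
card-trace (inside ∷ U) (outside ∷ W) {m} {r = r} W⊆U m+ refl = begin
  card (trace? (∣ W ∣ + r) (inside ∷ U) (outside ∷ W))
    ≡⟨ card-∷ (trace? _ (inside ∷ U) (outside ∷ W)) ⟩
  card (trace? (∣ W ∣ + r) (inside ∷ U) (outside ∷ W) ∘ (inside ∷_)) +
  card (trace? (∣ W ∣ + r) (inside ∷ U) (outside ∷ W) ∘ (outside ∷_))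
    ≡⟨ cong₂ _+_
         (card-empty (trace? (∣ W ∣ + r) (inside ∷ U) (outside ∷ W) ∘ (inside ∷_))
           (λ F (s , e) → case Vec.∷-injectiveˡ e of λ ()))
         (card-cong _ (trace? (∣ W ∣ + r) U W)
           ((λ (s , e) → s , Vec.∷-injectiveʳ e) , (λ (s , e) → s , cong (outside ∷_) e))) ⟩
  card (trace? (∣ W ∣ + r) U W)
    ≡⟨ card-trace U W (drop-∷-⊆ W⊆U) (suc-injective (trans (sym (+-suc m ∣ U ∣)) m+)) refl ⟩
  m C r ∎
  where open ≡-Reasoning
card-trace (outside ∷ U) (inside ∷ W) W⊆U = case W⊆U here of λ ()
card-trace {suc n} (outside ∷ U) (outside ∷ W) {zero} W⊆U m+ _ =
  contradiction (≤-trans (≤-reflexive (sym m+)) (∣p∣≤n U)) (<-irrefl refl)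
card-trace (outside ∷ U) (outside ∷ W) {suc m} {r = zero} W⊆U m+ refl = begin
  card (trace? (∣ W ∣ + 0) (outside ∷ U) (outside ∷ W))
    ≡⟨ card-∷ (trace? _ (outside ∷ U) (outside ∷ W)) ⟩
  card (trace? (∣ W ∣ + 0) (outside ∷ U) (outside ∷ W) ∘ (inside ∷_)) +
  card (trace? (∣ W ∣ + 0) (outside ∷ U) (outside ∷ W) ∘ (outside ∷_))
    ≡⟨ cong₂ _+_
         -- The trace already uses up all `∣ W ∣` elements, so a further one off `U` is impossible.
         (card-empty (trace? (∣ W ∣ + 0) (outside ∷ U) (outside ∷ W) ∘ (inside ∷_))
           (λ F (s , e) → <⇒≱ (≤-reflexive (trans s (+-identityʳ _)))
             (≤-trans (≤-reflexive (cong ∣_∣ (sym (Vec.∷-injectiveʳ e)))) (∣p∩q∣≤∣p∣ F U))))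
         (card-cong _ (trace? (∣ W ∣ + 0) U W)
           ((λ (s , e) → s , Vec.∷-injectiveʳ e) , (λ (s , e) → s , cong (outside ∷_) e))) ⟩
  card (trace? (∣ W ∣ + 0) U W)
    ≡⟨ card-trace U W {m} (drop-∷-⊆ W⊆U) (suc-injective m+) refl ⟩
  m C 0 ≡⟨⟩
  suc m C 0 ∎
  where open ≡-Reasoning
card-trace (outside ∷ U) (outside ∷ W) {suc m} {r = suc r} W⊆U m+ refl = begin
  card (trace? (∣ W ∣ + suc r) (outside ∷ U) (outside ∷ W))
    ≡⟨ card-∷ (trace? _ (outside ∷ U) (outside ∷ W)) ⟩
  card (trace? (∣ W ∣ + suc r) (outside ∷ U) (outside ∷ W) ∘ (inside ∷_)) +
  card (trace? (∣ W ∣ + suc r) (outside ∷ U) (outside ∷ W) ∘ (outside ∷_))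
    ≡⟨ cong₂ _+_
         (card-cong _ (trace? (∣ W ∣ + r) U W)
           ( (λ (s , e) → suc-injective (trans s (+-suc ∣ W ∣ r)) , Vec.∷-injectiveʳ e)
           , (λ (s , e) → trans (cong suc s) (sym (+-suc ∣ W ∣ r)) , cong (outside ∷_) e)))
         (card-cong _ (trace? (∣ W ∣ + suc r) U W)
           ((λ (s , e) → s , Vec.∷-injectiveʳ e) , (λ (s , e) → s , cong (outside ∷_) e))) ⟩
  card (trace? (∣ W ∣ + r) U W) + card (trace? (∣ W ∣ + suc r) U W)
    ≡⟨ cong₂ _+_ (card-trace U W {m} (drop-∷-⊆ W⊆U) (suc-injective m+) refl)
                 (card-trace U W {m} (drop-∷-⊆ W⊆U) (suc-injective m+) refl) ⟩
  m C r + m C suc r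
    ≡⟨ nCk+nC[k+1]≡[n+1]C[k+1] m r ⟩
  suc m C suc r ∎
  where open ≡-Reasoning

subset-of? : ∀ (A : Subset n) m → Decidable (λ T → Sized m T × T ⊆ A)
subset-of? A m T = sized? m T ×-dec T ⊆? A

-- A set lies in `A` exactly when its trace on the complement of `A` is empty.
card-subsets-of : ∀ (A : Subset n) m → card (subset-of? A m) ≡ ∣ A ∣ C m
card-subsets-of {n} A m = trans
  (card-cong (subset-of? A m) (trace? m (∁ A) ⊥)
    ( (λ {F} (s , F⊆A) → s , Empty-unique λ (x , x∈) →
         let x∈F , x∈∁A = x∈p∩q⁻ F (∁ A) x∈ in x∈∁p⇒x∉p x∈∁A (F⊆A x∈F))
    , (λ {F} (s , e) → s , λ {x} x∈F → x∉∁p⇒x∈p λ x∈∁A → ∉⊥ (subst (x ∈_) e (x∈p∩q⁺ (x∈F , x∈∁A))))))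
  (card-trace (∁ A) ⊥ ⊥⊆ (trans (+-comm ∣ A ∣ _) (∣∁p∣+∣p∣≡n A)) (cong (_+ m) (∣⊥∣≡0 n)))

-- Binomial coefficients

-- The absorption identity. Both the ratio of consecutive `c j` and the growth of `branches` come
-- from it.
[k+1]*[n+1]C[k+1]≡[n+1]*nCk : ∀ m r → suc r * (suc m C suc r) ≡ suc m * (m C r)
[k+1]*[n+1]C[k+1]≡[n+1]*nCk zero zero = refl
[k+1]*[n+1]C[k+1]≡[n+1]*nCk zero (suc r) = begin
  suc (suc r) * (1 C suc (suc r)) ≡⟨ cong (suc (suc r) *_) (k>n⇒nCk≡0 {1} {suc (suc r)} (s≤s (s≤s z≤n))) ⟩
  suc (suc r) * 0                 ≡⟨ *-zeroʳ r ⟩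
  0                               ≡⟨ cong (_+ 0) (k>n⇒nCk≡0 {0} {suc r} (s≤s z≤n)) ⟨
  1 * (0 C suc r)                 ∎
  where open ≡-Reasoning
[k+1]*[n+1]C[k+1]≡[n+1]*nCk (suc m) zero =
  trans (+-identityʳ _) (trans (nC1≡n (suc (suc m))) (sym (*-identityʳ _)))
[k+1]*[n+1]C[k+1]≡[n+1]*nCk (suc m) (suc r) = begin
  suc (suc r) * (suc (suc m) C suc (suc r))
    ≡⟨ cong (suc (suc r) *_) (nCk+nC[k+1]≡[n+1]C[k+1] (suc m) (suc r)) ⟨
  suc (suc r) * (a + suc m C suc (suc r))
    ≡⟨ *-distribˡ-+ (suc (suc r)) a (suc m C suc (suc r)) ⟩
  (a + suc r * a) + suc (suc r) * (suc m C suc (suc r))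
    ≡⟨ cong₂ (λ x y → (a + x) + y) ([k+1]*[n+1]C[k+1]≡[n+1]*nCk m r) ([k+1]*[n+1]C[k+1]≡[n+1]*nCk m (suc r)) ⟩
  (a + suc m * (m C r)) + suc m * (m C suc r)
    ≡⟨ +-assoc a _ _ ⟩
  a + (suc m * (m C r) + suc m * (m C suc r))
    ≡⟨ cong (a +_) (*-distribˡ-+ (suc m) (m C r) (m C suc r)) ⟨
  a + suc m * (m C r + m C suc r)
    ≡⟨ cong (λ x → a + suc m * x) (nCk+nC[k+1]≡[n+1]C[k+1] m r) ⟩
  suc (suc m) * a ∎
  where
  open ≡-Reasoning
  a = suc m C suc r

0<nCk : ∀ {m r} → r ≤ m → 0 < m C r
0<nCk {m} {zero} _ = ≤-refl
0<nCk {suc m} {suc r} (s≤s r≤m) = subst (0 <_) (nCk+nC[k+1]≡[n+1]C[k+1] m r)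
  (≤-trans (0<nCk r≤m) (m≤m+n _ _))

nCk-monoˡ : ∀ {m m′} r → m ≤ m′ → m C r ≤ m′ C r
nCk-monoˡ {zero} {_} zero _ = ≤-refl
nCk-monoˡ {zero} {m′} (suc r) _ = subst (_≤ m′ C suc r) (sym (k>n⇒nCk≡0 {0} {suc r} (s≤s z≤n))) z≤n
nCk-monoˡ {suc m} {suc m′} zero _ = ≤-refl
nCk-monoˡ {suc m} {suc m′} (suc r) (s≤s m≤m′) =
  subst₂ _≤_ (nCk+nC[k+1]≡[n+1]C[k+1] m r) (nCk+nC[k+1]≡[n+1]C[k+1] m′ r)
    (+-mono-≤ (nCk-monoˡ r m≤m′) (nCk-monoˡ (suc r) m≤m′))

2*nC2≤n*n : ∀ m → 2 * (m C 2) ≤ m * m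
2*nC2≤n*n zero = subst (_≤ 0) (cong (2 *_) (sym (k>n⇒nCk≡0 {0} {2} (s≤s z≤n)))) z≤n
2*nC2≤n*n (suc m) = ≤-trans
  (≤-reflexive (trans ([k+1]*[n+1]C[k+1]≡[n+1]*nCk m 1) (cong (suc m *_) (nC1≡n m))))
  (*-monoʳ-≤ (suc m) (n≤1+n m))

-- Bernoulli's inequality for (1 - 1/(m + 1))^l with denominators cleared; `d` is m + 1 - l.
[1+m]^l*[1+m-l]≤m^l*[1+m] : ∀ m l d → l + d ≡ suc m → suc m ^ l * d ≤ m ^ l * suc m
[1+m]^l*[1+m-l]≤m^l*[1+m] m zero d refl = ≤-refl
[1+m]^l*[1+m-l]≤m^l*[1+m] m (suc l) d l+d≡ = begin
  suc m * suc m ^ l * d     ≡⟨ lem₁ (suc m) (suc m ^ l) d ⟩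
  suc m ^ l * (suc m * d)   ≤⟨ *-monoʳ-≤ (suc m ^ l) [1+m]*d≤m*[1+d] ⟩
  suc m ^ l * (m * suc d)   ≡⟨ lem₂ (suc m ^ l) m (suc d) ⟩
  m * (suc m ^ l * suc d)   ≤⟨ *-monoʳ-≤ m ([1+m]^l*[1+m-l]≤m^l*[1+m] m l (suc d) (trans (+-suc l d) l+d≡)) ⟩
  m * (m ^ l * suc m)       ≡⟨ *-assoc m (m ^ l) (suc m) ⟨
  m * m ^ l * suc m         ∎
  where
  open ≤-Reasoning
  lem₁ : ∀ a b c → a * b * c ≡ b * (a * c)
  lem₁ = solve-∀
  lem₂ : ∀ a b c → a * (b * c) ≡ b * (a * c)
  lem₂ = solve-∀
  d≤m : d ≤ m
  d≤m = ≤-trans (m≤n+m d l) (≤-reflexive (suc-injective l+d≡))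
  [1+m]*d≤m*[1+d] : suc m * d ≤ m * suc d
  [1+m]*d≤m*[1+d] = subst (suc m * d ≤_) (sym (*-suc m d)) (+-monoˡ-≤ (m * d) d≤m)

-- In `branches` the base grows together with the exponent; this charges the growth of the base to a
-- single extra factor.
[1+m]^m≤m^m*[1+m] : ∀ m → suc m ^ m ≤ m ^ m * suc m
[1+m]^m≤m^m*[1+m] m = subst (_≤ m ^ m * suc m) (*-identityʳ (suc m ^ m))
  ([1+m]^l*[1+m-l]≤m^l*[1+m] m m 1 (+-comm m 1))

-- Counting k-sets when n is large

record Range (n k t : ℕ) : Set where
  field
    2≤t   : 2 ≤ t
    -- Stronger than `k ≥ t + 2`: since (u, v) ≠ (3, 3), one of the two is at least 4 and at most
    -- `k ∸ t + 1`.
    t+3≤k : t + 3 ≤ k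
    large : 7 * (k * k) * suc (k ∸ t) ≤ n

Containing : ℕ → Subset n → Family n
Containing k S F = Sized k F × S ⊆ F

containing? : ∀ k (S : Subset n) → Decidable (Containing k S)
containing? k S F = sized? k F ×-dec S ⊆? F

module Counting {n k t : ℕ} (range : Range n k t) where
  open Range range public

  -- The number of k-sets through a fixed (t + j)-set.
  c : ℕ → ℕ
  c j = (n ∸ (t + j)) C (k ∸ (t + j))

  5≤k : 5 ≤ k
  5≤k = ≤-trans (+-monoˡ-≤ 3 2≤t) t+3≤k

  t≤k : t ≤ k
  t≤k = m+n≤o⇒m≤o t t+3≤k

  t+1≤k : t + 1 ≤ k
  t+1≤k = ≤-trans (+-monoʳ-≤ t (s≤s z≤n)) t+3≤k

  t+2≤k : t + 2 ≤ k
  t+2≤k = ≤-trans (+-monoʳ-≤ t (s≤s (s≤s z≤n))) t+3≤k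

  k≤k*k : k ≤ k * k
  k≤k*k = ≤-trans (≤-reflexive (sym (*-identityʳ k))) (*-monoʳ-≤ k (≤-trans (s≤s z≤n) 5≤k))

  7*k*k≤n : 7 * (k * k) ≤ n
  7*k*k≤n = ≤-trans (≤-trans (≤-reflexive (sym (*-identityʳ _))) (*-monoʳ-≤ (7 * (k * k)) (s≤s z≤n))) large

  7*k≤n : 7 * k ≤ n
  7*k≤n = ≤-trans (*-monoʳ-≤ 7 k≤k*k) 7*k*k≤n

  k≤n : k ≤ n
  k≤n = ≤-trans (m≤n*m k 7) 7*k≤n

  0<c : ∀ j → 0 < c j
  0<c j = 0<nCk (∸-monoˡ-≤ (t + j) k≤n)

  -- By absorption the ratio of the two counts is (n - t - j)/(k - t - j). Of the k - t + 1 blocks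
  -- of size 7k² in `large`, one pays for subtracting t + j from n and the others give the ratio.
  7k²c[j+1]≤c[j] : ∀ {j} → t + suc j ≤ k → 7 * (k * k) * c (suc j) ≤ c j
  7k²c[j+1]≤c[j] {j} t+1+j≤k = *-cancelˡ-≤ (suc R) (begin
    suc R * (7 * (k * k) * c (suc j))  ≡⟨ lem (suc R) (7 * (k * k)) (c (suc j)) ⟩
    7 * (k * k) * suc R * c (suc j)    ≤⟨ *-monoˡ-≤ (c (suc j)) R-A ⟩
    suc A * c (suc j)                  ≡⟨ [k+1]*[n+1]C[k+1]≡[n+1]*nCk A R ⟨
    suc R * (suc A C suc R)            ≡⟨ cong₂ (λ x y → suc R * (x C y)) (1+∸ (≤-trans t+1+j≤k k≤n)) (1+∸ t+1+j≤k) ⟩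
    suc R * c j                        ∎)
    where
    open ≤-Reasoning
    A = n ∸ (t + suc j)
    R = k ∸ (t + suc j)
    lem : ∀ a b d → a * (b * d) ≡ b * a * d
    lem = solve-∀
    1+∸ : ∀ {m} → t + suc j ≤ m → suc (m ∸ (t + suc j)) ≡ m ∸ (t + j)
    1+∸ {m} le = trans (cong (λ x → suc (m ∸ x)) (+-suc t j))
      (sym (+-∸-assoc 1 (≤-trans (≤-reflexive (sym (+-suc t j))) le)))
    R-A : 7 * (k * k) * suc R ≤ suc A
    R-A = subst₂ _≤_ (cong (7 * (k * k) *_) (sym (1+∸ t+1+j≤k))) (sym (1+∸ (≤-trans t+1+j≤k k≤n)))
      (begin
      7 * (k * k) * (k ∸ (t + j))                     ≤⟨ *-monoʳ-≤ (7 * (k * k)) (∸-monoʳ-≤ k (m≤m+n t j)) ⟩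
      7 * (k * k) * (k ∸ t)                           ≡⟨ m+n∸m≡n (7 * (k * k)) _ ⟨
      7 * (k * k) + 7 * (k * k) * (k ∸ t) ∸ 7 * (k * k) ≡⟨ cong (_∸ 7 * (k * k)) (*-suc (7 * (k * k)) (k ∸ t)) ⟨
      7 * (k * k) * suc (k ∸ t) ∸ 7 * (k * k)         ≤⟨ ∸-monoˡ-≤ (7 * (k * k)) large ⟩
      n ∸ 7 * (k * k)                                 ≤⟨ ∸-monoʳ-≤ n (≤-trans (m+n≤o⇒m≤o (t + j) (≤-trans (≤-reflexive (trans (+-assoc t j 1) (cong (t +_) (+-comm j 1)))) t+1+j≤k)) (≤-trans k≤k*k (m≤n*m (k * k) 7))) ⟩
      n ∸ (t + j) ∎)

  7k²c₂≤c₁ : 7 * (k * k) * c 2 ≤ c 1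
  7k²c₂≤c₁ = 7k²c[j+1]≤c[j] t+2≤k

  card-containing : ∀ {S j} → ∣ S ∣ ≡ t + j → t + j ≤ k → card (containing? {n} k S) ≡ c j
  card-containing {S} {j} ∣S∣≡ t+j≤k = trans
    (card-cong (containing? k S) (trace? k S S)
      ( (λ (s , S⊆F) → s , trans (∩-comm _ S) (p⊆q⇒p∩q≡p S⊆F))
      , (λ {F} (s , e) → s , ⊆-trans (⊆-reflexive (sym e)) (p∩q⊆p F S))))
    (card-trace S S ⊆-refl
      (trans (cong (n ∸ (t + j) +_) ∣S∣≡) (m∸n+n≡m (≤-trans t+j≤k k≤n)))
      (trans (cong (_+ (k ∸ (t + j))) ∣S∣≡) (m+[n∸m]≡n t+j≤k)))

  card-containing-≤ : ∀ {S j} → t + j ≤ ∣ S ∣ → t + j ≤ k → card (containing? {n} k S) ≤ c j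
  card-containing-≤ {S} {j} t+j≤∣S∣ t+j≤k with S′ , S′⊆S , ∣S′∣≡ ← ⊆-of-card S t+j≤∣S∣ =
    ≤-trans (card-mono (containing? k S) (containing? k S′) (λ (s , S⊆F) → s , ⊆-trans S′⊆S S⊆F))
            (≤-reflexive (card-containing ∣S′∣≡ t+j≤k))

  card-⊆-≤ : ∀ {P : Family n} (P? : Decidable P) {S j} → t + j ≤ ∣ S ∣ → t + j ≤ k →
             P ⊆ᶠ Containing k S → card P? ≤ c j
  card-⊆-≤ P? {S} t+j≤∣S∣ t+j≤k P⊆ =
    ≤-trans (card-mono P? (containing? k S) P⊆) (card-containing-≤ t+j≤∣S∣ t+j≤k)

  Hit : Subset n → Subset n → Family n
  Hit X V F = Sized k F × X ⊆ F × Nonempty (F ∩ (V ─ X))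

  hit? : ∀ X V → Decidable (Hit X V)
  hit? X V F = sized? k F ×-dec X ⊆? F ×-dec nonempty? (F ∩ (V ─ X))

  card-hit-≤ : ∀ {X V m} → ∣ X ∣ ≡ t → ∣ V ─ X ∣ ≤ m → card (hit? X V) ≤ m * c 1
  card-hit-≤ {X} {V} {m} ∣X∣≡t ∣V─X∣≤m = ≤-trans
    (card-⋃ (hit? X V) (λ x → containing? k (X ∪ ⁅ x ⁆)) (elements (V ─ X))
      (λ {x} x∈ → card-containing-≤
        (≤-reflexive (trans (+-comm t 1) (trans (cong suc (sym ∣X∣≡t))
          (sym (∣p∪⁅x⁆∣≡1+∣p∣ (x∈p─q⇒x∉q V X (∈-elements⁻ (V ─ X) x∈)))))))
        t+1≤k)
      (λ {F} (s , X⊆F , x , x∈) → let x∈F , x∈V─X = x∈p∩q⁻ F (V ─ X) x∈ in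
        x , ∈-elements⁺ x∈V─X , s , ∪-⊆ X⊆F (⁅⁆-⊆ x∈F)))
    (*-monoˡ-≤ (c 1) (≤-trans (≤-reflexive (length-elements (V ─ X))) ∣V─X∣≤m))

  -- Bonferroni's inequality: the m families through `X` and one further element overlap pairwise in
  -- `c 2` sets. Everything is doubled to avoid halves, and m(m - 1) is rounded up to m².
  card-hit-≥ : ∀ {X V m} → ∣ X ∣ ≡ t → m ≤ ∣ V ─ X ∣ → 2 * (m * c 1) ≤ 2 * card (hit? X V) + m * m * c 2
  card-hit-≥ {X} {V} {m} ∣X∣≡t m≤ with Y , Y⊆ , refl ← ⊆-of-card (V ─ X) m≤ =
    ≤-trans (subst (λ m → 2 * (m * c 1) ≤ 2 * card (hit-any? (elements Y)) + m * m * c 2)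
      (length-elements Y) (bonferroni (elements-unique Y) (λ y∈ → Y∌X (∈-elements⁻ Y y∈))))
    (+-monoˡ-≤ (∣ Y ∣ * ∣ Y ∣ * c 2) (*-monoʳ-≤ 2 (card-mono (hit-any? (elements Y)) (hit? X V)
      (λ (s , X⊆F , any) → s , X⊆F , let y , y∈ , y∈F = find any in
        y , x∈p∩q⁺ (y∈F , Y⊆ (∈-elements⁻ Y y∈))))))
    where
    Y∌X : ∀ {y} → y ∈ Y → y ∉ X
    Y∌X y∈Y = x∈p─q⇒x∉q V X (Y⊆ y∈Y)
    hit-any? : ∀ ys → Decidable (λ F → Sized k F × X ⊆ F × Any (_∈ F) ys)
    hit-any? ys F = sized? k F ×-dec X ⊆? F ×-dec Any.any? (_∈? F) ys
    bonferroni : ∀ {ys} → Unique ys → (∀ {y} → y ∈ˡ ys → y ∉ X) →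
      2 * (length ys * c 1) ≤ 2 * card (hit-any? ys) + length ys * length ys * c 2
    bonferroni [] _ = z≤n
    bonferroni {y ∷ ys} (y∉ys ∷ uniq) ∉X = begin
      2 * (c 1 + l * c 1)                          ≡⟨ *-distribˡ-+ 2 (c 1) (l * c 1) ⟩
      2 * c 1 + 2 * (l * c 1)                      ≤⟨ +-mono-≤ (*-monoʳ-≤ 2 c₁≤) (bonferroni uniq (∉X ∘ there)) ⟩
      -- The spare `c 2` completes the square l² + 2l + 1.
      2 * (l * c 2 + B) + (2 * H + l * l * c 2)    ≤⟨ m≤m+n _ (c 2) ⟩
      2 * (l * c 2 + B) + (2 * H + l * l * c 2) + c 2 ≡⟨ lem l (c 2) B H ⟩
      2 * (H + B) + suc l * suc l * c 2            ≤⟨ +-monoˡ-≤ (suc l * suc l * c 2) (*-monoʳ-≤ 2 H+B≤) ⟩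
      2 * card (hit-any? (y ∷ ys)) + suc l * suc l * c 2 ∎
      where
      open ≤-Reasoning
      l = length ys
      S = X ∪ ⁅ y ⁆
      ∣S∣ : ∣ S ∣ ≡ t + 1
      ∣S∣ = trans (∣p∪⁅x⁆∣≡1+∣p∣ (∉X (here refl))) (trans (cong suc ∣X∣≡t) (+-comm 1 t))
      any? : Decidable (λ F → Any (_∈ F) ys)
      any? F = Any.any? (_∈? F) ys
      H = card (hit-any? ys)
      B = card (λ F → containing? k S F ×-dec ¬? (any? F))
      lem : ∀ l c B H → 2 * (l * c + B) + (2 * H + l * l * c) + c ≡ 2 * (H + B) + suc l * suc l * c
      lem = solve-∀
      c₁≤ : c 1 ≤ l * c 2 + B
      c₁≤ = begin
        c 1                       ≡⟨ card-containing ∣S∣ t+1≤k ⟨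
        card (containing? k S)    ≤⟨ card-split (containing? k S) any? ⟩
        card (λ F → containing? k S F ×-dec any? F) + B ≤⟨ +-monoˡ-≤ B
          (card-⋃ (λ F → containing? k S F ×-dec any? F) (λ z → containing? k (S ∪ ⁅ z ⁆)) ys
            (λ {z} z∈ → card-containing-≤ (≤-reflexive (trans (+-suc t 1) (trans (cong suc (sym ∣S∣)) (sym (∣p∪⁅x⁆∣≡1+∣p∣
              (λ z∈S → [ ∉X (there z∈) , (λ z∈⁅y⁆ → All.lookup y∉ys z∈ (sym (x∈⁅y⁆⇒x≡y y z∈⁅y⁆))) ]′ (x∈p∪q⁻ X ⁅ y ⁆ z∈S))))))) t+2≤k)
            (λ ((s , S⊆F) , any) → let z , z∈ , z∈F = find any in z , z∈ , s , ∪-⊆ S⊆F (⁅⁆-⊆ z∈F))) ⟩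
        l * c 2 + B ∎
      H+B≤ : H + B ≤ card (hit-any? (y ∷ ys))
      H+B≤ = card-⊎ (hit-any? (y ∷ ys)) (hit-any? ys) (λ F → containing? k S F ×-dec ¬? (any? F))
        (λ (s , X⊆F , any) → s , X⊆F , there any)
        (λ ((s , S⊆F) , _) → s , ⊆-trans (p⊆p∪q ⁅ y ⁆) S⊆F , here (S⊆F (q⊆p∪q X ⁅ y ⁆ (x∈⁅x⁆ y))))
        (λ (_ , _ , any) (_ , ¬any) → ¬any any)

  Missing : Subset n → Subset n → Family n
  Missing X U F = Sized k F × ∃ λ x → x ∈ X × F ∩ U ≡ U - x

  missing? : ∀ X U → Decidable (Missing X U)
  missing? X U F = sized? k F ×-dec Fin.any? λ x → x ∈? X ×-dec Vec.≡-dec _≟ᵇ_ (F ∩ U) (U - x)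

  -- `card-hit v` and `card-missing u` are the two parts of the closed formula for the size of
  -- 𝓛(n,k,t,u,v). In the latter, `suc k ∸ (t + u)` is k - u - t + 1 without a truncated
  -- intermediate value, as t + u may equal k + 1.
  card-hit : ℕ → ℕ
  card-hit v = c 0 ∸ ((n ∸ (t + v)) C (k ∸ t))

  card-missing : ℕ → ℕ
  card-missing u = t * ((n ∸ (t + u)) C (suc k ∸ (t + u)))

  card-hit-≡ : ∀ {X V v} → ∣ X ∣ ≡ t → X ⊆ V → ∣ V ∣ ≡ t + v → card (hit? X V) ≡ card-hit v
  card-hit-≡ {X} {V} {v} ∣X∣≡t X⊆V ∣V∣≡ = sym (begin
    c 0 ∸ T                                       ≡⟨ cong₂ _∸_ (sym (card-containing (trans ∣X∣≡t (sym (+-identityʳ t))) (≤-trans (≤-reflexive (+-identityʳ t)) t≤k))) (sym T≡) ⟩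
    card (containing? k X) ∸ card (trace? k V X)  ≡⟨ cong (_∸ card (trace? k V X)) (≤-antisym
        (card-∪ (containing? k X) (hit? X V) (trace? k V X) split)
        (card-⊎ (containing? k X) (hit? X V) (trace? k V X) (λ (s , X⊆F , _) → s , X⊆F)
          (λ {F} (s , e) → s , ⊆-trans (⊆-reflexive (sym e)) (p∩q⊆p F V))
          (λ {F} (_ , _ , x , x∈) (_ , e) → let x∈F , x∈V─X = x∈p∩q⁻ F (V ─ X) x∈ in
            x∈p─q⇒x∉q V X x∈V─X (subst (x ∈_) e (x∈p∩q⁺ (x∈F , p─q⊆p V X x∈V─X)))))) ⟩
    card (hit? X V) + card (trace? k V X) ∸ card (trace? k V X) ≡⟨ m+n∸n≡m _ (card (trace? k V X)) ⟩
    card (hit? X V) ∎)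
    where
    open ≡-Reasoning
    T = (n ∸ (t + v)) C (k ∸ t)
    T≡ : card (trace? k V X) ≡ T
    T≡ = card-trace V X X⊆V
      (trans (cong (n ∸ (t + v) +_) ∣V∣≡) (m∸n+n≡m (subst (_≤ n) ∣V∣≡ (∣p∣≤n V))))
      (trans (cong (_+ (k ∸ t)) ∣X∣≡t) (m+[n∸m]≡n t≤k))
    split : ∀ {F} → Containing k X F → Hit X V F ⊎ Trace k V X F
    split {F} (s , X⊆F) with nonempty? (F ∩ (V ─ X))
    ... | yes ne = inj₁ (s , X⊆F , ne)
    ... | no  em = inj₂ (s , ⊆-antisym
      (λ {x} x∈ → let x∈F , x∈V = x∈p∩q⁻ F V x∈ in
        decidable-stable (x ∈? X) λ x∉X → em (x , x∈p∩q⁺ (x∈F , x∈p∧x∉q⇒x∈p─q x∈V x∉X)))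
      (⊆-∩ X⊆F X⊆V))

  -- The classes for different `x` are disjoint because the traces `U - x` differ, so the union
  -- bound is exact.
  card-missing-≡ : ∀ {X U u} → ∣ X ∣ ≡ t → X ⊆ U → ∣ U ∣ ≡ t + u → t + u ≤ suc k →
                   card (missing? X U) ≡ card-missing u
  card-missing-≡ {X} {U} {u} ∣X∣≡t X⊆U ∣U∣≡ t+u≤1+k = ≤-antisym
    (≤-trans (card-⋃ (missing? X U) (λ x → trace? k U (U - x)) (elements X)
      (λ x∈ → ≤-reflexive (trace≡ (∈-elements⁻ X x∈)))
      (λ (s , x , x∈X , e) → x , ∈-elements⁺ x∈X , s , e))
      (≤-reflexive (cong (_* M) length≡)))
    (≤-trans (≤-reflexive (cong (_* M) (sym length≡)))
      (≤-trans (card-Any-≥ (λ x → trace? k U (U - x)) (elements-unique X)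
        (λ x∈ → ≤-reflexive (sym (trace≡ (∈-elements⁻ X x∈))))
        (λ {x} {y} x∈ y∈ (_ , e) (_ , e′) → decidable-stable (x Fin.≟ y) λ x≢y →
          x∈p-y⇒x≢y U x (subst (x ∈_) (trans (sym e′) e) (x∈p∧x≢y⇒x∈p-y (X⊆U (∈-elements⁻ X x∈)) x≢y)) refl))
        (card-mono (λ F → Any.any? (λ x → trace? k U (U - x) F) (elements X)) (missing? X U)
          (λ any → let x , x∈ , s , e = find any in s , x , ∈-elements⁻ X x∈ , e))))
    where
    M = (n ∸ (t + u)) C (suc k ∸ (t + u))
    length≡ : length (elements X) ≡ t
    length≡ = trans (length-elements X) ∣X∣≡t
    trace≡ : ∀ {x} → x ∈ X → card (trace? k U (U - x)) ≡ M
    trace≡ {x} x∈X = card-trace U (U - x) (p─q⊆p U ⁅ x ⁆)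
      (trans (cong (n ∸ (t + u) +_) ∣U∣≡) (m∸n+n≡m (subst (_≤ n) ∣U∣≡ (∣p∣≤n U))))
      (suc-injective (trans (cong (_+ (suc k ∸ (t + u))) (trans (1+∣p-x∣≡∣p∣ (X⊆U x∈X)) ∣U∣≡)) (m+[n∸m]≡n t+u≤1+k)))

  -- Every such set contains some `U - x`, which has at least t + 2 elements; hence the order `c 2`,
  -- negligible against `c 1`.
  card-missing-≤ : ∀ {X U} → ∣ X ∣ ≡ t → X ⊆ U → t + 3 ≤ ∣ U ∣ → card (missing? X U) ≤ t * c 2
  card-missing-≤ {X} {U} ∣X∣≡t X⊆U t+3≤∣U∣ = ≤-trans
    (card-⋃ (missing? X U) (λ x → containing? k (U - x)) (elements X)
      (λ {x} x∈ → card-containing-≤ (≤-pred (≤-trans (≤-reflexive (sym (+-suc t 2))) (≤-trans t+3≤∣U∣ (∣p∣≤1+∣p-x∣ U x)))) t+2≤k)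
      (λ {F} (s , x , x∈X , e) → x , ∈-elements⁺ x∈X , s , ⊆-trans (⊆-reflexive (sym e)) (p∩q⊆p F U)))
    (≤-reflexive (cong (_* c 2) (trans (length-elements X) ∣X∣≡t)))

  -- Each member contains `X` together with one of at most k²/2 pairs from `A ─ X`, and k²/2 times
  -- `c 2` is at most a 14th of `c 1`.
  card-pairs : ∀ {P : Family n} (P? : Decidable P) {X A} → ∣ X ∣ ≡ t → ∣ A ∣ ≤ k → P ⊆ᶠ Containing k X →
               (∀ {F} → P F → 2 ≤ ∣ F ∩ A ─ X ∣) → 14 * card P? ≤ c 1
  card-pairs P? {X} {A} ∣X∣≡t ∣A∣≤k P⊆ 2≤ = begin
    14 * card P?                      ≤⟨ *-monoʳ-≤ 14 (card-⋃ P? (λ T → containing? k (X ∪ T)) pairs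
      (λ {T} T∈ → let ∣T∣≡2 , T⊆ = pair T∈ in
        card-containing-≤ (≤-reflexive (sym (trans (∣p∪q∣≡∣p∣+∣q∣ (λ x∈X x∈T → x∈p─q⇒x∉q A X (T⊆ x∈T) x∈X))
          (cong₂ _+_ ∣X∣≡t ∣T∣≡2)))) t+2≤k)
      (λ {F} F∈ → let T , T⊆ , ∣T∣≡2 = ⊆-of-card (F ∩ A ─ X) (2≤ F∈) ; s , X⊆F = P⊆ F∈ in
        T , ∈-filter⁺ (subset-of? (A ─ X) 2) (∈-subsets T)
              (∣T∣≡2 , λ {x} x∈T → let x∈ = T⊆ x∈T in
                x∈p∧x∉q⇒x∈p─q (proj₂ (x∈p∩q⁻ F A (p─q⊆p (F ∩ A) X x∈))) (x∈p─q⇒x∉q (F ∩ A) X x∈))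
        , s , ∪-⊆ X⊆F (λ x∈T → proj₁ (x∈p∩q⁻ F A (p─q⊆p (F ∩ A) X (T⊆ x∈T)))))) ⟩
    14 * (length pairs * c 2)         ≤⟨ *-monoʳ-≤ 14 (*-monoˡ-≤ (c 2) (≤-trans (≤-reflexive (card-subsets-of (A ─ X) 2))
      (nCk-monoˡ 2 (≤-trans (∣p─q∣≤∣p∣ A X) ∣A∣≤k)))) ⟩
    14 * ((k C 2) * c 2)              ≡⟨ lem (k C 2) (c 2) ⟩
    7 * (2 * (k C 2)) * c 2           ≤⟨ *-monoˡ-≤ (c 2) (*-monoʳ-≤ 7 (2*nC2≤n*n k)) ⟩
    7 * (k * k) * c 2                 ≤⟨ 7k²c₂≤c₁ ⟩
    c 1 ∎
    where
    open ≤-Reasoning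
    lem : ∀ b c → 14 * (b * c) ≡ 7 * (2 * b) * c
    lem = solve-∀
    pairs = filter (subset-of? (A ─ X) 2) (subsets n)
    pair : ∀ {T} → T ∈ˡ pairs → Sized 2 T × T ⊆ A ─ X
    pair T∈ = proj₂ (∈-filter⁻ (subset-of? (A ─ X) 2) {xs = subsets n} T∈)

  -- Errors are counted in 28ths of `c 1`: 2 from the Bonferroni estimate and 21 from the losses
  -- `e`.
  main-part : ∀ {m a g e} → 14 * (m * c 1) ≤ 14 * a + c 1 → a ≤ g + e → 4 * e ≤ 3 * c 1 →
              28 * (m * c 1) ≤ 28 * g + 23 * c 1
  main-part {m} {a} {g} {e} a-large a≤ 4e≤ = begin
    28 * (m * c 1)                         ≡⟨ lem₁ (m * c 1) ⟩
    2 * (14 * (m * c 1))                   ≤⟨ *-monoʳ-≤ 2 a-large ⟩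
    2 * (14 * a + c 1)                     ≤⟨ *-monoʳ-≤ 2 (+-monoˡ-≤ (c 1) (*-monoʳ-≤ 14 a≤)) ⟩
    2 * (14 * (g + e) + c 1)               ≡⟨ lem₂ g e (c 1) ⟩
    28 * g + 7 * (4 * e) + 2 * c 1         ≤⟨ +-monoˡ-≤ (2 * c 1) (+-monoʳ-≤ (28 * g) (*-monoʳ-≤ 7 4e≤)) ⟩
    28 * g + 7 * (3 * c 1) + 2 * c 1       ≡⟨ lem₃ g (c 1) ⟩
    28 * g + 23 * c 1 ∎
    where
    open ≤-Reasoning
    lem₁ : ∀ a → 28 * a ≡ 2 * (14 * a)
    lem₁ = solve-∀
    lem₂ : ∀ a b c → 2 * (14 * (a + b) + c) ≡ 28 * a + 7 * (4 * b) + 2 * c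
    lem₂ = solve-∀
    lem₃ : ∀ a c → 28 * a + 7 * (3 * c) + 2 * c ≡ 28 * a + 23 * c
    lem₃ = solve-∀

  -- An excess of one whole `c 1` would need 28 of these 28ths.
  28m≤28s+27⇒m≤s : ∀ {m s} → 28 * (m * c 1) ≤ 28 * (s * c 1) + 27 * c 1 → m ≤ s
  28m≤28s+27⇒m≤s {m} {s} le = ≮⇒≥ λ s<m → <⇒≱ (m<n+m (28 * (s * c 1) + 27 * c 1) (0<c 1)) (begin
    c 1 + (28 * (s * c 1) + 27 * c 1)      ≡⟨ lem s (c 1) ⟩
    28 * (suc s * c 1)                     ≤⟨ *-monoʳ-≤ 28 (*-monoˡ-≤ (c 1) s<m) ⟩
    28 * (m * c 1)                         ≤⟨ le ⟩
    28 * (s * c 1) + 27 * c 1              ∎)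
    where
    open ≤-Reasoning
    lem : ∀ s c → c + (28 * (s * c) + 27 * c) ≡ 28 * (suc s * c)
    lem = solve-∀

  -- The term of order `c 2` is at most a seventh of `c 1`, that is 4 more 28ths, which makes 27.
  main-part⇒≤ : ∀ {m s g} → 28 * (m * c 1) ≤ 28 * g + 23 * c 1 → g ≤ s * c 1 + k * (k * c 2) → m ≤ s
  main-part⇒≤ {m} {s} {g} g-large g≤ = 28m≤28s+27⇒m≤s (begin
    28 * (m * c 1)                                      ≤⟨ g-large ⟩
    28 * g + 23 * c 1                                   ≤⟨ +-monoˡ-≤ (23 * c 1) (*-monoʳ-≤ 28 g≤) ⟩
    28 * (s * c 1 + k * (k * c 2)) + 23 * c 1           ≡⟨ lem₁ s (c 1) k (c 2) ⟩
    28 * (s * c 1) + 4 * (7 * (k * k) * c 2) + 23 * c 1 ≤⟨ +-monoˡ-≤ (23 * c 1) (+-monoʳ-≤ (28 * (s * c 1)) (*-monoʳ-≤ 4 7k²c₂≤c₁)) ⟩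
    28 * (s * c 1) + 4 * c 1 + 23 * c 1                 ≡⟨ lem₂ (s * c 1) (c 1) ⟩
    28 * (s * c 1) + 27 * c 1                           ∎)
    where
    open ≤-Reasoning
    lem₁ : ∀ s c k d → 28 * (s * c + k * (k * d)) + 23 * c ≡ 28 * (s * c) + 4 * (7 * (k * k) * d) + 23 * c
    lem₁ = solve-∀
    lem₂ : ∀ s c → 28 * s + 4 * c + 23 * c ≡ 28 * s + 27 * c
    lem₂ = solve-∀

-- Peeling

Cover : ℕ → Family n → Family n
Cover t 𝓒 B = ∀ D → 𝓒 D → t ≤ ∣ B ∩ D ∣

Generated : Family n → Family n
Generated 𝓑 F = ∃ λ B → 𝓑 B × B ⊆ F

generated? : {𝓑 : Family n} → Decidable 𝓑 → Decidable (Generated 𝓑)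
generated? 𝓑? F = anySubset? λ B → 𝓑? B ×-dec B ⊆? F

module _ {𝓒 : Family n} (𝓒? : Decidable 𝓒) (t : ℕ) where

  -- The witness `D` is what the branching uses: every cover containing `B` has an element of
  -- `D ─ B`.
  cover-or-witness : ∀ B → Cover t 𝓒 B ⊎ ∃ λ D → 𝓒 D × ∣ B ∩ D ∣ < t
  cover-or-witness B with anySubset? (λ D → 𝓒? D ×-dec ∣ B ∩ D ∣ <? t)
  ... | yes w = inj₂ w
  ... | no ¬w = inj₁ λ D D∈ → ≮⇒≥ λ lt → ¬w (D , D∈ , lt)

  cover? : Decidable (Cover t 𝓒)
  cover? B with cover-or-witness B
  ... | inj₁ cov           = yes cov
  ... | inj₂ (D , D∈ , lt) = no λ cov → <⇒≱ lt (cov D D∈)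

-- F misses at most j elements of D, hence meets every (j + 1)-subset of D.
large-subset-met : ∀ {t j} (F D W : Subset n) → t ≤ ∣ F ∩ D ∣ → ∣ D ∣ ≤ t + j → W ⊆ D → j < ∣ W ∣ →
                   Nonempty (F ∩ W)
large-subset-met {t = t} {j} F D W t≤ ∣D∣≤ W⊆D j<∣W∣ =
  decidable-stable (nonempty? (F ∩ W)) λ em → <⇒≱ j<∣W∣ (≤-trans
    (p⊆q⇒∣p∣≤∣q∣ {p = W} {D ─ F} (λ {x} x∈W → x∈p∧x∉q⇒x∈p─q (W⊆D x∈W) (λ x∈F → em (x , x∈p∩q⁺ (x∈F , x∈W)))))
    (+-cancelˡ-≤ t _ _ (≤-trans (+-monoˡ-≤ ∣ D ─ F ∣ t≤)
      (≤-trans (≤-reflexive (∣p∩q∣+∣q─p∣≡∣q∣ F D)) ∣D∣≤))))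

∩-exceeds⇒met : ∀ (F D T : Subset n) → ∣ T ∩ D ∣ < ∣ F ∩ D ∣ → Nonempty (F ∩ (D ─ T))
∩-exceeds⇒met F D T lt = decidable-stable (nonempty? (F ∩ (D ─ T))) λ em → <⇒≱ lt
  (p⊆q⇒∣p∣≤∣q∣ λ {x} x∈ → let x∈F , x∈D = x∈p∩q⁻ F D x∈ in
    x∈p∩q⁺ (decidable-stable (x ∈? T) (λ x∉T → em (x , x∈p∩q⁺ (x∈F , x∈p∧x∉q⇒x∈p─q x∈D x∉T))) , x∈D))

module Peeling {n k t : ℕ} (range : Range n k t) where
  open Counting range

  branches : ℕ → ℕ
  branches j = ((t + j) C j) * (suc j ^ j * c j)

  -- The binomial grows by (t + j + 1)/(j + 1) and the power by at most (j + 1)(j + 2). The product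
  -- (t + j + 1)(j + 2) is at most k², which the ratio 7k² of the counts absorbs with a factor 7 to
  -- spare.
  7*branches[j+1]≤branches[j] : ∀ {j} → t + suc j ≤ k → 7 * branches (suc j) ≤ branches j
  7*branches[j+1]≤branches[j] {j} t+1+j≤k = *-cancelˡ-≤ (suc j) (begin
    suc j * (7 * (C′ * (suc (suc j) ^ suc j * c (suc j))))
      ≡⟨ lem₁ (suc j) C′ (suc (suc j) ^ suc j) (c (suc j)) ⟩
    7 * (suc j * C′) * (suc (suc j) ^ suc j * c (suc j))
      ≡⟨ cong (λ x → 7 * x * (suc (suc j) ^ suc j * c (suc j))) absorb ⟩
    7 * (suc (t + j) * B) * (suc (suc j) ^ suc j * c (suc j))
      ≤⟨ *-monoʳ-≤ (7 * (suc (t + j) * B)) (*-monoˡ-≤ (c (suc j)) ([1+m]^m≤m^m*[1+m] (suc j))) ⟩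
    7 * (suc (t + j) * B) * (suc j ^ suc j * suc (suc j) * c (suc j))
      ≡⟨ lem₂ (suc (t + j)) B (suc j) (suc j ^ j) (suc (suc j)) (c (suc j)) ⟩
    suc j * (B * (suc j ^ j * (7 * (suc (t + j) * suc (suc j)) * c (suc j))))
      ≤⟨ *-monoʳ-≤ (suc j) (*-monoʳ-≤ B (*-monoʳ-≤ (suc j ^ j) (≤-trans
           (*-monoˡ-≤ (c (suc j)) (*-monoʳ-≤ 7 (*-mono-≤ 1+t+j≤k 2+j≤k)))
           (7k²c[j+1]≤c[j] t+1+j≤k)))) ⟩
    suc j * (B * (suc j ^ j * c j)) ∎)
    where
    open ≤-Reasoning
    B  = (t + j) C j
    C′ = (t + suc j) C suc j
    absorb : suc j * C′ ≡ suc (t + j) * B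
    absorb = trans (cong (λ m → suc j * (m C suc j)) (+-suc t j)) ([k+1]*[n+1]C[k+1]≡[n+1]*nCk (t + j) j)
    1+t+j≤k : suc (t + j) ≤ k
    1+t+j≤k = subst (_≤ k) (+-suc t j) t+1+j≤k
    2+j≤k : suc (suc j) ≤ k
    2+j≤k = ≤-trans (≤-trans (n≤1+n _) (+-monoˡ-≤ (suc j) 2≤t)) t+1+j≤k
    lem₁ : ∀ a b c d → a * (7 * (b * (c * d))) ≡ 7 * (a * b) * (c * d)
    lem₁ = solve-∀
    lem₂ : ∀ s b j p q c → 7 * (s * b) * (j * p * q * c) ≡ j * (b * (p * (7 * (s * q) * c)))
    lem₂ = solve-∀

  14*branches₂≤9*c₁ : 14 * branches 2 ≤ 9 * c 1
  14*branches₂≤9*c₁ = begin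
    14 * (((t + 2) C 2) * (9 * c 2))    ≡⟨ lem ((t + 2) C 2) (c 2) ⟩
    9 * (7 * (2 * ((t + 2) C 2)) * c 2) ≤⟨ *-monoʳ-≤ 9 (*-monoˡ-≤ (c 2) (*-monoʳ-≤ 7
      (≤-trans (2*nC2≤n*n (t + 2)) (*-mono-≤ t+2≤k t+2≤k)))) ⟩
    9 * (7 * (k * k) * c 2)             ≤⟨ *-monoʳ-≤ 9 7k²c₂≤c₁ ⟩
    9 * c 1 ∎
    where
    open ≤-Reasoning
    lem : ∀ b c → 14 * (b * (9 * c)) ≡ 9 * (7 * (2 * b) * c)
    lem = solve-∀

  module _ {𝓒 : Family n} (𝓒? : Decidable 𝓒) (j : ℕ) where

    Irreducible : Family n
    Irreducible F = (Sized k F × Cover t 𝓒 F) × ¬ ∃ λ T → (∣ T ∣ < t + j × Cover t 𝓒 T) × T ⊆ F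

    irreducible? : Decidable Irreducible
    irreducible? F = (sized? k F ×-dec cover? 𝓒? t F) ×-dec
      ¬? (generated? (λ T → (∣ T ∣ <? t + j) ×-dec cover? 𝓒? t T) F)

    module _ (∣𝓒∣≤ : ∀ {D} → 𝓒 D → ∣ D ∣ ≤ t + j) (0<j : 0 < j) (t+j≤k : t + j ≤ k) where

      -- Here `i` branchings are done and `d` remain. A `T` with d > 0 that is already a cover lies
      -- in no irreducible set; any other `T` is extended inside a generator that it meets in fewer
      -- than t elements.
      card-irreducible-⊇ : ∀ d {i T} → i + d ≡ j → ∣ T ∣ ≡ t + i →
        card (λ F → irreducible? F ×-dec T ⊆? F) ≤ suc j ^ d * c j
      card-irreducible-⊇ zero {i} {T} i+0≡j ∣T∣≡ = ≤-trans
        (card-⊆-≤ (λ F → irreducible? F ×-dec T ⊆? F) {T}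
          (≤-reflexive (trans (cong (t +_) (trans (sym i+0≡j) (+-identityʳ i))) (sym ∣T∣≡))) t+j≤k
          (λ (((s , _) , _) , T⊆F) → s , T⊆F))
        (≤-reflexive (sym (+-identityʳ (c j))))
      card-irreducible-⊇ (suc d) {i} {T} i+1+d≡j ∣T∣≡ with cover-or-witness 𝓒? t T
      ... | inj₁ cov = ≤-trans (≤-reflexive (card-empty (λ F → irreducible? F ×-dec T ⊆? F)
              (λ F ((_ , irr) , T⊆F) → irr (T , (∣T∣<t+j , cov) , T⊆F)))) z≤n
        where
        ∣T∣<t+j : ∣ T ∣ < t + j
        ∣T∣<t+j = ≤-trans (≤-reflexive (trans (cong suc ∣T∣≡) (sym (+-suc t i))))
          (+-monoʳ-≤ t (≤-trans (m≤m+n (suc i) d) (≤-reflexive (trans (sym (+-suc i d)) i+1+d≡j))))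
      ... | inj₂ (D , D∈ , T∩D<t) = ≤-trans
        (card-⋃ (λ F → irreducible? F ×-dec T ⊆? F) (λ x F → irreducible? F ×-dec (T ∪ ⁅ x ⁆) ⊆? F) (elements W)
          (λ x∈ → card-irreducible-⊇ d (trans (sym (+-suc i d)) i+1+d≡j)
            (trans (∣p∪⁅x⁆∣≡1+∣p∣ (x∈p─q⇒x∉q D T (W⊆ (∈-elements⁻ W x∈)))) (trans (cong suc ∣T∣≡) (sym (+-suc t i)))))
          (λ {F} (irr , T⊆F) → let x , x∈ = met F (proj₂ (proj₁ irr) D D∈) ; x∈F , x∈W = x∈p∩q⁻ F W x∈ in
            x , ∈-elements⁺ x∈W , irr , ∪-⊆ T⊆F (⁅⁆-⊆ x∈F)))
        (≤-trans (*-monoˡ-≤ (suc j ^ d * c j) (≤-trans (≤-reflexive (length-elements W)) ∣W∣≤))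
          (≤-reflexive (sym (*-assoc (suc j) (suc j ^ d) (c j)))))
        where
        -- `D ─ T` can be much larger than j + 1, but any j + 1 of its elements suffice, since `F`
        -- misses at most j elements of `D`. If it is smaller, all of it is taken.
        pick : ∃ λ W → W ⊆ D ─ T × ∣ W ∣ ≤ suc j × (∀ F → t ≤ ∣ F ∩ D ∣ → Nonempty (F ∩ W))
        pick with suc j ≤? ∣ D ─ T ∣
        ... | yes j< = let W , W⊆ , ∣W∣≡ = ⊆-of-card (D ─ T) j< in
          W , W⊆ , ≤-reflexive ∣W∣≡ , λ F t≤ →
            large-subset-met F D W t≤ (∣𝓒∣≤ D∈) (⊆-trans W⊆ (p─q⊆p D T)) (≤-reflexive (sym ∣W∣≡))
        ... | no j≮ = D ─ T , ⊆-refl , <⇒≤ (≰⇒> j≮) , λ F t≤ → ∩-exceeds⇒met F D T (≤-trans T∩D<t t≤)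
        W = proj₁ pick
        W⊆ = proj₁ (proj₂ pick)
        ∣W∣≤ = proj₁ (proj₂ (proj₂ pick))
        met = proj₂ (proj₂ (proj₂ pick))

      -- Every cover contains a t-subset of one fixed generator `C₀`, and the branching starts
      -- there: this is the binomial factor. If there is no generator, the empty set is a cover of
      -- size below t + j and nothing is irreducible.
      card-irreducible : card irreducible? ≤ branches j
      card-irreducible with anySubset? 𝓒?
      ... | no ¬𝓒 = ≤-trans (≤-reflexive (card-empty irreducible? λ F (_ , irr) →
          irr (⊥ , (subst (_< t + j) (sym (∣⊥∣≡0 n)) (≤-trans 0<j (m≤n+m j t)) , λ D D∈ → contradiction (D , D∈) ¬𝓒) , ⊥⊆))) z≤n
      ... | yes (C₀ , C₀∈) = ≤-trans
        (card-⋃ irreducible? (λ T F → irreducible? F ×-dec T ⊆? F) (filter t-subset? (subsets n))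
          (λ T∈ → card-irreducible-⊇ j {0} refl (trans (proj₁ (proj₂ (∈-filter⁻ t-subset? {xs = subsets n} T∈))) (sym (+-identityʳ t))))
          (λ {F} irr → let T , T⊆ , ∣T∣≡ = ⊆-of-card (F ∩ C₀) (proj₂ (proj₁ irr) C₀ C₀∈) in
            T , ∈-filter⁺ t-subset? (∈-subsets T) (∣T∣≡ , ⊆-trans T⊆ (p∩q⊆q F C₀)) , irr , ⊆-trans T⊆ (p∩q⊆p F C₀)))
        (*-monoˡ-≤ (suc j ^ j * c j) (begin
          card t-subset?                ≡⟨ card-subsets-of C₀ t ⟩
          ∣ C₀ ∣ C t                    ≤⟨ nCk-monoˡ t (∣𝓒∣≤ C₀∈) ⟩
          (t + j) C t                   ≡⟨ nCk≡nC[n∸k] (m≤m+n t j) ⟩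
          (t + j) C (t + j ∸ t)         ≡⟨ cong ((t + j) C_) (m+n∸m≡n t j) ⟩
          (t + j) C j                   ∎))
        where
        open ≤-Reasoning
        t-subset? : Decidable (λ T → Sized t T × T ⊆ C₀)
        t-subset? = subset-of? C₀ t

  -- Sizes are bounded only from above: all smaller generators are carried along, and one loss bound
  -- `e` serves both families.
  record Kernel {𝓕 𝓖 : Family n} (𝓕? : Decidable 𝓕) (𝓖? : Decidable 𝓖) (j e : ℕ) : Set₁ where
    field
      𝓑 𝓒   : Family n
      𝓑?    : Decidable 𝓑
      𝓒?    : Decidable 𝓒
      ∣𝓑∣≤  : ∀ {B} → 𝓑 B → ∣ B ∣ ≤ t + j
      ∣𝓒∣≤  : ∀ {D} → 𝓒 D → ∣ D ∣ ≤ t + j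
      cross : CrossIntersecting t 𝓑 𝓒
      𝓕-rest : card (λ F → 𝓕? F ×-dec ¬? (generated? 𝓑? F)) ≤ e
      𝓖-rest : card (λ G → 𝓖? G ×-dec ¬? (generated? 𝓒? G)) ≤ e

  flip-kernel : ∀ {𝓕 𝓖} {𝓕? : Decidable 𝓕} {𝓖? : Decidable 𝓖} {j e} → Kernel 𝓕? 𝓖? j e → Kernel 𝓖? 𝓕? j e
  flip-kernel K = record
    { 𝓑 = 𝓒 ; 𝓒 = 𝓑 ; 𝓑? = 𝓒? ; 𝓒? = 𝓑? ; ∣𝓑∣≤ = ∣𝓒∣≤ ; ∣𝓒∣≤ = ∣𝓑∣≤
    ; cross = λ {D} {B} D∈ B∈ → subst (λ S → t ≤ ∣ S ∣) (∩-comm B D) (cross B∈ D∈)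
    ; 𝓕-rest = 𝓖-rest ; 𝓖-rest = 𝓕-rest }
    where open Kernel K

  -- A member that is newly lost contains an old generator, so it covers `𝓒`; as it contains no new
  -- generator, it contains no small cover and is irreducible.
  rest-≤ : ∀ {𝓗 : Family n} (𝓗? : Decidable 𝓗) → 𝓗 ⊆ᶠ Sized k → ∀ {𝓑 𝓑′ 𝓒 : Family n}
    (𝓑? : Decidable 𝓑) (𝓑′? : Decidable 𝓑′) (𝓒? : Decidable 𝓒) {j e} → t + suc j ≤ k →
    (∀ {D} → 𝓒 D → ∣ D ∣ ≤ t + suc j) → (∀ {B} → 𝓑 B → Cover t 𝓒 B) →
    (∀ {B} → ∣ B ∣ < t + suc j → Cover t 𝓒 B → 𝓑′ B) →
    card (λ F → 𝓗? F ×-dec ¬? (generated? 𝓑? F)) ≤ e →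
    card (λ F → 𝓗? F ×-dec ¬? (generated? 𝓑′? F)) ≤ e + branches (suc j)
  rest-≤ {𝓗} 𝓗? 𝓗-sized {𝓑} {𝓑′} 𝓑? 𝓑′? 𝓒? {j} t+1+j≤k ∣𝓒∣≤ cov new rest = ≤-trans
    (card-∪ (λ F → 𝓗? F ×-dec ¬? (generated? 𝓑′? F)) (λ F → 𝓗? F ×-dec ¬? (generated? 𝓑? F)) (irreducible? 𝓒? (suc j)) split)
    (+-mono-≤ rest (card-irreducible 𝓒? (suc j) ∣𝓒∣≤ (s≤s z≤n) t+1+j≤k))
    where
    split : ∀ {F} → 𝓗 F × ¬ Generated 𝓑′ F → (𝓗 F × ¬ Generated 𝓑 F) ⊎ Irreducible 𝓒? (suc j) F
    split {F} (F∈ , ¬gen′) with generated? 𝓑? F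
    ... | no ¬gen = inj₁ (F∈ , ¬gen)
    ... | yes (B , B∈ , B⊆F) = inj₂
      ((𝓗-sized F∈ , λ D D∈ → ≤-trans (cov B∈ D D∈) (p⊆q⇒∣p∣≤∣q∣ {p = B ∩ D} {F ∩ D}
          (λ x∈ → let x∈B , x∈D = x∈p∩q⁻ B D x∈ in x∈p∩q⁺ (B⊆F x∈B , x∈D))))
      , λ (T , (∣T∣< , T-cov) , T⊆F) → ¬gen′ (T , new ∣T∣< T-cov , T⊆F))

  module _ {𝓕 𝓖 : Family n} (𝓕? : Decidable 𝓕) (𝓖? : Decidable 𝓖)
           (𝓕-sized : 𝓕 ⊆ᶠ Sized k) (𝓖-sized : 𝓖 ⊆ᶠ Sized k) where

    -- The two sides are treated in turn: `𝓑′` consists of small covers of `𝓒`, but `𝓒′` of small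
    -- covers of `𝓑′` rather than of `𝓑`. This makes the new pair cross t-intersecting by
    -- construction.
    peel : ∀ {j e} → t + suc j ≤ k → Kernel 𝓕? 𝓖? (suc j) e → Kernel 𝓕? 𝓖? j (e + branches (suc j))
    peel {j} t+1+j≤k K = record
      { 𝓑 = 𝓑′ ; 𝓒 = 𝓒′ ; 𝓑? = 𝓑′? ; 𝓒? = 𝓒′? ; ∣𝓑∣≤ = proj₁ ; ∣𝓒∣≤ = proj₁
      ; cross = λ {B} {D} B∈ (_ , cov) → subst (λ S → t ≤ ∣ S ∣) (∩-comm D B) (cov B B∈)
      ; 𝓕-rest = rest-≤ 𝓕? 𝓕-sized 𝓑? 𝓑′? 𝓒? t+1+j≤k ∣𝓒∣≤ (λ B∈ D D∈ → cross B∈ D∈)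
          (λ ∣B∣< cov → ≤-pred (≤-trans ∣B∣< (≤-reflexive (+-suc t j))) , cov) 𝓕-rest
      ; 𝓖-rest = rest-≤ 𝓖? 𝓖-sized 𝓒? 𝓒′? 𝓑′? t+1+j≤k (λ (le , _) → ≤-trans le (+-monoʳ-≤ t (n≤1+n j)))
          (λ {D} D∈ B (_ , cov) → subst (λ S → t ≤ ∣ S ∣) (∩-comm B D) (cov D D∈))
          (λ ∣D∣< cov → ≤-pred (≤-trans ∣D∣< (≤-reflexive (+-suc t j))) , cov) 𝓖-rest
      }
      where
      open Kernel K
      𝓑′ 𝓒′ : Family n
      𝓑′ B = ∣ B ∣ ≤ t + j × Cover t 𝓒 B
      𝓑′? : Decidable 𝓑′
      𝓑′? B = ∣ B ∣ ≤? t + j ×-dec cover? 𝓒? t B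
      𝓒′ D = ∣ D ∣ ≤ t + j × Cover t 𝓑′ D
      𝓒′? : Decidable 𝓒′
      𝓒′? D = ∣ D ∣ ≤? t + j ×-dec cover? 𝓑′? t D

    module _ (𝓕×𝓖 : CrossIntersecting t 𝓕 𝓖) where

      trivial-kernel : ∀ {j} → t + j ≡ k → Kernel 𝓕? 𝓖? j 0
      trivial-kernel t+j≡k = record
        { 𝓑 = 𝓕 ; 𝓒 = 𝓖 ; 𝓑? = 𝓕? ; 𝓒? = 𝓖?
        ; ∣𝓑∣≤ = λ F∈ → ≤-reflexive (trans (𝓕-sized F∈) (sym t+j≡k))
        ; ∣𝓒∣≤ = λ G∈ → ≤-reflexive (trans (𝓖-sized G∈) (sym t+j≡k))
        ; cross = 𝓕×𝓖
        ; 𝓕-rest = ≤-reflexive (card-empty (λ F → 𝓕? F ×-dec ¬? (generated? 𝓕? F)) λ F (F∈ , ¬gen) → ¬gen (F , F∈ , ⊆-refl))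
        ; 𝓖-rest = ≤-reflexive (card-empty (λ F → 𝓖? F ×-dec ¬? (generated? 𝓖? F)) λ F (F∈ , ¬gen) → ¬gen (F , F∈ , ⊆-refl))
        }

      -- The sixth is the sum of a geometric series of ratio 1/7, kept as an invariant.
      kernel-at : ∀ d j → t + (j + d) ≡ k → ∃ λ e → 6 * e ≤ branches j × Kernel 𝓕? 𝓖? j e
      kernel-at zero j eq = 0 , z≤n , trivial-kernel (trans (cong (t +_) (sym (+-identityʳ j))) eq)
      kernel-at (suc d) j eq with e , 6e≤ , K ← kernel-at d (suc j) (trans (cong (t +_) (sym (+-suc j d))) eq) =
        e + b , (begin
          6 * (e + b)     ≡⟨ *-distribˡ-+ 6 e b ⟩
          6 * e + 6 * b   ≤⟨ +-monoˡ-≤ (6 * b) 6e≤ ⟩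
          7 * b           ≤⟨ 7*branches[j+1]≤branches[j] t+1+j≤k ⟩
          branches j      ∎) , peel t+1+j≤k K
        where
        open ≤-Reasoning
        b = branches (suc j)
        t+1+j≤k : t + suc j ≤ k
        t+1+j≤k = ≤-trans (+-monoʳ-≤ t (m≤m+n (suc j) d)) (≤-reflexive (trans (cong (t +_) (sym (+-suc j d))) eq))

      -- The last peeling adds `branches 2` to losses of at most a sixth of it, and 7/6 of 9/14 is
      -- 3/4.
      small-kernel : ∃ λ e → 4 * e ≤ 3 * c 1 × Kernel 𝓕? 𝓖? 1 e
      small-kernel with e , 6e≤ , K ← kernel-at (k ∸ (t + 2)) 2 (trans (sym (+-assoc t 2 _)) (m+[n∸m]≡n t+2≤k)) =
        e + b , *-cancelˡ-≤ 6 (begin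
          6 * (4 * (e + b))        ≡⟨ lem₁ e b ⟩
          4 * (6 * e) + 24 * b     ≤⟨ +-monoˡ-≤ (24 * b) (*-monoʳ-≤ 4 6e≤) ⟩
          4 * b + 24 * b           ≡⟨ lem₂ b ⟩
          2 * (14 * b)             ≤⟨ *-monoʳ-≤ 2 14*branches₂≤9*c₁ ⟩
          2 * (9 * c 1)            ≡⟨ lem₃ (c 1) ⟩
          6 * (3 * c 1)            ∎) , peel t+2≤k K
        where
        open ≤-Reasoning
        b = branches 2
        lem₁ : ∀ e b → 6 * (4 * (e + b)) ≡ 4 * (6 * e) + 24 * b
        lem₁ = solve-∀
        lem₂ : ∀ b → 4 * b + 24 * b ≡ 2 * (14 * b)
        lem₂ = solve-∀
        lem₃ : ∀ c → 2 * (9 * c) ≡ 6 * (3 * c)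
        lem₃ = solve-∀

-- Comprehension, maximum degree and diversity

comprehension : {P : Pred (Fin n) 0ℓ} → Decidable P → Subset n
comprehension P? = tabulate (λ x → does (P? x))

module _ {P : Pred (Fin n) 0ℓ} (P? : Decidable P) {x : Fin n} where

  ∈-comprehension⁺ : P x → x ∈ comprehension P?
  ∈-comprehension⁺ p = Vec.lookup⇒[]= x _ (trans (Vec.lookup∘tabulate _ x) (dec-true (P? x) p))

  ∈-comprehension⁻ : x ∈ comprehension P? → P x
  ∈-comprehension⁻ x∈ with P? x | trans (sym (Vec.lookup∘tabulate (λ x → does (P? x)) x)) (Vec.[]=⇒lookup x∈)
  ... | yes p | _ = p

degree≤Δ : {𝓕 : Family n} (𝓕? : Decidable 𝓕) {t : ℕ} {S : Subset n} → ∣ S ∣ ≡ t → degree 𝓕? S ≤ Δ t 𝓕?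
degree≤Δ 𝓕? {t} {S} ∣S∣≡t = All.lookup (xs≤max 0 (List.map (degree 𝓕?) (filter (sized? t) (subsets _))))
  (∈-map⁺ (degree 𝓕?) (∈-filter⁺ (sized? t) (∈-subsets S) ∣S∣≡t))

Δ≤ : {𝓕 : Family n} (𝓕? : Decidable 𝓕) {t M : ℕ} → (∀ S → ∣ S ∣ ≡ t → degree 𝓕? S ≤ M) → Δ t 𝓕? ≤ M
Δ≤ {n} 𝓕? {t} {M} bound = max≤v⁺ {xs = List.map (degree 𝓕?) (filter (sized? t) (subsets n))} z≤n (All.tabulate λ d∈ →
  let S , S∈ , d≡ = ∈-map⁻ (degree 𝓕?) d∈ in
  subst (_≤ M) (sym d≡) (bound S (proj₂ (∈-filter⁻ (sized? t) {xs = subsets n} S∈))))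

-- Any t-set bounds the diversity from above; it need not be one of largest degree.
γ≤card-avoiding : {𝓕 : Family n} (𝓕? : Decidable 𝓕) {t : ℕ} {X : Subset n} → ∣ X ∣ ≡ t →
                  γ t 𝓕? ≤ card (λ F → 𝓕? F ×-dec ¬? (X ⊆? F))
γ≤card-avoiding 𝓕? {t} {X} ∣X∣≡t = m≤n+o⇒m∸n≤o (card 𝓕?) (Δ t 𝓕?) (≤-trans
  (card-split 𝓕? (X ⊆?_)) (+-monoˡ-≤ _ (degree≤Δ 𝓕? ∣X∣≡t)))

⊈⇒∣∩∣< : ∀ {p q : Subset n} → ¬ (p ⊆ q) → ∣ p ∩ q ∣ < ∣ p ∣
⊈⇒∣∩∣< {p = p} {q} p⊈q = let x , x∈p , x∉q = ⊈⇒∃ p⊈q in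
  p⊂q⇒∣p∣<∣q∣ (p∩q⊆p p q , x , x∈p , λ x∈ → x∉q (proj₂ (x∈p∩q⁻ p q x∈)))

-- Families concentrated on one t-set

module Star {n k t : ℕ} (range : Range n k t) where
  open Counting range

  0<t : 0 < t
  0<t = <⇒≤ 2≤t

  disjoint-of-size : ∀ {A m} → ∣ A ∣ + m ≤ n → ∃ λ Y → Disjoint Y A × ∣ Y ∣ ≡ m
  disjoint-of-size {A} {m} ∣A∣+m≤n =
    let Y , Y⊆∁A , ∣Y∣≡m = ⊆-of-card (∁ A) (+-cancelʳ-≤ (∣ A ∣) m (∣ ∁ A ∣)
          (≤-trans (≤-reflexive (+-comm m ∣ A ∣)) (≤-trans ∣A∣+m≤n (≤-reflexive (sym (∣∁p∣+∣p∣≡n A))))))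
    in Y , (λ y∈Y → x∈∁p⇒x∉p (Y⊆∁A y∈Y)) , ∣Y∣≡m

  module _ {𝓕 𝓖 : Family n} (𝓕? : Decidable 𝓕) (𝓖? : Decidable 𝓖)
           (𝓕-sized : 𝓕 ⊆ᶠ Sized k) (𝓖-sized : 𝓖 ⊆ᶠ Sized k) (cross : CrossIntersecting t 𝓕 𝓖)
           {X : Subset n} (∣X∣≡t : ∣ X ∣ ≡ t) where

    t≤∣G∩F∣ : ∀ {F G} → 𝓕 F → 𝓖 G → t ≤ ∣ G ∩ F ∣
    t≤∣G∩F∣ {F} {G} F∈ G∈ = subst (λ S → t ≤ ∣ S ∣) (∩-comm F G) (cross F∈ G∈)

    𝓖∋X? : Decidable (λ G → 𝓖 G × X ⊆ G)
    𝓖∋X? G = 𝓖? G ×-dec X ⊆? G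

    𝓖∌X? : Decidable (λ G → 𝓖 G × ¬ X ⊆ G)
    𝓖∌X? G = 𝓖? G ×-dec ¬? (X ⊆? G)

    meets-outside-X : ∀ {F G} → 𝓕 F → ¬ X ⊆ F → 𝓖 G → Nonempty (G ∩ (F ─ X))
    meets-outside-X {F} {G} F∈ X⊈F G∈ = ∩-exceeds⇒met G F X
      (≤-trans (⊈⇒∣∩∣< X⊈F) (≤-trans (≤-reflexive ∣X∣≡t) (t≤∣G∩F∣ F∈ G∈)))

    ∣F─X∣≤k : ∀ {F} → 𝓕 F → ∣ F ─ X ∣ ≤ k
    ∣F─X∣≤k {F} F∈ = ≤-trans (∣p─q∣≤∣p∣ F X) (≤-reflexive (𝓕-sized F∈))

    module _ (𝓖∌X-small : 4 * card 𝓖∌X? ≤ 3 * c 1) {u : ℕ} (3≤u : 3 ≤ u) (t+u≤1+k : t + u ≤ suc k)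
             (𝓖-large : 14 * (u * c 1) ≤ 14 * card 𝓖? + c 1) where

      𝓖-large′ : 28 * (u * c 1) ≤ 28 * card 𝓖∋X? + 23 * c 1
      𝓖-large′ = main-part {u} {card 𝓖?} {card 𝓖∋X?} {card 𝓖∌X?} 𝓖-large (card-split 𝓖? (X ⊆?_)) 𝓖∌X-small

      -- If `F` missed two elements of `X`, every member of `𝓖` would meet `F` twice outside `X`. By
      -- `card-pairs` at most a 14th of `c 1` members through `X` do so, while `𝓖` has about u times
      -- `c 1` of them.
      t≤1+∣F∩X∣ : ∀ {F} → 𝓕 F → t ≤ suc ∣ F ∩ X ∣
      t≤1+∣F∩X∣ {F} F∈ = ≮⇒≥ λ 2+∣F∩X∣≤t → <⇒≱ 3≤u (≤-trans (28m≤28s+27⇒m≤s {u} {0} (begin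
        28 * (u * c 1)                      ≤⟨ 𝓖-large′ ⟩
        28 * card 𝓖∋X? + 23 * c 1           ≡⟨ cong (_+ 23 * c 1) (*-assoc 2 14 (card 𝓖∋X?)) ⟩
        2 * (14 * card 𝓖∋X?) + 23 * c 1     ≤⟨ +-monoˡ-≤ (23 * c 1) (*-monoʳ-≤ 2 (card-pairs 𝓖∋X? ∣X∣≡t (≤-reflexive (𝓕-sized F∈))
                                                 (λ (G∈ , X⊆G) → 𝓖-sized G∈ , X⊆G) (λ (G∈ , _) → 2≤ 2+∣F∩X∣≤t G∈))) ⟩
        2 * c 1 + 23 * c 1                  ≡⟨ *-distribʳ-+ (c 1) 2 23 ⟨
        25 * c 1                            ≤⟨ *-monoˡ-≤ (c 1) (m≤m+n 25 2) ⟩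
        27 * c 1                            ∎)) z≤n)
        where
        open ≤-Reasoning
        2≤ : suc (suc ∣ F ∩ X ∣) ≤ t → ∀ {G} → 𝓖 G → 2 ≤ ∣ G ∩ F ─ X ∣
        2≤ 2+∣F∩X∣≤t {G} G∈ = +-cancelˡ-≤ (∣ (G ∩ F) ∩ X ∣) 2 (∣ G ∩ F ─ X ∣) (begin
          ∣ (G ∩ F) ∩ X ∣ + 2   ≤⟨ +-monoˡ-≤ 2 (p⊆q⇒∣p∣≤∣q∣ λ x∈ → let x∈GF , x∈X = x∈p∩q⁻ (G ∩ F) X x∈ in
                                     x∈p∩q⁺ (proj₂ (x∈p∩q⁻ G F x∈GF) , x∈X)) ⟩
          ∣ F ∩ X ∣ + 2       ≡⟨ +-comm ∣ F ∩ X ∣ 2 ⟩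
          2 + ∣ F ∩ X ∣       ≤⟨ 2+∣F∩X∣≤t ⟩
          t                   ≤⟨ t≤∣G∩F∣ F∈ G∈ ⟩
          ∣ G ∩ F ∣           ≡⟨ ∣p∣≡∣p∩q∣+∣p─q∣ (G ∩ F) X ⟩
          ∣ (G ∩ F) ∩ X ∣ + ∣ G ∩ F ─ X ∣ ∎)

      -- Membership outside `X` in every exceptional `F`, meaning one without `X`; as a negated
      -- existential it is decided by `anySubset?`.
      Common : Pred (Fin n) 0ℓ
      Common y = y ∉ X × ¬ ∃ λ F → (𝓕 F × ¬ X ⊆ F) × y ∉ F

      common? : Decidable Common
      common? y = ¬? (y ∈? X) ×-dec ¬? (anySubset? λ F → (𝓕? F ×-dec ¬? (X ⊆? F)) ×-dec ¬? (y ∈? F))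

      core : Subset n
      core = comprehension common?

      -- A member `G` through `X` meets `F₀ ─ X` in some `y`. If `y` is not in the core, another
      -- exceptional `F₁` avoids it, and `G` must meet `F₁ ─ X` in a second element `z`; there are
      -- at most k² such pairs.
      card-𝓖∋X : ∀ {F₀} → 𝓕 F₀ → ¬ X ⊆ F₀ → card 𝓖∋X? ≤ ∣ core ∣ * c 1 + k * (k * c 2)
      card-𝓖∋X {F₀} F₀∈ X⊈F₀ = ≤-trans
        (card-∪ 𝓖∋X? (hit? X core) rest? (λ {G} G∈ → split G∈ (nonempty? (G ∩ (core ─ X)))))
        (+-mono-≤ (card-hit-≤ ∣X∣≡t (∣p─q∣≤∣p∣ core X))
          (≤-trans (card-⋃ rest? (λ y G → rest? G ×-dec y ∈? G) (elements (F₀ ─ X))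
              (λ {y} y∈ → through y (∈-elements⁻ (F₀ ─ X) y∈))
              (λ {G} r@((G∈ , _) , _) → let y , y∈ = meets-outside-X F₀∈ X⊈F₀ G∈ ; y∈G , y∈F₀─X = x∈p∩q⁻ G (F₀ ─ X) y∈ in
                y , ∈-elements⁺ y∈F₀─X , r , y∈G))
            (*-monoˡ-≤ (k * c 2) (≤-trans (≤-reflexive (length-elements (F₀ ─ X))) (∣F─X∣≤k F₀∈)))))
        where
        Rest : Family n
        Rest G = (𝓖 G × X ⊆ G) × ¬ Nonempty (G ∩ (core ─ X))
        rest? : Decidable Rest
        rest? G = 𝓖∋X? G ×-dec ¬? (nonempty? (G ∩ (core ─ X)))
        split : ∀ {G} → 𝓖 G × X ⊆ G → Dec (Nonempty (G ∩ (core ─ X))) → Hit X core G ⊎ Rest G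
        split (G∈ , X⊆G) (yes ne) = inj₁ (𝓖-sized G∈ , X⊆G , ne)
        split G∈         (no em)  = inj₂ (G∈ , em)
        through : ∀ y → y ∈ F₀ ─ X → card (λ G → rest? G ×-dec y ∈? G) ≤ k * c 2
        through y y∈ with anySubset? (λ F → (𝓕? F ×-dec ¬? (X ⊆? F)) ×-dec ¬? (y ∈? F))
        ... | no ¬∃ = ≤-trans (≤-reflexive (card-empty (λ G → rest? G ×-dec y ∈? G) λ G ((_ , em) , y∈G) →
                em (y , x∈p∩q⁺ (y∈G , x∈p∧x∉q⇒x∈p─q (∈-comprehension⁺ common? (y∉X , ¬∃)) y∉X)))) z≤n
          where
          y∉X : y ∉ X
          y∉X = x∈p─q⇒x∉q F₀ X y∈
        ... | yes (F₁ , (F₁∈ , X⊈F₁) , y∉F₁) = ≤-trans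
          (card-⋃ (λ G → rest? G ×-dec y ∈? G) (λ z → containing? k (X ∪ ⁅ y ⁆ ∪ ⁅ z ⁆)) (elements (F₁ ─ X))
            (λ {z} z∈ → card-containing-≤ (≤-reflexive (sym (size (∈-elements⁻ (F₁ ─ X) z∈)))) t+2≤k)
            (λ {G} (((G∈ , X⊆G) , _) , y∈G) → let z , z∈ = meets-outside-X F₁∈ X⊈F₁ G∈ ; z∈G , z∈F₁─X = x∈p∩q⁻ G (F₁ ─ X) z∈ in
              z , ∈-elements⁺ z∈F₁─X , 𝓖-sized G∈ , ∪-⊆ X⊆G (∪-⊆ (⁅⁆-⊆ y∈G) (⁅⁆-⊆ z∈G))))
          (*-monoˡ-≤ (c 2) (≤-trans (≤-reflexive (length-elements (F₁ ─ X))) (∣F─X∣≤k F₁∈)))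
          where
          size : ∀ {z} → z ∈ F₁ ─ X → ∣ X ∪ ⁅ y ⁆ ∪ ⁅ z ⁆ ∣ ≡ t + 2
          size {z} z∈ = trans (∣p∪q∣≡∣p∣+∣q∣ (λ x∈X x∈yz → [ (λ x∈y → x∈p─q⇒x∉q F₀ X y∈ (subst (_∈ X) (x∈⁅y⁆⇒x≡y y x∈y) x∈X))
                , (λ x∈z → x∈p─q⇒x∉q F₁ X z∈ (subst (_∈ X) (x∈⁅y⁆⇒x≡y z x∈z) x∈X)) ]′ (x∈p∪q⁻ ⁅ y ⁆ ⁅ z ⁆ x∈yz)))
            (cong₂ _+_ ∣X∣≡t (trans (∣p∪⁅x⁆∣≡1+∣p∣ (λ z∈y → y∉F₁ (subst (_∈ F₁) (x∈⁅y⁆⇒x≡y y z∈y) (p─q⊆p F₁ X z∈)))) (cong suc (∣⁅x⁆∣≡1 y))))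

      u≤∣core∣ : ∀ {F₀} → 𝓕 F₀ → ¬ X ⊆ F₀ → u ≤ ∣ core ∣
      u≤∣core∣ F₀∈ X⊈F₀ = main-part⇒≤ {u} 𝓖-large′ (card-𝓖∋X F₀∈ X⊈F₀)

      Exceptional⊆Missing : Subset n → Set
      Exceptional⊆Missing U = ∀ {F} → 𝓕 F → ¬ X ⊆ F → Missing X U F

      misses-two : ∀ {F x y} → x ∈ X → x ∉ F → y ∈ X → y ∉ F → y ≢ x → suc ∣ F ∩ X ∣ < t
      misses-two {F} {x} {y} x∈X x∉F y∈X y∉F y≢x = subst (suc ∣ F ∩ X ∣ <_)
        (trans (cong suc (1+∣p-x∣≡∣p∣ (x∈p∧x≢y⇒x∈p-y y∈X y≢x))) (trans (1+∣p-x∣≡∣p∣ x∈X) ∣X∣≡t))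
        (s≤s (s≤s (p⊆q⇒∣p∣≤∣q∣ {p = F ∩ X} {X - x - y} (λ {z} z∈ → let z∈F , z∈X = x∈p∩q⁻ F X z∈ in
          x∈p∧x≢y⇒x∈p-y (x∈p∧x≢y⇒x∈p-y z∈X (λ z≡x → x∉F (subst (_∈ F) z≡x z∈F))) (λ z≡y → y∉F (subst (_∈ F) z≡y z∈F))))))

      -- An exceptional `F` misses exactly one element of `X`, by `t≤1+∣F∩X∣`, and contains the
      -- whole core.
      core-subset-missing : ∀ {Y} → Y ⊆ core → Exceptional⊆Missing (X ∪ Y)
      core-subset-missing {Y} Y⊆ {F} F∈ X⊈F = 𝓕-sized F∈ , x , x∈X , ⊆-antisym
        (λ {y} y∈ → let y∈F , y∈U = x∈p∩q⁻ F (X ∪ Y) y∈ in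
          x∈p∧x≢y⇒x∈p-y y∈U (λ y≡x → x∉F (subst (_∈ F) y≡x y∈F)))
        (λ {y} y∈ → x∈p∩q⁺ (decidable-stable (y ∈? F) (∉F⇒⊥ y∈) , p─q⊆p (X ∪ Y) ⁅ x ⁆ y∈))
        where
        x = proj₁ (⊈⇒∃ X⊈F)
        x∈X = proj₁ (proj₂ (⊈⇒∃ X⊈F))
        x∉F = proj₂ (proj₂ (⊈⇒∃ X⊈F))
        ∉F⇒⊥ : ∀ {y} → y ∈ (X ∪ Y) - x → ¬ y ∉ F
        ∉F⇒⊥ {y} y∈ y∉F =
          [ (λ y∈X → <⇒≱ (misses-two x∈X x∉F y∈X y∉F (x∈p-y⇒x≢y (X ∪ Y) x y∈)) (t≤1+∣F∩X∣ F∈))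
          , (λ y∈Y → proj₂ (∈-comprehension⁻ common? (Y⊆ y∈Y)) (F , (F∈ , X⊈F) , y∉F)) ]′
          (x∈p∪q⁻ X Y (p─q⊆p (X ∪ Y) ⁅ x ⁆ y∈))

      t+u≤n : t + u ≤ n
      t+u≤n = begin
        t + u       ≤⟨ t+u≤1+k ⟩
        suc k       ≤⟨ +-monoˡ-≤ k (≤-trans (s≤s z≤n) 5≤k) ⟩
        k + k       ≤⟨ +-monoʳ-≤ k (m≤m+n k (5 * k)) ⟩
        7 * k       ≤⟨ 7*k≤n ⟩
        n ∎
        where open ≤-Reasoning

      exceptional⊆missing : ∃ λ U → X ⊆ U × ∣ U ∣ ≡ t + u × Exceptional⊆Missing U
      exceptional⊆missing = build (anySubset? λ F → 𝓕? F ×-dec ¬? (X ⊆? F))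
        where
        extend : ∀ {Y} → Disjoint Y X → ∣ Y ∣ ≡ u → ∣ X ∪ Y ∣ ≡ t + u
        extend Y#X ∣Y∣≡u = trans (∣p∪q∣≡∣p∣+∣q∣ (λ x∈X x∈Y → Y#X x∈Y x∈X)) (cong₂ _+_ ∣X∣≡t ∣Y∣≡u)
        build : Dec (∃ λ F → 𝓕 F × ¬ X ⊆ F) → ∃ λ U → X ⊆ U × ∣ U ∣ ≡ t + u × Exceptional⊆Missing U
        -- With no exceptional member, any superset of `X` of the right size serves.
        build (no ¬∃) =
          let Y , Y#X , ∣Y∣≡u = disjoint-of-size {X} {u} (subst (λ s → s + u ≤ n) (sym ∣X∣≡t) t+u≤n) in
          X ∪ Y , p⊆p∪q Y , extend Y#X ∣Y∣≡u , λ {F} F∈ X⊈F → contradiction (F , F∈ , X⊈F) ¬∃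
        build (yes (F₀ , F₀∈ , X⊈F₀)) =
          let Y , Y⊆ , ∣Y∣≡u = ⊆-of-card core (u≤∣core∣ F₀∈ X⊈F₀) in
          X ∪ Y , p⊆p∪q Y , extend (λ x∈Y → proj₁ (∈-comprehension⁻ common? (Y⊆ x∈Y))) ∣Y∣≡u , core-subset-missing Y⊆

  -- `U - x` is filled up with elements outside `U` and `D`, so that `F` meets `D` only inside `U`.
  -- The allowance `3 * k` covers the largest `D` in use, the union of a (t + u)-set and a k-set.
  missing-generic : ∀ {U x D u} → x ∈ U → ∣ U ∣ ≡ t + u → t + u ≤ suc k → ∣ D ∣ ≤ 3 * k →
    ∃ λ F → Sized k F × F ∩ U ≡ U - x × (∀ {y} → y ∈ F → y ∈ U - x ⊎ (y ∉ U × y ∉ D))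
  missing-generic {U} {x} {D} {u} x∈U ∣U∣≡ t+u≤1+k ∣D∣≤ =
    let A , A# , ∣A∣≡ = disjoint-of-size {U ∪ D} {suc k ∸ (t + u)} room
        A#U : Disjoint A U
        A#U = λ y∈A y∈U → A# y∈A (p⊆p∪q D y∈U)
    in (U - x) ∪ A
     , suc-injective (trans (cong suc (∣p∪q∣≡∣p∣+∣q∣ (λ y∈ y∈A → A#U y∈A (p─q⊆p U ⁅ x ⁆ y∈))))
         (trans (cong₂ _+_ (trans (1+∣p-x∣≡∣p∣ x∈U) ∣U∣≡) ∣A∣≡) (m+[n∸m]≡n t+u≤1+k)))
     , ⊆-antisym
         (λ y∈ → let y∈F , y∈U = x∈p∩q⁻ ((U - x) ∪ A) U y∈ in
           [ (λ y∈U-x → y∈U-x) , (λ y∈A → contradiction y∈U (A#U y∈A)) ]′ (x∈p∪q⁻ (U - x) A y∈F))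
         (⊆-∩ (p⊆p∪q A) (p─q⊆p U ⁅ x ⁆))
     , λ y∈F → Sum.map₂ (λ y∈A → A#U y∈A , λ y∈D → A# y∈A (q⊆p∪q U D y∈D)) (x∈p∪q⁻ (U - x) A y∈F)
    where
    open ≤-Reasoning
    room : ∣ U ∪ D ∣ + (suc k ∸ (t + u)) ≤ n
    room = begin
      ∣ U ∪ D ∣ + (suc k ∸ (t + u))       ≤⟨ +-monoˡ-≤ _ (∣p∪q∣≤∣p∣+∣q∣ U D) ⟩
      ∣ U ∣ + ∣ D ∣ + (suc k ∸ (t + u))   ≡⟨ cong (λ s → s + ∣ D ∣ + (suc k ∸ (t + u))) ∣U∣≡ ⟩
      t + u + ∣ D ∣ + (suc k ∸ (t + u))   ≡⟨ lem₁ (t + u) ∣ D ∣ (suc k ∸ (t + u)) ⟩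
      ∣ D ∣ + (t + u + (suc k ∸ (t + u))) ≡⟨ cong (∣ D ∣ +_) (m+[n∸m]≡n t+u≤1+k) ⟩
      ∣ D ∣ + suc k                       ≤⟨ +-mono-≤ ∣D∣≤ (+-monoˡ-≤ k (≤-trans (s≤s z≤n) 5≤k)) ⟩
      3 * k + (k + k)                     ≤⟨ m≤m+n _ (2 * k) ⟩
      3 * k + (k + k) + 2 * k             ≡⟨ lem₂ k ⟩
      7 * k                               ≤⟨ 7*k≤n ⟩
      n ∎
      where
      lem₁ : ∀ a b c → a + b + c ≡ b + (a + c)
      lem₁ = solve-∀
      lem₂ : ∀ k → 3 * k + (k + k) + 2 * k ≡ 7 * k
      lem₂ = solve-∀

  module _ {𝓕 𝓖 : Family n} (cross : CrossIntersecting t 𝓕 𝓖) {X U : Subset n} {u : ℕ}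
           (∣X∣≡t : ∣ X ∣ ≡ t) (X⊆U : X ⊆ U) (∣U∣≡ : ∣ U ∣ ≡ t + u) (t+u≤1+k : t + u ≤ suc k)
           (missing⊆𝓕 : Missing X U ⊆ᶠ 𝓕) where

    -- Otherwise a generic member of `Missing X U` would meet `G` only within `X - x`, in at most t
    -- - 1 elements.
    ⊇X⇒hit : ∀ {G} → 𝓖 G → Sized k G → X ⊆ G → Hit X U G
    ⊇X⇒hit {G} G∈ s X⊆G = s , X⊆G , decidable-stable (nonempty? (G ∩ (U ─ X))) λ em →
      let x , x∈X = 0<∣p∣⇒Nonempty (≤-trans 0<t (≤-reflexive (sym ∣X∣≡t)))
          F , ∣F∣≡k , F∩U≡ , F⊆ = missing-generic {U} {x} {G} (X⊆U x∈X) ∣U∣≡ t+u≤1+k (≤-trans (≤-reflexive s) (m≤n*m k 3))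
          F∩G⊆ : F ∩ G ⊆ X - x
          F∩G⊆ = λ {y} y∈ → let y∈F , y∈G = x∈p∩q⁻ F G y∈ in [
            (λ y∈U-x → x∈p∧x≢y⇒x∈p-y (decidable-stable (y ∈? X) (λ y∉X →
              em (y , x∈p∩q⁺ (y∈G , x∈p∧x∉q⇒x∈p─q (p─q⊆p U ⁅ x ⁆ y∈U-x) y∉X)))) (x∈p-y⇒x≢y U x y∈U-x)) ,
            (λ (_ , y∉G) → contradiction y∈G y∉G) ]′ (F⊆ y∈F)
      in <⇒≱ (subst (∣ X - x ∣ <_) ∣X∣≡t (≤-reflexive (1+∣p-x∣≡∣p∣ x∈X)))
             (≤-trans (cross (missing⊆𝓕 (∣F∣≡k , x , x∈X , F∩U≡)) G∈) (p⊆q⇒∣p∣≤∣q∣ F∩G⊆))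

  -- As t ≥ 2, there are distinct `x` and `y` in `X`. A generic `F` without `x` and a `G` without
  -- `y`, generic also with respect to `F`, meet only within `U ∩ V`, where both `x` and `y` are
  -- lost.
  missing-cross⇒large-∩ : ∀ {X U V u v} → ∣ X ∣ ≡ t → X ⊆ U → ∣ U ∣ ≡ t + u → t + u ≤ suc k →
    X ⊆ V → ∣ V ∣ ≡ t + v → t + v ≤ suc k → CrossIntersecting t (Missing X U) (Missing X V) → t + 2 ≤ ∣ U ∩ V ∣
  missing-cross⇒large-∩ {X} {U} {V} ∣X∣≡t X⊆U ∣U∣≡ t+u≤ X⊆V ∣V∣≡ t+v≤ cross =
    let x , x∈X = 0<∣p∣⇒Nonempty (≤-trans 0<t (≤-reflexive (sym ∣X∣≡t)))
        y , y∈X-x = 0<∣p∣⇒Nonempty {p = X - x} (≤-pred (≤-trans 2≤t (≤-trans (≤-reflexive (sym ∣X∣≡t)) (∣p∣≤1+∣p-x∣ X x))))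
        y∈X = p─q⊆p X ⁅ x ⁆ y∈X-x
        F , ∣F∣≡k , F∩U≡ , F⊆ = missing-generic {U} {x} {V} (X⊆U x∈X) ∣U∣≡ t+u≤ ∣V∣≤
        G , ∣G∣≡k , G∩V≡ , G⊆ = missing-generic {V} {y} {U ∪ F} (X⊆V y∈X) ∣V∣≡ t+v≤ (∣U∪F∣≤ F ∣F∣≡k)
        F∩G⊆ : F ∩ G ⊆ U ∩ V - x - y
        F∩G⊆ = λ {z} z∈ → let z∈F , z∈G = x∈p∩q⁻ F G z∈
                              z∈V-y = [ (λ p → p) , (λ (_ , z∉) → contradiction (q⊆p∪q U F z∈F) z∉) ]′ (G⊆ z∈G)
                              z∈V = p─q⊆p V ⁅ y ⁆ z∈V-y
                              z∈U-x = [ (λ p → p) , (λ (_ , z∉V) → contradiction z∈V z∉V) ]′ (F⊆ z∈F) in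
          x∈p∧x≢y⇒x∈p-y (x∈p∧x≢y⇒x∈p-y (x∈p∩q⁺ (p─q⊆p U ⁅ x ⁆ z∈U-x , z∈V)) (x∈p-y⇒x≢y U x z∈U-x)) (x∈p-y⇒x≢y V y z∈V-y)
        x∈ = x∈p∩q⁺ (X⊆U x∈X , X⊆V x∈X)
        y∈ = x∈p∧x≢y⇒x∈p-y (x∈p∩q⁺ (X⊆U y∈X , X⊆V y∈X)) (x∈p-y⇒x≢y X x y∈X-x)
    in begin
      t + 2                       ≤⟨ +-monoˡ-≤ 2 (cross (∣F∣≡k , x , x∈X , F∩U≡) (∣G∣≡k , y , y∈X , G∩V≡)) ⟩
      ∣ F ∩ G ∣ + 2               ≤⟨ +-monoˡ-≤ 2 (p⊆q⇒∣p∣≤∣q∣ F∩G⊆) ⟩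
      ∣ U ∩ V - x - y ∣ + 2       ≡⟨ +-comm _ 2 ⟩
      2 + ∣ U ∩ V - x - y ∣       ≡⟨ cong suc (1+∣p-x∣≡∣p∣ y∈) ⟩
      suc ∣ U ∩ V - x ∣           ≡⟨ 1+∣p-x∣≡∣p∣ x∈ ⟩
      ∣ U ∩ V ∣ ∎
    where
    open ≤-Reasoning
    1+k≤2k : suc k ≤ k + k
    1+k≤2k = +-monoˡ-≤ k (≤-trans (s≤s z≤n) 5≤k)
    ∣V∣≤ : ∣ V ∣ ≤ 3 * k
    ∣V∣≤ = ≤-trans (≤-reflexive ∣V∣≡) (≤-trans t+v≤ (≤-trans 1+k≤2k (+-monoʳ-≤ k (m≤m+n k _))))
    ∣U∪F∣≤ : ∀ F → ∣ F ∣ ≡ k → ∣ U ∪ F ∣ ≤ 3 * k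
    ∣U∪F∣≤ F ∣F∣≡k = begin
      ∣ U ∪ F ∣       ≤⟨ ∣p∪q∣≤∣p∣+∣q∣ U F ⟩
      ∣ U ∣ + ∣ F ∣   ≡⟨ cong₂ _+_ ∣U∣≡ ∣F∣≡k ⟩
      t + _ + k       ≤⟨ +-monoˡ-≤ k (≤-trans t+u≤ 1+k≤2k) ⟩
      k + k + k       ≡⟨ lem k ⟩
      3 * k           ∎
      where
      lem : ∀ k → k + k + k ≡ 3 * k
      lem = solve-∀

-- Small sets, listed families and submodularity

distinct-elements-3 : ∀ {p : Subset n} {x y z} → x ∈ p → y ∈ p → z ∈ p → x ≢ y → x ≢ z → y ≢ z → 3 ≤ ∣ p ∣
distinct-elements-3 {p = p} {x} {y} {z} x∈ y∈ z∈ x≢y x≢z y≢z = begin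
  3                       ≤⟨ s≤s (s≤s (Nonempty⇒0<∣p∣ (z , z∈p-x-y))) ⟩
  2 + ∣ p - x - y ∣       ≡⟨ cong suc (1+∣p-x∣≡∣p∣ y∈p-x) ⟩
  suc ∣ p - x ∣           ≡⟨ 1+∣p-x∣≡∣p∣ x∈ ⟩
  ∣ p ∣ ∎
  where
  open ≤-Reasoning
  y∈p-x : y ∈ p - x
  y∈p-x = x∈p∧x≢y⇒x∈p-y y∈ (x≢y ∘ sym)
  z∈p-x-y : z ∈ p - x - y
  z∈p-x-y = x∈p∧x≢y⇒x∈p-y (x∈p∧x≢y⇒x∈p-y z∈ (x≢z ∘ sym)) (y≢z ∘ sym)

two-elements : ∀ {p : Subset n} → ∣ p ∣ ≡ 2 →
               ∃ λ x → ∃ λ y → x ∈ p × y ∈ p × x ≢ y × (∀ {z} → z ∈ p → z ≡ x ⊎ z ≡ y)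
two-elements {p = p} ∣p∣≡2 =
  let x , x∈p   = 0<∣p∣⇒Nonempty {p = p} (≤-trans (s≤s z≤n) (≤-reflexive (sym ∣p∣≡2)))
      y , y∈p-x = 0<∣p∣⇒Nonempty {p = p - x} (≤-pred (≤-trans (≤-reflexive (sym ∣p∣≡2)) (∣p∣≤1+∣p-x∣ p x)))
      y∈p       = p─q⊆p p ⁅ x ⁆ y∈p-x
  in x , y , x∈p , y∈p , (λ x≡y → x∈p-y⇒x≢y p x y∈p-x (sym x≡y)) , λ {z} z∈p → two x∈p y∈p (x∈p-y⇒x≢y p x y∈p-x) z∈p
  where
  two : ∀ {x y z} → x ∈ p → y ∈ p → y ≢ x → z ∈ p → z ≡ x ⊎ z ≡ y
  two {x} {y} {z} x∈p y∈p y≢x z∈p with z Fin.≟ x | z Fin.≟ y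
  ... | yes z≡x | _       = inj₁ z≡x
  ... | no  _   | yes z≡y = inj₂ z≡y
  ... | no  z≢x | no  z≢y = contradiction
    (≤-trans (distinct-elements-3 x∈p y∈p z∈p (y≢x ∘ sym) (z≢x ∘ sym) (z≢y ∘ sym)) (≤-reflexive ∣p∣≡2)) (<-irrefl refl)

⊆-via-∩-─ : ∀ {p q r : Subset n} → p ∩ q ⊆ r → p ─ q ⊆ r → p ⊆ r
⊆-via-∩-─ {q = q} p∩q⊆r p─q⊆r {x} x∈p with x ∈? q
... | yes x∈q = p∩q⊆r (x∈p∩q⁺ (x∈p , x∈q))
... | no  x∉q = p─q⊆r (x∈p∧x∉q⇒x∈p─q x∈p x∉q)

card-singleton : ∀ (B : Subset n) → card (λ F → Vec.≡-dec _≟ᵇ_ F B) ≤ 1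
card-singleton {n} B = ≤-trans
  (card-mono _ (trace? ∣ B ∣ ⊤ B) (λ {F} F≡B → cong ∣_∣ F≡B , trans (∩-identityʳ F) F≡B))
  (≤-reflexive (card-trace ⊤ B {0} ⊆⊤ (∣⊤∣≡n n) (+-identityʳ ∣ B ∣)))

card-listed : {P : Family n} (P? : Decidable P) (xs : List (Subset n)) → (∀ {F} → P F → F ∈ˡ xs) →
              card P? ≤ length xs
card-listed P? xs P⊆xs = ≤-trans
  (card-⋃ P? (λ B F → Vec.≡-dec _≟ᵇ_ F B) xs (λ {B} _ → card-singleton B) (λ {F} F∈ → F , P⊆xs F∈ , refl))
  (≤-reflexive (*-identityʳ (length xs)))

unlisted : {P : Family n} (P? : Decidable P) (xs : List (Subset n)) → length xs < card P? →
           ∃ λ F → P F × ¬ F ∈ˡ xs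
unlisted P? xs xs<P with anySubset? (λ F → P? F ×-dec ¬? (Any.any? (λ B → Vec.≡-dec _≟ᵇ_ F B) xs))
... | yes (F , F∈ , F∉xs) = F , F∈ , F∉xs
... | no  ¬∃ = contradiction
  (card-listed P? xs (λ {F} F∈ → decidable-stable (Any.any? (λ B → Vec.≡-dec _≟ᵇ_ F B) xs) λ F∉xs → ¬∃ (F , F∈ , F∉xs)))
  (<⇒≱ xs<P)

∣p∩q∣-modular : ∀ (B p q : Subset n) → ∣ B ∩ p ∣ + ∣ B ∩ q ∣ ≤ ∣ B ∩ (p ∪ q) ∣ + ∣ B ∩ (p ∩ q) ∣
∣p∩q∣-modular B p q = begin
  ∣ B ∩ p ∣ + ∣ B ∩ q ∣                             ≡⟨ ∣p∪q∣+∣p∩q∣≡∣p∣+∣q∣ (B ∩ p) (B ∩ q) ⟨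
  ∣ (B ∩ p) ∪ (B ∩ q) ∣ + ∣ (B ∩ p) ∩ (B ∩ q) ∣     ≤⟨ +-mono-≤
    (p⊆q⇒∣p∣≤∣q∣ (∪-⊆ (⊆-∩ (p∩q⊆p B p) (⊆-trans (p∩q⊆q B p) (p⊆p∪q q))) (⊆-∩ (p∩q⊆p B q) (⊆-trans (p∩q⊆q B q) (q⊆p∪q p q)))))
    (p⊆q⇒∣p∣≤∣q∣ {p = (B ∩ p) ∩ (B ∩ q)} {B ∩ (p ∩ q)} (⊆-∩ (⊆-trans (p∩q⊆p (B ∩ p) (B ∩ q)) (p∩q⊆p B p))
      (⊆-∩ (⊆-trans (p∩q⊆p (B ∩ p) (B ∩ q)) (p∩q⊆q B p)) (⊆-trans (p∩q⊆q (B ∩ p) (B ∩ q)) (p∩q⊆q B q))))) ⟩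
  ∣ B ∩ (p ∪ q) ∣ + ∣ B ∩ (p ∩ q) ∣ ∎
  where open ≤-Reasoning

∣B∩p∣≤∣B∩X∣+∣p─X∣ : ∀ (B p X : Subset n) → ∣ B ∩ p ∣ ≤ ∣ B ∩ X ∣ + ∣ p ─ X ∣
∣B∩p∣≤∣B∩X∣+∣p─X∣ B p X = begin
  ∣ B ∩ p ∣                               ≡⟨ ∣p∣≡∣p∩q∣+∣p─q∣ (B ∩ p) X ⟩
  ∣ (B ∩ p) ∩ X ∣ + ∣ B ∩ p ─ X ∣         ≤⟨ +-mono-≤
    (p⊆q⇒∣p∣≤∣q∣ {p = (B ∩ p) ∩ X} {B ∩ X} (λ x∈ → let x∈Bp , x∈X = x∈p∩q⁻ (B ∩ p) X x∈ in x∈p∩q⁺ (proj₁ (x∈p∩q⁻ B p x∈Bp) , x∈X)))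
    (p⊆q⇒∣p∣≤∣q∣ {p = B ∩ p ─ X} {p ─ X} (λ x∈ → x∈p∧x∉q⇒x∈p─q (proj₂ (x∈p∩q⁻ B p (p─q⊆p (B ∩ p) X x∈))) (x∈p─q⇒x∉q (B ∩ p) X x∈))) ⟩
  ∣ B ∩ X ∣ + ∣ p ─ X ∣ ∎
  where open ≤-Reasoning

-- Sets of size t + 1 meeting in at least t elements: the Johnson graph

module Johnson (t : ℕ) where

  record Triple (𝓟 : Family n) : Set where
    field
      {P₁ P₂ P₃} : Subset n
      P₁∈ : 𝓟 P₁
      P₂∈ : 𝓟 P₂
      P₃∈ : 𝓟 P₃
      P₁≢P₂ : P₁ ≢ P₂
      P₁≢P₃ : P₁ ≢ P₃
      P₂≢P₃ : P₂ ≢ P₃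

  triple : {𝓟 : Family n} (𝓟? : Decidable 𝓟) → 3 ≤ card 𝓟? → Triple 𝓟
  triple 𝓟? 3≤ =
    let P₁ , P₁∈ , _   = unlisted 𝓟? [] (≤-trans (s≤s z≤n) 3≤)
        P₂ , P₂∈ , P₂∉ = unlisted 𝓟? (P₁ ∷ []) (≤-trans (s≤s (s≤s z≤n)) 3≤)
        P₃ , P₃∈ , P₃∉ = unlisted 𝓟? (P₁ ∷ P₂ ∷ []) 3≤
    in record { P₁∈ = P₁∈ ; P₂∈ = P₂∈ ; P₃∈ = P₃∈
              ; P₁≢P₂ = λ e → P₂∉ (here (sym e)) ; P₁≢P₃ = λ e → P₃∉ (here (sym e)) ; P₂≢P₃ = λ e → P₃∉ (there (here (sym e))) }

  -- A `B` without `X` would need the one extra element of each of the three sets; these are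
  -- distinct, and with at least t - 1 elements of `X` they exceed the size t + 1.
  star-triple : ∀ {X : Subset n} → ∣ X ∣ ≡ t → (T : Triple (λ P → Sized (suc t) P × X ⊆ P)) → let open Triple T in
    ∀ {B} → Sized (suc t) B → t ≤ ∣ B ∩ P₁ ∣ → t ≤ ∣ B ∩ P₂ ∣ → t ≤ ∣ B ∩ P₃ ∣ → X ⊆ B
  star-triple {X = X} ∣X∣≡t T {B} ∣B∣≡ t≤₁ t≤₂ t≤₃ = decidable-stable (X ⊆? B) λ X⊈B →
    let p₁ , p₁∈B , p₁∈ = new X⊈B P₁∈ t≤₁
        p₂ , p₂∈B , p₂∈ = new X⊈B P₂∈ t≤₂
        p₃ , p₃∈B , p₃∈ = new X⊈B P₃∈ t≤₃
    in <⇒≱ (≤-reflexive (cong suc ∣B∣≡)) (begin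
      suc (suc t)                   ≤⟨ s≤s (s≤s (≤-trans t≤₁ (subst (∣ B ∩ P₁ ∣ ≤_)
                                        (trans (cong (∣ B ∩ X ∣ +_) (∣P─X∣≡1 P₁∈)) (+-comm _ 1)) (∣B∩p∣≤∣B∩X∣+∣p─X∣ B P₁ X)))) ⟩
      3 + ∣ B ∩ X ∣                 ≡⟨ +-comm 3 _ ⟩
      ∣ B ∩ X ∣ + 3                 ≤⟨ +-monoʳ-≤ (∣ B ∩ X ∣) (distinct-elements-3 p₁∈B p₂∈B p₃∈B
                                        (distinct P₁∈ P₂∈ P₁≢P₂ p₁∈ p₂∈) (distinct P₁∈ P₃∈ P₁≢P₃ p₁∈ p₃∈) (distinct P₂∈ P₃∈ P₂≢P₃ p₂∈ p₃∈)) ⟩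
      ∣ B ∩ X ∣ + ∣ B ─ X ∣         ≡⟨ ∣p∣≡∣p∩q∣+∣p─q∣ B X ⟨
      ∣ B ∣ ∎)
    where
    open Triple T
    open ≤-Reasoning
    ∣P─X∣≡1 : ∀ {P} → Sized (suc t) P × X ⊆ P → ∣ P ─ X ∣ ≡ 1
    ∣P─X∣≡1 {P} (∣P∣≡ , X⊆P) = +-cancelˡ-≡ t (∣ P ─ X ∣) 1 (trans
      (cong (_+ ∣ P ─ X ∣) (sym (trans (cong ∣_∣ (p⊆q⇒p∩q≡p X⊆P)) ∣X∣≡t)))
      (trans (∣p∩q∣+∣q─p∣≡∣q∣ X P) (trans ∣P∣≡ (+-comm 1 t))))
    new : ∀ {P} → ¬ X ⊆ B → Sized (suc t) P × X ⊆ P → t ≤ ∣ B ∩ P ∣ → ∃ λ p → p ∈ B ─ X × p ∈ P ─ X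
    new {P} X⊈B (_ , X⊆P) t≤ =
      let p , p∈ = ∩-exceeds⇒met P B X (≤-trans (⊈⇒∣∩∣< X⊈B) (≤-trans (≤-reflexive ∣X∣≡t) (subst (λ S → t ≤ ∣ S ∣) (∩-comm B P) t≤)))
          p∈P , p∈B─X = x∈p∩q⁻ P (B ─ X) p∈
      in p , p∈B─X , x∈p∧x∉q⇒x∈p─q p∈P (x∈p─q⇒x∉q B X p∈B─X)
    X∪p≡P : ∀ {P p} → Sized (suc t) P × X ⊆ P → p ∈ P ─ X → X ∪ ⁅ p ⁆ ≡ P
    X∪p≡P {P} {p} (∣P∣≡ , X⊆P) p∈ = ⊆-antisym X∪p⊆P (⊆-card⇒⊇ X∪p⊆P
      (≤-reflexive (trans ∣P∣≡ (sym (trans (∣p∪⁅x⁆∣≡1+∣p∣ (x∈p─q⇒x∉q P X p∈)) (cong suc ∣X∣≡t))))))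
      where
      X∪p⊆P : X ∪ ⁅ p ⁆ ⊆ P
      X∪p⊆P = ∪-⊆ X⊆P (⁅⁆-⊆ (p─q⊆p P X p∈))
    distinct : ∀ {P Q p q} → Sized (suc t) P × X ⊆ P → Sized (suc t) Q × X ⊆ Q → P ≢ Q → p ∈ P ─ X → q ∈ Q ─ X → p ≢ q
    distinct P∈ Q∈ P≢Q p∈ q∈ refl = P≢Q (trans (sym (X∪p≡P P∈ p∈)) (X∪p≡P Q∈ q∈))

  -- Dual to `star-triple`: a `B` not inside `Z` omits the one element of `Z` that each of the three
  -- sets omits, yet has t elements in `Z`, so `Z` would have t + 3.
  clique-triple : ∀ {Z : Subset n} → ∣ Z ∣ ≡ suc (suc t) → (T : Triple (λ P → Sized (suc t) P × P ⊆ Z)) → let open Triple T in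
    ∀ {B} → Sized (suc t) B → t ≤ ∣ B ∩ P₁ ∣ → t ≤ ∣ B ∩ P₂ ∣ → t ≤ ∣ B ∩ P₃ ∣ → B ⊆ Z
  clique-triple {Z = Z} ∣Z∣≡ T {B} ∣B∣≡ t≤₁ t≤₂ t≤₃ = decidable-stable (B ⊆? Z) λ B⊈Z →
    let z₁ , z₁∈Z─B , z₁∈ = new B⊈Z P₁∈ t≤₁
        z₂ , z₂∈Z─B , z₂∈ = new B⊈Z P₂∈ t≤₂
        z₃ , z₃∈Z─B , z₃∈ = new B⊈Z P₃∈ t≤₃
    in <⇒≱ (≤-reflexive (cong suc ∣Z∣≡)) (begin
      3 + t                       ≡⟨ +-comm 3 t ⟩
      t + 3                       ≤⟨ +-mono-≤ (≤-trans t≤₁ (p⊆q⇒∣p∣≤∣q∣ {p = B ∩ P₁} {B ∩ Z} (⊆-∩ (p∩q⊆p B P₁) (⊆-trans (p∩q⊆q B P₁) (proj₂ P₁∈)))))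
                                      (distinct-elements-3 z₁∈Z─B z₂∈Z─B z₃∈Z─B
                                        (distinct P₁∈ P₂∈ P₁≢P₂ z₁∈ z₂∈) (distinct P₁∈ P₃∈ P₁≢P₃ z₁∈ z₃∈) (distinct P₂∈ P₃∈ P₂≢P₃ z₂∈ z₃∈)) ⟩
      ∣ B ∩ Z ∣ + ∣ Z ─ B ∣       ≡⟨ ∣p∩q∣+∣q─p∣≡∣q∣ B Z ⟩
      ∣ Z ∣ ∎)
    where
    open Triple T
    open ≤-Reasoning
    ∣Z─P∣≡1 : ∀ {P} → Sized (suc t) P × P ⊆ Z → ∣ Z ─ P ∣ ≡ 1
    ∣Z─P∣≡1 {P} (∣P∣≡ , P⊆Z) = +-cancelˡ-≡ (suc t) (∣ Z ─ P ∣) 1 (trans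
      (cong (_+ ∣ Z ─ P ∣) (sym (trans (cong ∣_∣ (p⊆q⇒p∩q≡p P⊆Z)) ∣P∣≡)))
      (trans (∣p∩q∣+∣q─p∣≡∣q∣ P Z) (trans ∣Z∣≡ (+-comm 1 (suc t)))))
    new : ∀ {P} → ¬ B ⊆ Z → Sized (suc t) P × P ⊆ Z → t ≤ ∣ B ∩ P ∣ → ∃ λ z → z ∈ Z ─ B × z ∈ Z ─ P
    new {P} B⊈Z P∈@(∣P∣≡ , P⊆Z) t≤ =
      let z , z∈ = 0<∣p∣⇒Nonempty {p = Z ─ P} (≤-reflexive (sym (∣Z─P∣≡1 P∈)))
      in z , x∈p∧x∉q⇒x∈p─q (p─q⊆p Z P z∈) (λ z∈B → <⇒≱ (⊈⇒∣∩∣< B⊈Z) (begin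
           ∣ B ∣                   ≡⟨ ∣B∣≡ ⟩
           suc t                   ≤⟨ s≤s t≤ ⟩
           suc ∣ B ∩ P ∣           ≡⟨ ∣p∪⁅x⁆∣≡1+∣p∣ (λ z∈BP → x∈p─q⇒x∉q Z P z∈ (proj₂ (x∈p∩q⁻ B P z∈BP))) ⟨
           ∣ (B ∩ P) ∪ ⁅ z ⁆ ∣     ≤⟨ p⊆q⇒∣p∣≤∣q∣ {p = (B ∩ P) ∪ ⁅ z ⁆} {B ∩ Z} (∪-⊆ (⊆-∩ (p∩q⊆p B P) (⊆-trans (p∩q⊆q B P) P⊆Z)) (⁅⁆-⊆ (x∈p∩q⁺ (z∈B , p─q⊆p Z P z∈)))) ⟩
           ∣ B ∩ Z ∣               ∎)) , z∈
    P≡Z-z : ∀ {P z} → Sized (suc t) P × P ⊆ Z → z ∈ Z ─ P → P ≡ Z - z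
    P≡Z-z {P} {z} (∣P∣≡ , P⊆Z) z∈ = ⊆-antisym P⊆Z-z (⊆-card⇒⊇ P⊆Z-z
      (≤-reflexive (suc-injective (trans (1+∣p-x∣≡∣p∣ (p─q⊆p Z P z∈)) (trans ∣Z∣≡ (cong suc (sym ∣P∣≡)))))))
      where
      P⊆Z-z : P ⊆ Z - z
      P⊆Z-z y∈P = x∈p∧x≢y⇒x∈p-y (P⊆Z y∈P) (λ y≡z → x∈p─q⇒x∉q Z P z∈ (subst (_∈ P) y≡z y∈P))
    distinct : ∀ {P Q p q} → Sized (suc t) P × P ⊆ Z → Sized (suc t) Q × Q ⊆ Z → P ≢ Q → p ∈ Z ─ P → q ∈ Z ─ Q → p ≢ q
    distinct P∈ Q∈ P≢Q p∈ q∈ refl = P≢Q (trans (P≡Z-z P∈ p∈) (sym (P≡Z-z Q∈ q∈)))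

  -- Submodularity leaves `B` at least t - 1 elements of `P ∩ Q`, which has at most that many.
  common-neighbour : ∀ {B P Q : Subset n} → Sized (suc t) B → t ≤ ∣ B ∩ P ∣ → t ≤ ∣ B ∩ Q ∣ → ∣ P ∩ Q ∣ < t →
                     P ∩ Q ⊆ B × t ≡ suc ∣ P ∩ Q ∣
  common-neighbour {B = B} {P} {Q} ∣B∣≡ t≤₁ t≤₂ far =
    ⊆-trans (⊆-card⇒⊇ (p∩q⊆q B (P ∩ Q)) (≤-pred (≤-trans far t≤))) (p∩q⊆p B (P ∩ Q)) ,
    ≤-antisym (≤-trans t≤ (s≤s (∣p∩q∣≤∣q∣ B (P ∩ Q)))) far
    where
    open ≤-Reasoning
    t≤ : t ≤ suc ∣ B ∩ (P ∩ Q) ∣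
    t≤ = +-cancelˡ-≤ t _ _ (begin
      t + t                                       ≤⟨ +-mono-≤ t≤₁ t≤₂ ⟩
      ∣ B ∩ P ∣ + ∣ B ∩ Q ∣                       ≤⟨ ∣p∩q∣-modular B P Q ⟩
      ∣ B ∩ (P ∪ Q) ∣ + ∣ B ∩ (P ∩ Q) ∣           ≤⟨ +-monoˡ-≤ _ (≤-trans (∣p∩q∣≤∣p∣ B (P ∪ Q)) (≤-reflexive ∣B∣≡)) ⟩
      suc t + ∣ B ∩ (P ∩ Q) ∣                     ≡⟨ +-suc t _ ⟨
      t + suc ∣ B ∩ (P ∩ Q) ∣ ∎)

  ≢⇒∣∩∣≤t : ∀ {P Q : Subset n} → Sized (suc t) P → Sized (suc t) Q → P ≢ Q → ∣ P ∩ Q ∣ ≤ t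
  ≢⇒∣∩∣≤t {P = P} {Q} ∣P∣≡ ∣Q∣≡ P≢Q = ≤-pred (≤-trans
    (⊈⇒∣∩∣< λ P⊆Q → P≢Q (⊆-antisym P⊆Q (⊆-card⇒⊇ P⊆Q (≤-reflexive (trans ∣Q∣≡ (sym ∣P∣≡))))))
    (≤-reflexive ∣P∣≡))

  module _ {𝓑 𝓒 : Family n} (𝓑? : Decidable 𝓑) (∣𝓑∣≡ : ∀ {B} → 𝓑 B → Sized (suc t) B) (∣𝓒∣≡ : ∀ {D} → 𝓒 D → Sized (suc t) D)
           (cross : ∀ {B D} → 𝓑 B → 𝓒 D → t ≤ ∣ B ∩ D ∣) (4≤𝓑 : 4 ≤ card 𝓑?) where

    cross′ : ∀ {B D} → 𝓑 B → 𝓒 D → t ≤ ∣ D ∩ B ∣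
    cross′ {B} {D} B∈ D∈ = subst (λ S → t ≤ ∣ S ∣) (∩-comm B D) (cross B∈ D∈)

    -- Two far-apart members P, Q of 𝓒 have only four common neighbours, so 𝓑 consists of
    -- all four; but these have no common neighbour other than P and Q.
    close : ∀ {P Q R} → 𝓒 P → 𝓒 Q → 𝓒 R → P ≢ R → Q ≢ R → t ≤ ∣ P ∩ Q ∣
    close {P} {Q} {R} P∈ Q∈ R∈ P≢R Q≢R = ≮⇒≥ impossible
      where
      impossible : ¬ ∣ P ∩ Q ∣ < t
      impossible far = [ (λ (a∈R , b∈R) → contains P∈ P≢R (P⊆ a∈R b∈R)) , (λ (c∈R , d∈R) → contains Q∈ Q≢R (Q⊆ c∈R d∈R)) ]′ pair
        where
        Y = P ∩ Q
        neighbour : ∀ {B} → 𝓑 B → Y ⊆ B × t ≡ suc ∣ Y ∣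
        neighbour B∈ = common-neighbour (∣𝓑∣≡ B∈) (cross B∈ P∈) (cross B∈ Q∈) far
        t≡1+∣Y∣ : t ≡ suc ∣ Y ∣
        t≡1+∣Y∣ = proj₂ (neighbour (proj₁ (proj₂ (unlisted 𝓑? [] (≤-trans (s≤s z≤n) 4≤𝓑)))))
        ∣P─Q∣≡2 : ∣ P ─ Q ∣ ≡ 2
        ∣P─Q∣≡2 = +-cancelˡ-≡ (∣ Y ∣) _ _ (trans (sym (∣p∣≡∣p∩q∣+∣p─q∣ P Q)) (trans (∣𝓒∣≡ P∈) (trans (cong suc t≡1+∣Y∣) (+-comm 2 _))))
        ∣Q─P∣≡2 : ∣ Q ─ P ∣ ≡ 2
        ∣Q─P∣≡2 = +-cancelˡ-≡ (∣ Y ∣) _ _ (trans (∣p∩q∣+∣q─p∣≡∣q∣ P Q) (trans (∣𝓒∣≡ Q∈) (trans (cong suc t≡1+∣Y∣) (+-comm 2 _))))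

        Pair : Fin n → Fin n → Subset n
        Pair p q = (Y ∪ ⁅ p ⁆) ∪ ⁅ q ⁆

        ∣Pair∣ : ∀ {p q} → p ∈ P ─ Q → q ∈ Q ─ P → ∣ Pair p q ∣ ≡ suc t
        ∣Pair∣ {p} {q} p∈ q∈ = trans (∣p∪⁅x⁆∣≡1+∣p∣ (λ q∈Yp → [ (λ q∈Y → x∈p─q⇒x∉q Q P q∈ (p∩q⊆p P Q q∈Y))
            , (λ q∈p → x∈p─q⇒x∉q Q P q∈ (subst (_∈ P) (sym (x∈⁅y⁆⇒x≡y p q∈p)) (p─q⊆p P Q p∈))) ]′ (x∈p∪q⁻ Y ⁅ p ⁆ q∈Yp)))
          (cong suc (trans (∣p∪⁅x⁆∣≡1+∣p∣ (λ p∈Y → x∈p─q⇒x∉q P Q p∈ (p∩q⊆q P Q p∈Y))) (sym t≡1+∣Y∣)))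

        𝓑⊆Pairs : ∀ {B} → 𝓑 B → ∃ λ p → ∃ λ q → p ∈ P ─ Q × q ∈ Q ─ P × B ≡ Pair p q
        𝓑⊆Pairs {B} B∈ =
          let Y⊆B = proj₁ (neighbour B∈)
              p , p∈ = ∩-exceeds⇒met B P Q (≤-trans (s≤s (≤-reflexive (cong ∣_∣ (∩-comm Q P)))) (≤-trans far (cross B∈ P∈)))
              q , q∈ = ∩-exceeds⇒met B Q P (≤-trans far (cross B∈ Q∈))
              p∈B , p∈P─Q = x∈p∩q⁻ B (P ─ Q) p∈
              q∈B , q∈Q─P = x∈p∩q⁻ B (Q ─ P) q∈
              Pair⊆B = ∪-⊆ (∪-⊆ Y⊆B (⁅⁆-⊆ p∈B)) (⁅⁆-⊆ q∈B)
          in p , q , p∈P─Q , q∈Q─P ,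
             ⊆-antisym (⊆-card⇒⊇ Pair⊆B (≤-reflexive (trans (∣𝓑∣≡ B∈) (sym (∣Pair∣ p∈P─Q q∈Q─P))))) Pair⊆B

        -- Without this pair only three candidates would remain for the four members of `𝓑`.
        -- Renaming a, b and c, d gives the other three pairs.
        all-pairs : ∀ {a b c d} → (∀ {z} → z ∈ P ─ Q → z ≡ a ⊎ z ≡ b) → (∀ {z} → z ∈ Q ─ P → z ≡ c ⊎ z ≡ d) → 𝓑 (Pair a c)
        all-pairs {a} {b} {c} {d} only-ab only-cd = decidable-stable (𝓑? (Pair a c)) λ ac∉ →
          <⇒≱ 4≤𝓑 (card-listed 𝓑? (Pair a d ∷ Pair b c ∷ Pair b d ∷ []) (λ B∈ →
            let p , q , p∈ , q∈ , B≡ = 𝓑⊆Pairs B∈ in listed ac∉ (only-ab p∈) (only-cd q∈) B∈ B≡))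
          where
          listed : ∀ {B p q} → ¬ 𝓑 (Pair a c) → p ≡ a ⊎ p ≡ b → q ≡ c ⊎ q ≡ d → 𝓑 B → B ≡ Pair p q →
                   B ∈ˡ Pair a d ∷ Pair b c ∷ Pair b d ∷ []
          listed ac∉ (inj₁ refl) (inj₁ refl) B∈ refl = contradiction B∈ ac∉
          listed ac∉ (inj₁ refl) (inj₂ refl) B∈ refl = here refl
          listed ac∉ (inj₂ refl) (inj₁ refl) B∈ refl = there (here refl)
          listed ac∉ (inj₂ refl) (inj₂ refl) B∈ refl = there (there (here refl))

        ab = two-elements ∣P─Q∣≡2
        cd = two-elements ∣Q─P∣≡2
        a = proj₁ ab
        b = proj₁ (proj₂ ab)
        a∈ = proj₁ (proj₂ (proj₂ ab))
        b∈ = proj₁ (proj₂ (proj₂ (proj₂ ab)))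
        a≢b = proj₁ (proj₂ (proj₂ (proj₂ (proj₂ ab))))
        only-ab : ∀ {z} → z ∈ P ─ Q → z ≡ a ⊎ z ≡ b
        only-ab = proj₂ (proj₂ (proj₂ (proj₂ (proj₂ ab))))
        c = proj₁ cd
        d = proj₁ (proj₂ cd)
        c∈ = proj₁ (proj₂ (proj₂ cd))
        d∈ = proj₁ (proj₂ (proj₂ (proj₂ cd)))
        c≢d = proj₁ (proj₂ (proj₂ (proj₂ (proj₂ cd))))
        only-cd : ∀ {z} → z ∈ Q ─ P → z ≡ c ⊎ z ≡ d
        only-cd = proj₂ (proj₂ (proj₂ (proj₂ (proj₂ cd))))

        ac∈ : 𝓑 (Pair a c)
        ac∈ = all-pairs only-ab only-cd
        ad∈ : 𝓑 (Pair a d)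
        ad∈ = all-pairs only-ab (Sum.swap ∘ only-cd)
        bc∈ : 𝓑 (Pair b c)
        bc∈ = all-pairs (Sum.swap ∘ only-ab) only-cd
        bd∈ : 𝓑 (Pair b d)
        bd∈ = all-pairs (Sum.swap ∘ only-ab) (Sum.swap ∘ only-cd)

        P#Q : ∀ {p q} → p ∈ P ─ Q → q ∈ Q ─ P → p ≢ q
        P#Q p∈ q∈ refl = x∈p─q⇒x∉q P Q p∈ (p─q⊆p Q P q∈)

        ac∩bd⊆Y : Pair a c ∩ Pair b d ⊆ Y
        ac∩bd⊆Y {z} z∈ =
          let z∈ac , z∈bd = x∈p∩q⁻ (Pair a c) (Pair b d) z∈ in
          [ (λ z∈Ya → [ (λ z∈Y → z∈Y) , (λ z∈a → first (x∈⁅y⁆⇒x≡y a z∈a) (member z∈bd)) ]′ (x∈p∪q⁻ Y ⁅ a ⁆ z∈Ya))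
          , (λ z∈c → second (x∈⁅y⁆⇒x≡y c z∈c) (member z∈bd)) ]′ (x∈p∪q⁻ (Y ∪ ⁅ a ⁆) ⁅ c ⁆ z∈ac)
          where
          member : ∀ {z} → z ∈ Pair b d → z ∈ Y ⊎ z ≡ b ⊎ z ≡ d
          member {z} z∈bd = [ (λ z∈Yb → Sum.map₂ (λ z∈b → inj₁ (x∈⁅y⁆⇒x≡y b z∈b)) (x∈p∪q⁻ Y ⁅ b ⁆ z∈Yb))
                            , (λ z∈d → inj₂ (inj₂ (x∈⁅y⁆⇒x≡y d z∈d))) ]′ (x∈p∪q⁻ (Y ∪ ⁅ b ⁆) ⁅ d ⁆ z∈bd)
          first : ∀ {z} → z ≡ a → z ∈ Y ⊎ z ≡ b ⊎ z ≡ d → z ∈ Y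
          first _   (inj₁ z∈Y)          = z∈Y
          first z≡a (inj₂ (inj₁ z≡b)) = contradiction (trans (sym z≡a) z≡b) a≢b
          first z≡a (inj₂ (inj₂ z≡d)) = contradiction (trans (sym z≡a) z≡d) (P#Q a∈ d∈)
          second : ∀ {z} → z ≡ c → z ∈ Y ⊎ z ≡ b ⊎ z ≡ d → z ∈ Y
          second _   (inj₁ z∈Y)          = z∈Y
          second z≡c (inj₂ (inj₁ z≡b)) = contradiction (trans (sym z≡b) z≡c) (P#Q b∈ c∈)
          second z≡c (inj₂ (inj₂ z≡d)) = contradiction (trans (sym z≡c) z≡d) c≢d

        Y⊆ac∩bd : Y ⊆ Pair a c ∩ Pair b d
        Y⊆ac∩bd = ⊆-∩ (proj₁ (neighbour ac∈)) (proj₁ (neighbour bd∈))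

        -- `Pair a c` and `Pair b d` are themselves far apart and meet in `Y`, so the argument for
        -- common neighbours applies to `R` with the roles exchanged.
        Y⊆R : Y ⊆ R
        Y⊆R = ⊆-trans Y⊆ac∩bd (proj₁ (common-neighbour (∣𝓒∣≡ R∈) (cross′ ac∈ R∈) (cross′ bd∈ R∈)
          (≤-trans (s≤s (p⊆q⇒∣p∣≤∣q∣ ac∩bd⊆Y)) far)))

        hits : ∀ {p q} → 𝓑 (Pair p q) → p ∈ R ⊎ q ∈ R
        hits {p} {q} B∈ =
          let z , z∈ = ∩-exceeds⇒met R (Pair p q) Y (≤-trans (s≤s (∣p∩q∣≤∣p∣ Y (Pair p q))) (≤-trans far (cross′ B∈ R∈)))
              z∈R , z∈Pair─Y = x∈p∩q⁻ R (Pair p q ─ Y) z∈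
          in [ (λ z∈Yp → [ (λ z∈Y → contradiction z∈Y (x∈p─q⇒x∉q (Pair p q) Y z∈Pair─Y))
                         , (λ z∈p → inj₁ (subst (_∈ R) (x∈⁅y⁆⇒x≡y p z∈p) z∈R)) ]′ (x∈p∪q⁻ Y ⁅ p ⁆ z∈Yp))
             , (λ z∈q → inj₂ (subst (_∈ R) (x∈⁅y⁆⇒x≡y q z∈q) z∈R)) ]′
             (x∈p∪q⁻ (Y ∪ ⁅ p ⁆) ⁅ q ⁆ (p─q⊆p (Pair p q) Y z∈Pair─Y))

        -- `R` is a vertex cover of the complete bipartite graph between a, b and c, d, hence
        -- contains one side.
        pair : (a ∈ R × b ∈ R) ⊎ (c ∈ R × d ∈ R)
        pair = combine (hits ac∈) (hits ad∈) (hits bc∈) (hits bd∈)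
          where
          combine : ∀ {A A′ B B′ : Set} → A ⊎ B → A ⊎ B′ → A′ ⊎ B → A′ ⊎ B′ → (A × A′) ⊎ (B × B′)
          combine (inj₁ x) _        (inj₁ y) _        = inj₁ (x , y)
          combine (inj₁ x) _        (inj₂ _) (inj₁ y) = inj₁ (x , y)
          combine (inj₁ _) _        (inj₂ x) (inj₂ y) = inj₂ (x , y)
          combine (inj₂ x) (inj₂ y) _        _        = inj₂ (x , y)
          combine (inj₂ _) (inj₁ x) (inj₁ y) _        = inj₁ (x , y)
          combine (inj₂ _) (inj₁ x) (inj₂ _) (inj₁ y) = inj₁ (x , y)
          combine (inj₂ x) (inj₁ _) (inj₂ _) (inj₂ y) = inj₂ (x , y)

        P⊆ : a ∈ R → b ∈ R → P ⊆ R
        P⊆ a∈R b∈R = ⊆-via-∩-─ Y⊆R λ z∈ →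
          [ (λ e → subst (_∈ R) (sym e) a∈R) , (λ e → subst (_∈ R) (sym e) b∈R) ]′ (only-ab z∈)

        Q⊆ : c ∈ R → d ∈ R → Q ⊆ R
        Q⊆ c∈R d∈R = ⊆-via-∩-─ (⊆-trans (⊆-reflexive (∩-comm Q P)) Y⊆R) λ z∈ →
          [ (λ e → subst (_∈ R) (sym e) c∈R) , (λ e → subst (_∈ R) (sym e) d∈R) ]′ (only-cd z∈)

        contains : ∀ {S} → 𝓒 S → S ≢ R → ¬ S ⊆ R
        contains S∈ S≢R S⊆R = S≢R (⊆-antisym S⊆R (⊆-card⇒⊇ S⊆R (≤-reflexive (trans (∣𝓒∣≡ R∈) (sym (∣𝓒∣≡ S∈))))))

    StarOrClique : Set
    StarOrClique =
        (∃ λ X → ∣ X ∣ ≡ t × (∀ {B} → 𝓑 B → X ⊆ B) × (∀ {D} → 𝓒 D → X ⊆ D))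
      ⊎ (∃ λ Z → ∣ Z ∣ ≡ suc (suc t) × (∀ {B} → 𝓑 B → B ⊆ Z) × (∀ {D} → 𝓒 D → D ⊆ Z))

    -- Three pairwise adjacent sets either share their pairwise intersection or lie in the union of
    -- two of them. A triple of `𝓒` settles this for all of `𝓑`, and a triple of `𝓑` then carries it
    -- back to all of `𝓒`.
    star-or-clique : (T : Triple 𝓒) → StarOrClique
    star-or-clique T = by-cases (P₁ ∩ P₂ ⊆? P₃)
      where
      open Triple T
      U : Triple 𝓑
      U = triple 𝓑? (≤-trans (n≤1+n 3) 4≤𝓑)
      open Triple U using () renaming (P₁∈ to B₁∈; P₂∈ to B₂∈; P₃∈ to B₃∈; P₁≢P₂ to B₁≢B₂; P₁≢P₃ to B₁≢B₃; P₂≢P₃ to B₂≢B₃)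
      ∣P₁∩P₂∣≡t : ∣ P₁ ∩ P₂ ∣ ≡ t
      ∣P₁∩P₂∣≡t = ≤-antisym (≢⇒∣∩∣≤t (∣𝓒∣≡ P₁∈) (∣𝓒∣≡ P₂∈) P₁≢P₂) (close P₁∈ P₂∈ P₃∈ P₁≢P₃ P₂≢P₃)
      t≤∣P₃∩P₁∣ : t ≤ ∣ P₃ ∩ P₁ ∣
      t≤∣P₃∩P₁∣ = close P₃∈ P₁∈ P₂∈ (P₂≢P₃ ∘ sym) P₁≢P₂
      t≤∣P₃∩P₂∣ : t ≤ ∣ P₃ ∩ P₂ ∣
      t≤∣P₃∩P₂∣ = close P₃∈ P₂∈ P₁∈ (P₁≢P₃ ∘ sym) (P₁≢P₂ ∘ sym)
      by-cases : Dec (P₁ ∩ P₂ ⊆ P₃) → StarOrClique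
      by-cases (yes X⊆P₃) = inj₁ (P₁ ∩ P₂ , ∣P₁∩P₂∣≡t , X⊆𝓑 , X⊆𝓒)
        where
        X⊆𝓑 : ∀ {B} → 𝓑 B → P₁ ∩ P₂ ⊆ B
        X⊆𝓑 B∈ = star-triple ∣P₁∩P₂∣≡t (record
          { P₁∈ = ∣𝓒∣≡ P₁∈ , p∩q⊆p P₁ P₂ ; P₂∈ = ∣𝓒∣≡ P₂∈ , p∩q⊆q P₁ P₂ ; P₃∈ = ∣𝓒∣≡ P₃∈ , X⊆P₃
          ; P₁≢P₂ = P₁≢P₂ ; P₁≢P₃ = P₁≢P₃ ; P₂≢P₃ = P₂≢P₃ })
          (∣𝓑∣≡ B∈) (cross B∈ P₁∈) (cross B∈ P₂∈) (cross B∈ P₃∈)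
        X⊆𝓒 : ∀ {D} → 𝓒 D → P₁ ∩ P₂ ⊆ D
        X⊆𝓒 D∈ = star-triple ∣P₁∩P₂∣≡t (record
          { P₁∈ = ∣𝓑∣≡ B₁∈ , X⊆𝓑 B₁∈ ; P₂∈ = ∣𝓑∣≡ B₂∈ , X⊆𝓑 B₂∈ ; P₃∈ = ∣𝓑∣≡ B₃∈ , X⊆𝓑 B₃∈
          ; P₁≢P₂ = B₁≢B₂ ; P₁≢P₃ = B₁≢B₃ ; P₂≢P₃ = B₂≢B₃ })
          (∣𝓒∣≡ D∈) (cross′ B₁∈ D∈) (cross′ B₂∈ D∈) (cross′ B₃∈ D∈)
      by-cases (no X⊈P₃) = inj₂ (P₁ ∪ P₂ , ∣Z∣≡ , 𝓑⊆Z , 𝓒⊆Z)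
        where
        open ≤-Reasoning
        ∣Z∣≡ : ∣ P₁ ∪ P₂ ∣ ≡ suc (suc t)
        ∣Z∣≡ = +-cancelʳ-≡ t _ _ (trans (cong (∣ P₁ ∪ P₂ ∣ +_) (sym ∣P₁∩P₂∣≡t))
          (trans (∣p∪q∣+∣p∩q∣≡∣p∣+∣q∣ P₁ P₂) (trans (cong₂ _+_ (∣𝓒∣≡ P₁∈) (∣𝓒∣≡ P₂∈)) (+-suc (suc t) t))))
        P₃⊆Z : P₃ ⊆ P₁ ∪ P₂
        P₃⊆Z = ⊆-trans (⊆-card⇒⊇ (p∩q⊆p P₃ (P₁ ∪ P₂)) (≤-trans (≤-reflexive (∣𝓒∣≡ P₃∈)) (+-cancelʳ-≤ t _ _ (begin
          suc t + t                                     ≤⟨ s≤s (+-mono-≤ t≤∣P₃∩P₁∣ t≤∣P₃∩P₂∣) ⟩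
          suc (∣ P₃ ∩ P₁ ∣ + ∣ P₃ ∩ P₂ ∣)               ≤⟨ s≤s (∣p∩q∣-modular P₃ P₁ P₂) ⟩
          suc (∣ P₃ ∩ (P₁ ∪ P₂) ∣ + ∣ P₃ ∩ (P₁ ∩ P₂) ∣) ≡⟨ +-suc _ _ ⟨
          ∣ P₃ ∩ (P₁ ∪ P₂) ∣ + suc ∣ P₃ ∩ (P₁ ∩ P₂) ∣   ≤⟨ +-monoʳ-≤ _ (≤-trans (s≤s (≤-reflexive (cong ∣_∣ (∩-comm P₃ (P₁ ∩ P₂))))) (≤-trans (⊈⇒∣∩∣< X⊈P₃) (≤-reflexive ∣P₁∩P₂∣≡t))) ⟩
          ∣ P₃ ∩ (P₁ ∪ P₂) ∣ + t ∎)))) (p∩q⊆q P₃ (P₁ ∪ P₂))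
        𝓑⊆Z : ∀ {B} → 𝓑 B → B ⊆ P₁ ∪ P₂
        𝓑⊆Z B∈ = clique-triple ∣Z∣≡ (record
          { P₁∈ = ∣𝓒∣≡ P₁∈ , p⊆p∪q P₂ ; P₂∈ = ∣𝓒∣≡ P₂∈ , q⊆p∪q P₁ P₂ ; P₃∈ = ∣𝓒∣≡ P₃∈ , P₃⊆Z
          ; P₁≢P₂ = P₁≢P₂ ; P₁≢P₃ = P₁≢P₃ ; P₂≢P₃ = P₂≢P₃ })
          (∣𝓑∣≡ B∈) (cross B∈ P₁∈) (cross B∈ P₂∈) (cross B∈ P₃∈)
        𝓒⊆Z : ∀ {D} → 𝓒 D → D ⊆ P₁ ∪ P₂
        𝓒⊆Z D∈ = clique-triple ∣Z∣≡ (record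
          { P₁∈ = ∣𝓑∣≡ B₁∈ , 𝓑⊆Z B₁∈ ; P₂∈ = ∣𝓑∣≡ B₂∈ , 𝓑⊆Z B₂∈ ; P₃∈ = ∣𝓑∣≡ B₃∈ , 𝓑⊆Z B₃∈
          ; P₁≢P₂ = B₁≢B₂ ; P₁≢P₃ = B₁≢B₃ ; P₂≢P₃ = B₂≢B₃ })
          (∣𝓒∣≡ D∈) (cross′ B₁∈ D∈) (cross′ B₂∈ D∈) (cross′ B₃∈ D∈)

-- Initial segments and subsets of codimension one

∣initial∣≡ : ∀ n m → m ≤ n → ∣ initial n m ∣ ≡ m
∣initial∣≡ zero    zero    _         = refl
∣initial∣≡ (suc n) zero    _         = ∣initial∣≡ n zero z≤n
∣initial∣≡ (suc n) (suc m) (s≤s m≤n) = cong suc (∣initial∣≡ n m m≤n)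

initial-mono : ∀ n {l m} → l ≤ m → initial n l ⊆ initial n m
initial-mono n {l} {m} l≤m x∈ = ∈-comprehension⁺ (λ i → Fin.toℕ i <? m)
  (≤-trans (∈-comprehension⁻ (λ i → Fin.toℕ i <? l) x∈) l≤m)

hyperplane : ∀ {D Z : Subset n} → D ⊆ Z → ∣ Z ∣ ≡ suc ∣ D ∣ → ∃ λ z → z ∈ Z × Z - z ⊆ D
hyperplane {D = D} {Z} D⊆Z ∣Z∣≡ with z , z∈Z , z∉D ← ⊈⇒∃ {p = Z} {D} (λ Z⊆D → <⇒≱ (≤-reflexive (sym ∣Z∣≡)) (p⊆q⇒∣p∣≤∣q∣ Z⊆D)) =
  z , z∈Z , ⊆-card⇒⊇ {p = D} {Z - z}
    (λ {y} y∈D → x∈p∧x≢y⇒x∈p-y (D⊆Z y∈D) (λ y≡z → z∉D (subst (_∈ D) y≡z y∈D)))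
    (≤-reflexive (suc-injective (trans (1+∣p-x∣≡∣p∣ z∈Z) ∣Z∣≡)))

-- Size and diversity of the model families

module Construction {n k t : ℕ} (range : Range n k t) where
  open Counting range

  14tc₂≤2c₁ : 14 * (t * c 2) ≤ 2 * c 1
  14tc₂≤2c₁ = begin
    14 * (t * c 2)              ≤⟨ *-monoʳ-≤ 14 (*-monoˡ-≤ (c 2) (≤-trans t≤k k≤k*k)) ⟩
    14 * (k * k * c 2)          ≡⟨ lem (k * k) (c 2) ⟩
    2 * (7 * (k * k) * c 2)     ≤⟨ *-monoʳ-≤ 2 7k²c₂≤c₁ ⟩
    2 * c 1                     ∎
    where
    open ≤-Reasoning
    lem : ∀ a b → 14 * (a * b) ≡ 2 * (7 * a * b)
    lem = solve-∀

  module _ {X U V : Subset n} {u v : ℕ} (∣X∣≡t : ∣ X ∣ ≡ t) (X⊆U : X ⊆ U) (X⊆V : X ⊆ V)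
           (∣U∣≡ : ∣ U ∣ ≡ t + u) (∣V∣≡ : ∣ V ∣ ≡ t + v)
           (3≤u : 3 ≤ u) (t+u≤1+k : t + u ≤ suc k) (3≤v : 3 ≤ v) (t+v≤1+k : t + v ≤ suc k) where

    card-hit-large : 14 * (v * c 1) ≤ 14 * card-hit v + c 1
    card-hit-large = begin
      14 * (v * c 1)                                  ≡⟨ *-assoc 7 2 (v * c 1) ⟩
      7 * (2 * (v * c 1))                             ≤⟨ *-monoʳ-≤ 7 (card-hit-≥ ∣X∣≡t (≤-reflexive (sym ∣V─X∣≡v))) ⟩
      7 * (2 * card (hit? X V) + v * v * c 2)         ≡⟨ cong (λ h → 7 * (2 * h + v * v * c 2)) (card-hit-≡ ∣X∣≡t X⊆V ∣V∣≡) ⟩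
      7 * (2 * card-hit v + v * v * c 2)              ≡⟨ lem (card-hit v) (v * v) (c 2) ⟩
      14 * card-hit v + 7 * (v * v) * c 2             ≤⟨ +-monoʳ-≤ (14 * card-hit v) (≤-trans
        (*-monoˡ-≤ (c 2) (*-monoʳ-≤ 7 (*-mono-≤ v≤k v≤k))) 7k²c₂≤c₁) ⟩
      14 * card-hit v + c 1 ∎
      where
      open ≤-Reasoning
      lem : ∀ h w c → 7 * (2 * h + w * c) ≡ 14 * h + 7 * w * c
      lem = solve-∀
      v≤k : v ≤ k
      v≤k = ≤-pred (≤-trans (+-monoˡ-≤ v (<⇒≤ 2≤t)) t+v≤1+k)
      ∣V─X∣≡v : ∣ V ─ X ∣ ≡ v
      ∣V─X∣≡v = +-cancelˡ-≡ t _ v (trans (cong (_+ ∣ V ─ X ∣) (sym (trans (cong ∣_∣ (p⊆q⇒p∩q≡p X⊆V)) ∣X∣≡t)))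
        (trans (∣p∩q∣+∣q─p∣≡∣q∣ X V) ∣V∣≡))

    missing⇒⊉X : ∀ {F} → Missing X U F → ¬ X ⊆ F
    missing⇒⊉X {F} (_ , x , x∈X , e) X⊆F =
      x∈p-y⇒x≢y U x (subst (x ∈_) e (x∈p∩q⁺ (X⊆F x∈X , X⊆U x∈X))) refl

    card-𝓛-≥ : card-hit v + card-missing u ≤ card (𝓛? k X U V)
    card-𝓛-≥ = subst₂ (λ h m → h + m ≤ card (𝓛? k X U V))
      (card-hit-≡ ∣X∣≡t X⊆V ∣V∣≡) (card-missing-≡ ∣X∣≡t X⊆U ∣U∣≡ t+u≤1+k)
      (card-⊎ (𝓛? k X U V) (hit? X V) (missing? X U) inj₁ inj₂ (λ (_ , X⊆F , _) F∈ → missing⇒⊉X F∈ X⊆F))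

    card-𝓛-large : 14 * (v * c 1) ≤ 14 * card (𝓛? k X U V) + c 1
    card-𝓛-large = ≤-trans card-hit-large
      (+-monoˡ-≤ (c 1) (*-monoʳ-≤ 14 (≤-trans (m≤m+n (card-hit v) (card-missing u)) card-𝓛-≥)))

    γ-𝓛-≤ : γ t (𝓛? k X U V) ≤ t * c 2
    γ-𝓛-≤ = ≤-trans (γ≤card-avoiding (𝓛? k X U V) ∣X∣≡t) (≤-trans
      (card-mono (λ F → 𝓛? k X U V F ×-dec ¬? (X ⊆? F)) (missing? X U)
        (λ {F} (F∈ , X⊈F) → [ (λ (_ , X⊆F , _) → contradiction {A = X ⊆ F} X⊆F X⊈F) , (λ m → m) ]′ F∈))
      (card-missing-≤ ∣X∣≡t X⊆U (≤-trans (+-monoʳ-≤ t 3≤u) (≤-reflexive (sym ∣U∣≡)))))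

    -- The largest degree is at `X`. Another `S` has an element off `X`, which leaves at most `c 1`
    -- members through `X` and the `t * c 2` exceptional ones, far below 3 times `c 1`.
    degree-𝓛-≤ : ∀ S → ∣ S ∣ ≡ t → degree (𝓛? k X U V) S ≤ card-hit v
    degree-𝓛-≤ S ∣S∣≡t with S ⊆? X
    ... | yes S⊆X = ≤-trans
      (card-mono (λ F → 𝓛? k X U V F ×-dec S ⊆? F) (hit? X V)
        (λ {F} (F∈ , S⊆F) → [ (λ h → h) , (λ m → contradiction {A = X ⊆ F} (⊆-trans X⊆S S⊆F) (missing⇒⊉X m)) ]′ F∈))
      (≤-reflexive (card-hit-≡ ∣X∣≡t X⊆V ∣V∣≡))
      where
      X⊆S : X ⊆ S
      X⊆S = ⊆-card⇒⊇ S⊆X (≤-reflexive (trans ∣X∣≡t (sym ∣S∣≡t)))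
    ... | no S⊈X = let y , y∈S , y∉X = ⊈⇒∃ S⊈X in *-cancelˡ-≤ 14 (+-cancelʳ-≤ (c 1) _ _ (begin
      14 * degree (𝓛? k X U V) S + c 1      ≤⟨ +-monoˡ-≤ (c 1) (*-monoʳ-≤ 14 (≤-trans
        (card-∪ (λ F → 𝓛? k X U V F ×-dec S ⊆? F) (containing? k (X ∪ ⁅ y ⁆)) (missing? X U)
          (λ (F∈ , S⊆F) → Sum.map₁ (λ (s , X⊆F , _) → s , ∪-⊆ X⊆F (⁅⁆-⊆ (S⊆F y∈S))) F∈))
        (+-mono-≤ (card-containing-≤ (≤-reflexive (sym (trans (∣p∪⁅x⁆∣≡1+∣p∣ y∉X) (trans (cong suc ∣X∣≡t) (+-comm 1 t))))) t+1≤k)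
          (card-missing-≤ ∣X∣≡t X⊆U (≤-trans (+-monoʳ-≤ t 3≤u) (≤-reflexive (sym ∣U∣≡))))))) ⟩
      14 * (c 1 + t * c 2) + c 1            ≡⟨ lem₁ (c 1) (t * c 2) ⟩
      15 * c 1 + 14 * (t * c 2)             ≤⟨ +-monoʳ-≤ (15 * c 1) 14tc₂≤2c₁ ⟩
      15 * c 1 + 2 * c 1                    ≤⟨ m≤m+n _ (25 * c 1) ⟩
      15 * c 1 + 2 * c 1 + 25 * c 1         ≡⟨ lem₂ (c 1) ⟩
      14 * (3 * c 1)                        ≤⟨ *-monoʳ-≤ 14 (*-monoˡ-≤ (c 1) 3≤v) ⟩
      14 * (v * c 1)                        ≤⟨ card-hit-large ⟩
      14 * card-hit v + c 1                 ∎))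
      where
      open ≤-Reasoning
      lem₁ : ∀ c d → 14 * (c + d) + c ≡ 15 * c + 14 * d
      lem₁ = solve-∀
      lem₂ : ∀ c → 15 * c + 2 * c + 25 * c ≡ 14 * (3 * c)
      lem₂ = solve-∀

    card-missing≤γ-𝓛 : card-missing u ≤ γ t (𝓛? k X U V)
    card-missing≤γ-𝓛 = begin
      card-missing u                              ≡⟨ m+n∸m≡n (card-hit v) (card-missing u) ⟨
      card-hit v + card-missing u ∸ card-hit v    ≤⟨ ∸-mono card-𝓛-≥ (Δ≤ (𝓛? k X U V) degree-𝓛-≤) ⟩
      γ t (𝓛? k X U V)                            ∎
      where open ≤-Reasoning

-- The structure of the generators

module Structure {n k t : ℕ} (range : Range n k t) where
  open Counting range
  open Peeling range
  open Johnson t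

  -- Size at least m - 1/14 in units of `c 1`, the form in which the size of 𝓛 is inherited.
  Large : {𝓕 : Family n} → Decidable 𝓕 → ℕ → Set
  Large 𝓕? m = 14 * (m * c 1) ≤ 14 * card 𝓕? + c 1

  Large-mono : ∀ {𝓕 : Family n} (𝓕? : Decidable 𝓕) {l m} → l ≤ m → Large 𝓕? m → Large 𝓕? l
  Large-mono 𝓕? l≤m = ≤-trans (*-monoʳ-≤ 14 (*-monoˡ-≤ (c 1) l≤m))

  Structured : (𝓑 𝓒 : Family n) → Set
  Structured 𝓑 𝓒 =
      (∃ λ X → ∣ X ∣ ≡ t × (∀ {B} → 𝓑 B → X ⊆ B) × (∀ {D} → 𝓒 D → X ⊆ D))
    ⊎ (∃ λ Z → ∣ Z ∣ ≡ suc (suc t) × (∀ {B} → 𝓑 B → Sized (suc t) B × B ⊆ Z) × (∀ {D} → 𝓒 D → Sized (suc t) D × D ⊆ Z))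

  Structured-sym : ∀ {𝓑 𝓒} → Structured 𝓑 𝓒 → Structured 𝓒 𝓑
  Structured-sym = Sum.map (λ (X , s , b , c) → X , s , c , b) (λ (Z , s , b , c) → Z , s , c , b)

  module _ {𝓕 𝓖 : Family n} {𝓕? : Decidable 𝓕} {𝓖? : Decidable 𝓖} (𝓖-sized : 𝓖 ⊆ᶠ Sized k)
           {e : ℕ} (4e≤3c₁ : 4 * e ≤ 3 * c 1) (K : Kernel 𝓕? 𝓖? 1 e) where
    open Kernel K

    𝓖-generated? : Decidable (λ G → 𝓖 G × Generated 𝓒 G)
    𝓖-generated? G = 𝓖? G ×-dec generated? 𝓒? G

    generated-large : ∀ {m} → Large 𝓖? m → 28 * (m * c 1) ≤ 28 * card 𝓖-generated? + 23 * c 1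
    generated-large {m} 𝓖-large = main-part {m} {card 𝓖?} {card 𝓖-generated?} {e} 𝓖-large
      (≤-trans (card-split 𝓖? (generated? 𝓒?)) (+-monoʳ-≤ (card 𝓖-generated?) 𝓖-rest)) 4e≤3c₁

    generated-bound : ∀ {m s} → Large 𝓖? m → card 𝓖-generated? ≤ s * c 1 + k * (k * c 2) → m ≤ s
    generated-bound {m} {s} 𝓖-large = main-part⇒≤ {m} {s} (generated-large {m} 𝓖-large)

    generators≥ : ∀ {m} → Large 𝓖? m → (∀ {D} → 𝓒 D → Sized (suc t) D) → m ≤ card 𝓒?
    generators≥ {m} 𝓖-large ∣𝓒∣≡ = generated-bound {m} {card 𝓒?} 𝓖-large (≤-trans
      (card-⋃ 𝓖-generated? (containing? k) (filter 𝓒? (subsets n))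
        (λ {D} D∈ → card-containing-≤ (≤-reflexive (trans (+-comm t 1) (sym (∣𝓒∣≡ (proj₂ (∈-filter⁻ 𝓒? {xs = subsets n} D∈)))))) t+1≤k)
        (λ {G} (G∈ , D , D∈ , D⊆G) → D , ∈-filter⁺ 𝓒? (∈-subsets D) D∈ , 𝓖-sized G∈ , D⊆G))
      (m≤m+n _ _))

    module _ (𝓖-large : Large 𝓖? 3) where

      𝓒-inhabited : ∃ 𝓒
      𝓒-inhabited = decide (anySubset? 𝓒?)
        where
        decide : Dec (∃ 𝓒) → ∃ 𝓒
        decide (yes w) = w
        decide (no ¬𝓒) = contradiction (generated-bound {3} {0} 𝓖-large (≤-trans (≤-reflexive
          (card-empty 𝓖-generated? λ G (_ , D , D∈ , _) → ¬𝓒 (D , D∈))) z≤n)) (λ ())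

      -- All of `𝓒` contains such an `X`. If some `B` did not, it would have at most two elements
      -- outside `X`, and the generated part of `𝓖`, which must hit one of them, would be at most 2
      -- times `c 1`, too few.
      small-member⇒star : ∀ {X} → 𝓑 X → ∣ X ∣ ≤ t → Structured 𝓑 𝓒
      small-member⇒star {X} X∈ ∣X∣≤t = inj₁ (X , ∣X∣≡t , (λ {B} B∈ → decidable-stable (X ⊆? B) (impossible B∈)) , X⊆𝓒)
        where
        open ≤-Reasoning
        D₀ = proj₁ 𝓒-inhabited
        D₀∈ = proj₂ 𝓒-inhabited
        ∣X∣≡t : ∣ X ∣ ≡ t
        ∣X∣≡t = ≤-antisym ∣X∣≤t (≤-trans (cross X∈ D₀∈) (∣p∩q∣≤∣p∣ X D₀))
        X⊆𝓒 : ∀ {D} → 𝓒 D → X ⊆ D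
        X⊆𝓒 {D} D∈ = ⊆-trans (⊆-card⇒⊇ (p∩q⊆p X D) (≤-trans ∣X∣≤t (cross X∈ D∈))) (p∩q⊆q X D)
        impossible : ∀ {B} → 𝓑 B → ¬ ¬ X ⊆ B
        impossible {B} B∈ X⊈B = contradiction (generated-bound {3} {2} 𝓖-large (≤-trans
          (≤-trans (card-mono 𝓖-generated? (hit? X B) λ {G} (G∈ , D , D∈ , D⊆G) →
              𝓖-sized G∈ , ⊆-trans (X⊆𝓒 D∈) D⊆G ,
              let x , x∈ = ∩-exceeds⇒met D B X (≤-trans (⊈⇒∣∩∣< X⊈B) (≤-trans ∣X∣≤t (subst (λ S → t ≤ ∣ S ∣) (∩-comm B D) (cross B∈ D∈))))
                  x∈D , x∈B─X = x∈p∩q⁻ D (B ─ X) x∈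
              in x , x∈p∩q⁺ (D⊆G x∈D , x∈B─X))
            (card-hit-≤ {X} {B} {2} ∣X∣≡t ∣B─X∣≤2))
          (m≤m+n _ _))) (λ { (s≤s (s≤s ())) })
          where
          ∣D₀─X∣≤1 : ∣ D₀ ─ X ∣ ≤ 1
          ∣D₀─X∣≤1 = +-cancelˡ-≤ t _ _ (begin
            t + ∣ D₀ ─ X ∣              ≡⟨ cong (_+ ∣ D₀ ─ X ∣) (sym (trans (cong ∣_∣ (p⊆q⇒p∩q≡p (X⊆𝓒 D₀∈))) ∣X∣≡t)) ⟩
            ∣ X ∩ D₀ ∣ + ∣ D₀ ─ X ∣     ≡⟨ ∣p∩q∣+∣q─p∣≡∣q∣ X D₀ ⟩
            ∣ D₀ ∣                      ≤⟨ ∣𝓒∣≤ D₀∈ ⟩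
            t + 1                       ∎)
          ∣B─X∣≤2 : ∣ B ─ X ∣ ≤ 2
          ∣B─X∣≤2 = +-cancelˡ-≤ (∣ B ∩ X ∣) _ _ (begin
            ∣ B ∩ X ∣ + ∣ B ─ X ∣       ≡⟨ ∣p∣≡∣p∩q∣+∣p─q∣ B X ⟨
            ∣ B ∣                       ≤⟨ ∣𝓑∣≤ B∈ ⟩
            t + 1                       ≤⟨ +-monoˡ-≤ 1 (cross B∈ D₀∈) ⟩
            ∣ B ∩ D₀ ∣ + 1              ≤⟨ +-monoˡ-≤ 1 (∣B∩p∣≤∣B∩X∣+∣p─X∣ B D₀ X) ⟩
            ∣ B ∩ X ∣ + ∣ D₀ ─ X ∣ + 1  ≡⟨ +-assoc (∣ B ∩ X ∣) _ 1 ⟩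
            ∣ B ∩ X ∣ + (∣ D₀ ─ X ∣ + 1) ≤⟨ +-monoʳ-≤ (∣ B ∩ X ∣) (+-monoˡ-≤ 1 ∣D₀─X∣≤1) ⟩
            ∣ B ∩ X ∣ + 2               ∎)

      -- The generators are of the form `Z - z`. If `F` has fewer than t elements in `Z - z`, the
      -- members of `𝓖` through `Z - z` need a further element of `F` and are negligible. With at
      -- most t - 1 elements of `F` in `Z` this affects every `z`; with exactly t it spares only the
      -- two `z` outside `F`, while `𝓖` needs three.
      generated-by-clique⇒𝓐 : CrossIntersecting t 𝓕 𝓖 → 𝓕 ⊆ᶠ Sized k →
        ∀ {Z} → ∣ Z ∣ ≡ suc (suc t) → (∀ {D} → 𝓒 D → Sized (suc t) D × D ⊆ Z) → 𝓕 ⊆ᶠ 𝓐 k t Z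
      generated-by-clique⇒𝓐 𝓕×𝓖 𝓕-sized {Z} ∣Z∣≡ 𝓒-clique {F} F∈ = 𝓕-sized F∈ ,
        ≮⇒≥ λ lt → decide (≤-pred (≤-trans lt (≤-reflexive (+-comm t 1)))) (t ≤? ∣ F ∩ Z ∣)
        where
        open ≤-Reasoning
        Through : Fin n → Family n
        Through z G = 𝓖 G × Z - z ⊆ G
        through? : ∀ z → Decidable (Through z)
        through? z G = 𝓖? G ×-dec (Z - z) ⊆? G
        generated⇒through : ∀ {G} → 𝓖 G × Generated 𝓒 G → ∃ λ z → z ∈ Z × Through z G
        generated⇒through {G} (G∈ , D , D∈ , D⊆G) =
          let ∣D∣≡ , D⊆Z = 𝓒-clique D∈
              z , z∈Z , Z-z⊆D = hyperplane D⊆Z (trans ∣Z∣≡ (cong suc (sym ∣D∣≡)))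
          in z , z∈Z , G∈ , ⊆-trans Z-z⊆D D⊆G
        ∣Z-z∣≡ : ∀ {z} → z ∈ Z → ∣ Z - z ∣ ≡ suc t
        ∣Z-z∣≡ z∈Z = suc-injective (trans (1+∣p-x∣≡∣p∣ z∈Z) ∣Z∣≡)
        through≤ : ∀ {z} → z ∈ Z → card (through? z) ≤ c 1
        through≤ {z} z∈Z = card-⊆-≤ (through? z) {Z - z} (≤-reflexive (trans (+-comm t 1) (sym (∣Z-z∣≡ z∈Z)))) t+1≤k (λ (G∈ , Z-z⊆G) → 𝓖-sized G∈ , Z-z⊆G)
        few-through : ∀ {z} → z ∈ Z → ∣ (Z - z) ∩ F ∣ < t → card (through? z) ≤ k * c 2
        few-through {z} z∈Z lt = ≤-trans
          (card-⋃ (through? z) (λ y → containing? k ((Z - z) ∪ ⁅ y ⁆)) (elements (F ─ (Z - z)))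
            (λ {y} y∈ → card-containing-≤ (≤-reflexive (trans (+-comm t 2) (trans (cong suc (sym (∣Z-z∣≡ z∈Z)))
                (sym (∣p∪⁅x⁆∣≡1+∣p∣ (x∈p─q⇒x∉q F (Z - z) (∈-elements⁻ (F ─ (Z - z)) y∈))))))) t+2≤k)
            (λ {G} (G∈ , Z-z⊆G) →
              let y , y∈ = ∩-exceeds⇒met G F (Z - z) (≤-trans lt (subst (λ S → t ≤ ∣ S ∣) (∩-comm F G) (𝓕×𝓖 F∈ G∈)))
                  y∈G , y∈F─ = x∈p∩q⁻ G (F ─ (Z - z)) y∈
              in y , ∈-elements⁺ y∈F─ , 𝓖-sized G∈ , ∪-⊆ Z-z⊆G (⁅⁆-⊆ y∈G)))
          (*-monoˡ-≤ (c 2) (≤-trans (≤-reflexive (length-elements (F ─ (Z - z)))) (≤-trans (∣p─q∣≤∣p∣ F (Z - z)) (≤-reflexive (𝓕-sized F∈)))))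
        many-through : ∀ Y → Y ⊆ Z → (∀ {z} → z ∈ Y → ∣ (Z - z) ∩ F ∣ < t) → ∣ Y ∣ ≤ k →
          card (λ G → 𝓖-generated? G ×-dec Any.any? (λ z → through? z G) (elements Y)) ≤ k * (k * c 2)
        many-through Y Y⊆Z few ∣Y∣≤k = ≤-trans
          (card-⋃ _ through? (elements Y) (λ z∈ → let z∈Y = ∈-elements⁻ Y z∈ in few-through (Y⊆Z z∈Y) (few z∈Y)) (λ (_ , any) → find any))
          (*-monoˡ-≤ (k * c 2) (≤-trans (≤-reflexive (length-elements Y)) ∣Y∣≤k))
        ∣Z∣≤k : ∣ Z ∣ ≤ k
        ∣Z∣≤k = ≤-trans (≤-reflexive (trans ∣Z∣≡ (+-comm 2 t))) t+2≤k
        decide : ∣ F ∩ Z ∣ ≤ t → Dec (t ≤ ∣ F ∩ Z ∣) → _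
        decide ∣F∩Z∣≤t (no t≰) = contradiction (generated-bound {3} {0} 𝓖-large (≤-trans
          (card-mono 𝓖-generated? (λ G → 𝓖-generated? G ×-dec Any.any? (λ z → through? z G) (elements Z))
            (λ {G} G∈ → let z , z∈Z , thr = generated⇒through G∈ in G∈ , lose (∈-elements⁺ z∈Z) thr))
          (many-through Z ⊆-refl (λ {z} _ → ≤-trans (s≤s (p⊆q⇒∣p∣≤∣q∣ {p = (Z - z) ∩ F} {F ∩ Z}
            (⊆-∩ (p∩q⊆q (Z - z) F) (⊆-trans (p∩q⊆p (Z - z) F) (p─q⊆p Z ⁅ z ⁆))))) (≰⇒> t≰)) ∣Z∣≤k))) (λ ())
        decide ∣F∩Z∣≤t (yes t≤) = contradiction (generated-bound {3} {2} 𝓖-large (≤-trans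
          (card-∪ 𝓖-generated? (λ G → Any.any? (λ z → through? z G) (elements (Z ─ F)))
            (λ G → 𝓖-generated? G ×-dec Any.any? (λ z → through? z G) (elements (Z ∩ F))) split)
          (+-mono-≤
            (≤-trans (card-Any-≤ through? (elements (Z ─ F)) (λ z∈ → through≤ (p─q⊆p Z F (∈-elements⁻ (Z ─ F) z∈))))
              (*-monoˡ-≤ (c 1) (≤-trans (≤-reflexive (length-elements (Z ─ F))) ∣Z─F∣≤2)))
            (many-through (Z ∩ F) (p∩q⊆p Z F) (λ {z} z∈ → ≤-trans
              (≤-trans (s≤s (p⊆q⇒∣p∣≤∣q∣ {p = (Z - z) ∩ F} {(F ∩ Z) - z} (λ y∈ → let y∈Z-z , y∈F = x∈p∩q⁻ (Z - z) F y∈ in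
                  x∈p∧x≢y⇒x∈p-y (x∈p∩q⁺ (y∈F , p─q⊆p Z ⁅ z ⁆ y∈Z-z)) (x∈p-y⇒x≢y Z z y∈Z-z))))
                (≤-reflexive (1+∣p-x∣≡∣p∣ (subst (z ∈_) (∩-comm Z F) z∈)))) ∣F∩Z∣≤t)
              (≤-trans (∣p∩q∣≤∣p∣ Z F) ∣Z∣≤k))))) (λ { (s≤s (s≤s ())) })
          where
          ∣Z─F∣≤2 : ∣ Z ─ F ∣ ≤ 2
          ∣Z─F∣≤2 = +-cancelˡ-≤ t _ _ (begin
            t + ∣ Z ─ F ∣               ≤⟨ +-monoˡ-≤ _ t≤ ⟩
            ∣ F ∩ Z ∣ + ∣ Z ─ F ∣       ≡⟨ ∣p∩q∣+∣q─p∣≡∣q∣ F Z ⟩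
            ∣ Z ∣                       ≡⟨ trans ∣Z∣≡ (+-comm 2 t) ⟩
            t + 2                       ∎)
          split : ∀ {G} → 𝓖 G × Generated 𝓒 G →
            Any (λ z → Through z G) (elements (Z ─ F)) ⊎ ((𝓖 G × Generated 𝓒 G) × Any (λ z → Through z G) (elements (Z ∩ F)))
          split {G} G∈ = let z , z∈Z , thr = generated⇒through G∈ in place z∈Z thr (z ∈? F)
            where
            place : ∀ {z} → z ∈ Z → Through z G → Dec (z ∈ F) → _
            place z∈Z thr (yes z∈F) = inj₂ (G∈ , lose (∈-elements⁺ (x∈p∩q⁺ (z∈Z , z∈F))) thr)
            place z∈Z thr (no  z∉F) = inj₁ (lose (∈-elements⁺ (x∈p∧x∉q⇒x∈p─q z∈Z z∉F)) thr)

    -- `Z` has only t + 2 subsets of size t + 1, and each generates at most `c 1` members.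
    clique-size : ∀ {m Z} → Large 𝓖? m → ∣ Z ∣ ≡ suc (suc t) → (∀ {D} → 𝓒 D → Sized (suc t) D × D ⊆ Z) → m ≤ t + 2
    clique-size {m} {Z} 𝓖-large ∣Z∣≡ 𝓒-clique = ≤-trans
      (generated-bound {m} {∣ Z ∣ C suc t} 𝓖-large (≤-trans
        (≤-trans (card-⋃ 𝓖-generated? (containing? k) (filter (subset-of? Z (suc t)) (subsets n))
          (λ {D} D∈ → card-containing-≤ (≤-reflexive (trans (+-comm t 1) (sym (proj₁ (proj₂ (∈-filter⁻ (subset-of? Z (suc t)) {xs = subsets n} D∈)))))) t+1≤k)
          (λ {G} (G∈ , D , D∈ , D⊆G) → D , ∈-filter⁺ (subset-of? Z (suc t)) (∈-subsets D) (𝓒-clique D∈) , 𝓖-sized G∈ , D⊆G))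
          (≤-reflexive (cong (_* c 1) (card-subsets-of Z (suc t)))))
        (m≤m+n _ _)))
      (≤-reflexive (begin
        ∣ Z ∣ C suc t                           ≡⟨ cong (_C suc t) ∣Z∣≡ ⟩
        suc (suc t) C suc t                     ≡⟨ nCk≡nC[n∸k] (n≤1+n (suc t)) ⟩
        suc (suc t) C (suc (suc t) ∸ suc t)     ≡⟨ cong (suc (suc t) C_) (m+n∸n≡m 1 t) ⟩
        suc (suc t) C 1                         ≡⟨ nC1≡n (suc (suc t)) ⟩
        suc (suc t)                             ≡⟨ +-comm 2 t ⟩
        t + 2 ∎))
      where open ≡-Reasoning

  -- Members through a t-set inside `Z` use one of its two other elements in `Z`; through any other
  -- t-set they need two further elements of `Z`, and `card-pairs` applies.
  Δ-𝓐-≤ : ∀ {𝓕 : Family n} (𝓕? : Decidable 𝓕) {Z} → ∣ Z ∣ ≡ suc (suc t) → 𝓕 ⊆ᶠ 𝓐 k t Z → Δ t 𝓕? ≤ 2 * c 1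
  Δ-𝓐-≤ {𝓕} 𝓕? {Z} ∣Z∣≡ 𝓕⊆𝓐 = Δ≤ 𝓕? λ S ∣S∣≡t → bound S ∣S∣≡t (S ⊆? Z)
    where
    open ≤-Reasoning
    bound : ∀ S → ∣ S ∣ ≡ t → Dec (S ⊆ Z) → degree 𝓕? S ≤ 2 * c 1
    bound S ∣S∣≡t (yes S⊆Z) = ≤-trans
      (card-mono (λ F → 𝓕? F ×-dec S ⊆? F) (hit? S Z) (λ {F} (F∈ , S⊆F) → proj₁ (𝓕⊆𝓐 F∈) , S⊆F ,
        ∩-exceeds⇒met F Z S (≤-trans (s≤s (≤-trans (∣p∩q∣≤∣p∣ S Z) (≤-reflexive ∣S∣≡t)))
          (≤-trans (≤-reflexive (+-comm 1 t)) (proj₂ (𝓕⊆𝓐 F∈))))))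
      (card-hit-≤ {S} {Z} {2} ∣S∣≡t (≤-reflexive (+-cancelˡ-≡ t _ 2 (trans
        (cong (_+ ∣ Z ─ S ∣) (sym (trans (cong ∣_∣ (p⊆q⇒p∩q≡p S⊆Z)) ∣S∣≡t)))
        (trans (∣p∩q∣+∣q─p∣≡∣q∣ S Z) (trans ∣Z∣≡ (+-comm 2 t)))))))
    bound S ∣S∣≡t (no S⊈Z) = ≤-trans (m≤n*m (degree 𝓕? S) 14) (≤-trans
      (card-pairs (λ F → 𝓕? F ×-dec S ⊆? F) ∣S∣≡t (≤-trans (≤-reflexive (trans ∣Z∣≡ (+-comm 2 t))) t+2≤k)
        (λ (F∈ , S⊆F) → proj₁ (𝓕⊆𝓐 F∈) , S⊆F)
        (λ {F} (F∈ , _) → +-cancelˡ-≤ (∣ (F ∩ Z) ∩ S ∣) 2 _ (begin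
          ∣ (F ∩ Z) ∩ S ∣ + 2           ≤⟨ +-monoˡ-≤ 2 (p⊆q⇒∣p∣≤∣q∣ {p = (F ∩ Z) ∩ S} {S ∩ Z}
                                             (⊆-∩ (p∩q⊆q (F ∩ Z) S) (⊆-trans (p∩q⊆p (F ∩ Z) S) (p∩q⊆q F Z)))) ⟩
          ∣ S ∩ Z ∣ + 2                 ≡⟨ +-suc _ 1 ⟩
          suc ∣ S ∩ Z ∣ + 1             ≤⟨ +-monoˡ-≤ 1 (≤-trans (⊈⇒∣∩∣< S⊈Z) (≤-reflexive ∣S∣≡t)) ⟩
          t + 1                         ≤⟨ proj₂ (𝓕⊆𝓐 F∈) ⟩
          ∣ F ∩ Z ∣                     ≡⟨ ∣p∣≡∣p∩q∣+∣p─q∣ (F ∩ Z) S ⟩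
          ∣ (F ∩ Z) ∩ S ∣ + ∣ F ∩ Z ─ S ∣ ∎)))
      (m≤n*m (c 1) 2))

  -- In 14ths of `c 1`: the size gives 42, against 28 for the maximum degree, 1 for the error and 2
  -- for a diversity of `t * c 2`.
  𝓐⇒γ-large : ∀ {𝓕 : Family n} (𝓕? : Decidable 𝓕) {Z} → Large 𝓕? 3 → ∣ Z ∣ ≡ suc (suc t) → 𝓕 ⊆ᶠ 𝓐 k t Z → ¬ γ t 𝓕? ≤ t * c 2
  𝓐⇒γ-large 𝓕? 𝓕-large ∣Z∣≡ 𝓕⊆𝓐 γ≤ = <⇒≱ (m<m+n (31 * c 1) {11 * c 1} (*-mono-< (s≤s (z≤n {10})) (0<c 1))) (begin
    31 * c 1 + 11 * c 1                     ≡⟨ lem₁ (c 1) ⟩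
    14 * (3 * c 1)                          ≤⟨ 𝓕-large ⟩
    14 * card 𝓕? + c 1                      ≤⟨ +-monoˡ-≤ (c 1) (*-monoʳ-≤ 14 (≤-trans (m≤n+m∸n (card 𝓕?) (Δ t 𝓕?)) (+-mono-≤ (Δ-𝓐-≤ 𝓕? ∣Z∣≡ 𝓕⊆𝓐) γ≤))) ⟩
    14 * (2 * c 1 + t * c 2) + c 1          ≡⟨ lem₂ (c 1) (t * c 2) ⟩
    29 * c 1 + 14 * (t * c 2)               ≤⟨ +-monoʳ-≤ (29 * c 1) (Construction.14tc₂≤2c₁ range) ⟩
    29 * c 1 + 2 * c 1                      ≡⟨ *-distribʳ-+ (c 1) 29 2 ⟨
    31 * c 1                                ∎)
    where
    open ≤-Reasoning
    lem₁ : ∀ c → 31 * c + 11 * c ≡ 14 * (3 * c)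
    lem₁ = solve-∀
    lem₂ : ∀ c d → 14 * (2 * c + d) + c ≡ 29 * c + 14 * d
    lem₂ = solve-∀

  -- A generator of size t gives the star at once; otherwise all have size t + 1, and there are four
  -- on one side and three on the other for `star-or-clique`.
  structure : ∀ {𝓕 𝓖 : Family n} {𝓕? : Decidable 𝓕} {𝓖? : Decidable 𝓖} (𝓕-sized : 𝓕 ⊆ᶠ Sized k) (𝓖-sized : 𝓖 ⊆ᶠ Sized k)
    {e} → 4 * e ≤ 3 * c 1 → (K : Kernel 𝓕? 𝓖? 1 e) → Large 𝓕? 4 → Large 𝓖? 3 →
    Structured (Kernel.𝓑 K) (Kernel.𝓒 K)
  structure {𝓕? = 𝓕?} 𝓕-sized 𝓖-sized 4e≤ K 𝓕-large 𝓖-large =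
    by-cases (anySubset? λ B → 𝓑? B ×-dec ∣ B ∣ ≤? t) (anySubset? λ D → 𝓒? D ×-dec ∣ D ∣ ≤? t)
    where
    open Kernel K
    by-cases : Dec (∃ λ B → 𝓑 B × ∣ B ∣ ≤ t) → Dec (∃ λ D → 𝓒 D × ∣ D ∣ ≤ t) → Structured 𝓑 𝓒
    by-cases (yes (X , X∈ , ∣X∣≤t)) _ = small-member⇒star 𝓖-sized 4e≤ K 𝓖-large X∈ ∣X∣≤t
    by-cases (no _) (yes (X , X∈ , ∣X∣≤t)) = Structured-sym
      (small-member⇒star 𝓕-sized 4e≤ (flip-kernel K) (Large-mono 𝓕? (n≤1+n 3) 𝓕-large) X∈ ∣X∣≤t)
    by-cases (no ¬𝓑) (no ¬𝓒) = Sum.map₂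
      (λ (Z , ∣Z∣≡ , b , d) → Z , ∣Z∣≡ , (λ B∈ → ∣𝓑∣≡ B∈ , b B∈) , (λ D∈ → ∣𝓒∣≡ D∈ , d D∈))
      (star-or-clique 𝓑? ∣𝓑∣≡ ∣𝓒∣≡ cross (generators≥ 𝓕-sized 4e≤ (flip-kernel K) {4} 𝓕-large ∣𝓑∣≡)
        (triple 𝓒? (generators≥ 𝓖-sized 4e≤ K {3} 𝓖-large ∣𝓒∣≡)))
      where
      ∣𝓑∣≡ : ∀ {B} → 𝓑 B → Sized (suc t) B
      ∣𝓑∣≡ {B} B∈ = ≤-antisym (≤-trans (∣𝓑∣≤ B∈) (≤-reflexive (+-comm t 1))) (≰⇒> λ le → ¬𝓑 (B , B∈ , le))
      ∣𝓒∣≡ : ∀ {D} → 𝓒 D → Sized (suc t) D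
      ∣𝓒∣≡ {D} D∈ = ≤-antisym (≤-trans (∣𝓒∣≤ D∈) (≤-reflexive (+-comm t 1))) (≰⇒> λ le → ¬𝓒 (D , D∈ , le))

-- The two cases and the case of equality

m+n≤o+p∧p≤n⇒m≤o : ∀ m {n o p} → m + n ≤ o + p → p ≤ n → m ≤ o
m+n≤o+p∧p≤n⇒m≤o m {o = o} {p} le p≤n = +-cancelʳ-≤ p m o (≤-trans (+-monoʳ-≤ m p≤n) le)

module Assembly {n k t : ℕ} (range : Range n k t) where
  open Counting range
  open Peeling range
  open Star range
  open Construction range
  open Structure range

  -- The hypotheses in a form invariant under exchanging (𝓕, u) with (𝓖, v), so that each argument
  -- is given for one side only.
  record Situation {𝓕 𝓖 : Family n} (𝓕? : Decidable 𝓕) (𝓖? : Decidable 𝓖) (u v : ℕ) : Set where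
    field
      𝓕-sized : 𝓕 ⊆ᶠ Sized k
      𝓖-sized : 𝓖 ⊆ᶠ Sized k
      cross   : CrossIntersecting t 𝓕 𝓖
      3≤u     : 3 ≤ u
      t+u≤1+k : t + u ≤ suc k
      3≤v     : 3 ≤ v
      t+v≤1+k : t + v ≤ suc k
      𝓕-≥     : card-hit v + card-missing u ≤ card 𝓕?
      𝓖-≥     : card-hit u + card-missing v ≤ card 𝓖?
      𝓕-large : Large 𝓕? v
      𝓖-large : Large 𝓖? u

  flip-situation : ∀ {𝓕 𝓖} {𝓕? : Decidable 𝓕} {𝓖? : Decidable 𝓖} {u v} → Situation 𝓕? 𝓖? u v → Situation 𝓖? 𝓕? v u
  flip-situation S = record
    { 𝓕-sized = 𝓖-sized ; 𝓖-sized = 𝓕-sized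
    ; cross = λ {G} {F} G∈ F∈ → subst (λ S → t ≤ ∣ S ∣) (∩-comm F G) (cross F∈ G∈)
    ; 3≤u = 3≤v ; t+u≤1+k = t+v≤1+k ; 3≤v = 3≤u ; t+v≤1+k = t+u≤1+k
    ; 𝓕-≥ = 𝓖-≥ ; 𝓖-≥ = 𝓕-≥ ; 𝓕-large = 𝓖-large ; 𝓖-large = 𝓕-large }
    where open Situation S

  avoiding? : {𝓕 : Family n} → Decidable 𝓕 → ∀ X → Decidable (λ F → 𝓕 F × ¬ X ⊆ F)
  avoiding? 𝓕? X F = 𝓕? F ×-dec ¬? (X ⊆? F)

  Confined : Family n → Subset n → ℕ → Subset n → Set
  Confined 𝓕 X u U = X ⊆ U × ∣ U ∣ ≡ t + u × (∀ {F} → 𝓕 F → ¬ X ⊆ F → Missing X U F)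

  module _ {𝓕 𝓖 : Family n} {𝓕? : Decidable 𝓕} {𝓖? : Decidable 𝓖} {u v : ℕ} (S : Situation 𝓕? 𝓖? u v)
           {X : Subset n} (∣X∣≡t : ∣ X ∣ ≡ t) where
    open Situation S

    confined : 4 * card (avoiding? 𝓖? X) ≤ 3 * c 1 → ∃ (Confined 𝓕 X u)
    confined 𝓖-avoiding = exceptional⊆missing 𝓕? 𝓖? 𝓕-sized 𝓖-sized cross ∣X∣≡t 𝓖-avoiding {u} 3≤u t+u≤1+k 𝓖-large

    module _ {U : Subset n} (conf : Confined 𝓕 X u U) where

      private
        X⊆U : X ⊆ U
        X⊆U = proj₁ conf
        ∣U∣≡ : ∣ U ∣ ≡ t + u
        ∣U∣≡ = proj₁ (proj₂ conf)
        𝓕-avoiding⊆ : ∀ {F} → 𝓕 F → ¬ X ⊆ F → Missing X U F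
        𝓕-avoiding⊆ = proj₂ (proj₂ conf)

      card-avoiding≤ : card (avoiding? 𝓕? X) ≤ card-missing u
      card-avoiding≤ = ≤-trans (card-mono (avoiding? 𝓕? X) (missing? X U) (λ (F∈ , X⊈F) → 𝓕-avoiding⊆ F∈ X⊈F))
        (≤-reflexive (card-missing-≡ ∣X∣≡t X⊆U ∣U∣≡ t+u≤1+k))

      γ≤card-missing : γ t 𝓕? ≤ card-missing u
      γ≤card-missing = ≤-trans (γ≤card-avoiding 𝓕? ∣X∣≡t) card-avoiding≤

      missing⊆𝓕 : card-missing u ≤ card (avoiding? 𝓕? X) → Missing X U ⊆ᶠ 𝓕
      missing⊆𝓕 ≤avoiding F∈ = proj₁ (card-≤⇒⊇ (avoiding? 𝓕? X) (missing? X U) (λ (F∈ , X⊈F) → 𝓕-avoiding⊆ F∈ X⊈F)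
        (≤-trans (≤-reflexive (card-missing-≡ ∣X∣≡t X⊆U ∣U∣≡ t+u≤1+k)) ≤avoiding) F∈)

  -- If 𝓕 contains all of Missing X U, then 𝓖 is forced: its members through X hit U,
  -- so the two lower bounds making up ∣𝓖∣ are both attained.
  module _ {𝓕 𝓖 : Family n} {𝓕? : Decidable 𝓕} {𝓖? : Decidable 𝓖} {u v : ℕ} (S : Situation 𝓕? 𝓖? u v)
           {X : Subset n} (∣X∣≡t : ∣ X ∣ ≡ t) {U V : Subset n}
           (𝓕-conf : Confined 𝓕 X u U) (𝓖-conf : Confined 𝓖 X v V) (missing⊆ : Missing X U ⊆ᶠ 𝓕) where
    open Situation S

    through? : Decidable (λ G → 𝓖 G × X ⊆ G)
    through? G = 𝓖? G ×-dec X ⊆? G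

    card-hit-U : card (hit? X U) ≡ card-hit u
    card-hit-U = card-hit-≡ ∣X∣≡t (proj₁ 𝓕-conf) (proj₁ (proj₂ 𝓕-conf))

    through⊆hit : ∀ {G} → 𝓖 G → X ⊆ G → Hit X U G
    through⊆hit G∈ X⊆G = ⊇X⇒hit cross ∣X∣≡t (proj₁ 𝓕-conf) (proj₁ (proj₂ 𝓕-conf)) t+u≤1+k missing⊆ G∈ (𝓖-sized G∈) X⊆G

    card-through≤ : card through? ≤ card-hit u
    card-through≤ = ≤-trans (card-mono through? (hit? X U) (λ (G∈ , X⊆G) → through⊆hit G∈ X⊆G)) (≤-reflexive card-hit-U)

    𝓖-≥′ : card-hit u + card-missing v ≤ card through? + card (avoiding? 𝓖? X)
    𝓖-≥′ = ≤-trans 𝓖-≥ (card-split 𝓖? (X ⊆?_))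

    hit⊆𝓖 : Hit X U ⊆ᶠ 𝓖
    hit⊆𝓖 G∈ = proj₁ (card-≤⇒⊇ through? (hit? X U) (λ (G∈ , X⊆G) → through⊆hit G∈ X⊆G)
      (≤-trans (≤-reflexive card-hit-U) (m+n≤o+p∧p≤n⇒m≤o (card-hit u) 𝓖-≥′ (card-avoiding≤ (flip-situation S) ∣X∣≡t 𝓖-conf))) G∈)

    missing⊆𝓖 : Missing X V ⊆ᶠ 𝓖
    missing⊆𝓖 = missing⊆𝓕 (flip-situation S) ∣X∣≡t 𝓖-conf (m+n≤o+p∧p≤n⇒m≤o (card-missing v)
      (≤-trans (≤-reflexive (+-comm (card-missing v) (card-hit u)))
        (≤-trans 𝓖-≥′ (≤-reflexive (+-comm (card through?) (card (avoiding? 𝓖? X)))))) card-through≤)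

    𝓖≐𝓛 : 𝓖 ≐ 𝓛 k X V U
    𝓖≐𝓛 = (λ {G} G∈ → place G∈ (X ⊆? G)) , [ hit⊆𝓖 , missing⊆𝓖 ]′
      where
      place : ∀ {G} → 𝓖 G → Dec (X ⊆ G) → 𝓛 k X V U G
      place G∈ (yes X⊆G) = inj₁ (through⊆hit G∈ X⊆G)
      place G∈ (no  X⊈G) = inj₂ (proj₂ (proj₂ 𝓖-conf) G∈ X⊈G)

  Extremal : Family n → Family n → ℕ → ℕ → Set
  Extremal 𝓕 𝓖 u v = ∃ λ (X : Subset n) → ∃ λ (U : Subset n) → ∃ λ (V : Subset n) →
    Sized t X × Sized (t + u) U × Sized (t + v) V × X ⊆ U ∩ V × ∣ U ∩ V ∣ ≥ t + 2
    × 𝓕 ≐ 𝓛 k X U V × 𝓖 ≐ 𝓛 k X V U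

  module _ {𝓕 𝓖 : Family n} {𝓕? : Decidable 𝓕} {𝓖? : Decidable 𝓖} {u v : ℕ} (S : Situation 𝓕? 𝓖? u v) where
    open Situation S

    -- The forcing runs back and forth: `Missing X U` inside `𝓕` determines `𝓖`, which then contains
    -- `Missing X V`, and this determines `𝓕`.
    extremal : ∀ {X} (∣X∣≡t : ∣ X ∣ ≡ t) {U V} (𝓕-conf : Confined 𝓕 X u U) (𝓖-conf : Confined 𝓖 X v V) →
               Missing X U ⊆ᶠ 𝓕 → Extremal 𝓕 𝓖 u v
    extremal {X} ∣X∣≡t {U} {V} 𝓕-conf@(X⊆U , ∣U∣≡ , _) 𝓖-conf@(X⊆V , ∣V∣≡ , _) missing⊆ =
      X , U , V , ∣X∣≡t , ∣U∣≡ , ∣V∣≡ , ⊆-∩ X⊆U X⊆V ,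
      missing-cross⇒large-∩ ∣X∣≡t X⊆U ∣U∣≡ t+u≤1+k X⊆V ∣V∣≡ t+v≤1+k (λ F∈ G∈ → cross (missing⊆ F∈) (missingV⊆ G∈)) ,
      𝓖≐𝓛 (flip-situation S) ∣X∣≡t 𝓖-conf 𝓕-conf missingV⊆ ,
      𝓖≐𝓛 S ∣X∣≡t 𝓕-conf 𝓖-conf missing⊆
      where
      missingV⊆ : Missing X V ⊆ᶠ 𝓖
      missingV⊆ = missing⊆𝓖 S ∣X∣≡t 𝓕-conf 𝓖-conf missing⊆

    Star-case : Set
    Star-case = (γ t 𝓕? ≤ card-missing u × γ t 𝓖? ≤ card-missing v)
      × (card-missing u ≤ γ t 𝓕? ⊎ card-missing v ≤ γ t 𝓖? → Extremal 𝓕 𝓖 u v)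

    star-case : ∀ {X} → ∣ X ∣ ≡ t → 4 * card (avoiding? 𝓕? X) ≤ 3 * c 1 → 4 * card (avoiding? 𝓖? X) ≤ 3 * c 1 → Star-case
    star-case {X} ∣X∣≡t 𝓕-avoiding 𝓖-avoiding =
      (γ≤card-missing S ∣X∣≡t 𝓕-conf , γ≤card-missing (flip-situation S) ∣X∣≡t 𝓖-conf) , equality
      where
      𝓕-conf = proj₂ (confined S ∣X∣≡t 𝓖-avoiding)
      𝓖-conf = proj₂ (confined (flip-situation S) ∣X∣≡t 𝓕-avoiding)
      equality : card-missing u ≤ γ t 𝓕? ⊎ card-missing v ≤ γ t 𝓖? → Extremal 𝓕 𝓖 u v
      equality (inj₁ ≤γ) = extremal ∣X∣≡t 𝓕-conf 𝓖-conf
        (missing⊆𝓕 S ∣X∣≡t 𝓕-conf (≤-trans ≤γ (γ≤card-avoiding 𝓕? ∣X∣≡t)))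
      equality (inj₂ ≤γ) = extremal ∣X∣≡t 𝓕-conf 𝓖-conf
        (missing⊆𝓖 (flip-situation S) ∣X∣≡t 𝓖-conf 𝓕-conf
          (missing⊆𝓕 (flip-situation S) ∣X∣≡t 𝓖-conf (≤-trans ≤γ (γ≤card-avoiding 𝓖? ∣X∣≡t))))

    Confined-to-𝓐 : Set
    Confined-to-𝓐 = u ≤ t + 2 × v ≤ t + 2 × ∃ λ (Z : Subset n) → Sized (t + 2) Z × 𝓕 ⊆ᶠ 𝓐 k t Z × 𝓖 ⊆ᶠ 𝓐 k t Z

    Clique-case : Set
    Clique-case = Confined-to-𝓐 × ¬ γ t 𝓕? ≤ t * c 2

    star-or-clique-case : u ≢ 3 ⊎ v ≢ 3 → Star-case ⊎ Clique-case
    star-or-clique-case ≢3 = conclude (proj₂ (proj₂ kernel)) (proj₁ (proj₂ kernel)) (structured (proj₂ (proj₂ kernel)) (proj₁ (proj₂ kernel)) ≢3)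
      where
      kernel = small-kernel 𝓕? 𝓖? 𝓕-sized 𝓖-sized cross
      -- Whichever parameter exceeds 3 decides the side that supplies four generators: u speaks for
      -- `𝓖`, v for `𝓕`.
      structured : ∀ {e} (K : Kernel 𝓕? 𝓖? 1 e) → 4 * e ≤ 3 * c 1 → u ≢ 3 ⊎ v ≢ 3 → Structured (Kernel.𝓑 K) (Kernel.𝓒 K)
      structured K 4e≤ (inj₁ u≢3) = Structured-sym (structure 𝓖-sized 𝓕-sized 4e≤ (flip-kernel K)
        (Large-mono 𝓖? (≤∧≢⇒< 3≤u (u≢3 ∘ sym)) 𝓖-large) (Large-mono 𝓕? 3≤v 𝓕-large))
      structured K 4e≤ (inj₂ v≢3) = structure 𝓕-sized 𝓖-sized 4e≤ K
        (Large-mono 𝓕? (≤∧≢⇒< 3≤v (v≢3 ∘ sym)) 𝓕-large) (Large-mono 𝓖? 3≤u 𝓖-large)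
      conclude : ∀ {e} (K : Kernel 𝓕? 𝓖? 1 e) → 4 * e ≤ 3 * c 1 → Structured (Kernel.𝓑 K) (Kernel.𝓒 K) → Star-case ⊎ Clique-case
      conclude K 4e≤ (inj₁ (X , ∣X∣≡t , X⊆𝓑 , X⊆𝓒)) = inj₁ (star-case ∣X∣≡t
        (≤-trans (*-monoʳ-≤ 4 (≤-trans (card-mono (avoiding? 𝓕? X) (λ F → 𝓕? F ×-dec ¬? (generated? 𝓑? F))
          (λ (F∈ , X⊈F) → F∈ , λ (_ , B∈ , B⊆F) → X⊈F (⊆-trans (X⊆𝓑 B∈) B⊆F))) 𝓕-rest)) 4e≤)
        (≤-trans (*-monoʳ-≤ 4 (≤-trans (card-mono (avoiding? 𝓖? X) (λ G → 𝓖? G ×-dec ¬? (generated? 𝓒? G))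
          (λ (G∈ , X⊈G) → G∈ , λ (_ , D∈ , D⊆G) → X⊈G (⊆-trans (X⊆𝓒 D∈) D⊆G))) 𝓖-rest)) 4e≤))
        where open Kernel K
      conclude K 4e≤ (inj₂ (Z , ∣Z∣≡ , 𝓑-clique , 𝓒-clique)) = inj₂
        ( ( clique-size 𝓖-sized 4e≤ K {u} 𝓖-large ∣Z∣≡ 𝓒-clique
          , clique-size 𝓕-sized 4e≤ (flip-kernel K) {v} 𝓕-large ∣Z∣≡ 𝓑-clique
          , Z , trans ∣Z∣≡ (+-comm 2 t) , 𝓕⊆𝓐
          , generated-by-clique⇒𝓐 𝓕-sized 4e≤ (flip-kernel K) (Large-mono 𝓕? 3≤v 𝓕-large) (Situation.cross (flip-situation S)) 𝓖-sized ∣Z∣≡ 𝓑-clique)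
        , 𝓐⇒γ-large 𝓕? (Large-mono 𝓕? 3≤v 𝓕-large) ∣Z∣≡ 𝓕⊆𝓐)
        where
        𝓕⊆𝓐 : 𝓕 ⊆ᶠ 𝓐 k t Z
        𝓕⊆𝓐 = generated-by-clique⇒𝓐 𝓖-sized 4e≤ K (Large-mono 𝓖? 3≤u 𝓖-large) cross 𝓕-sized ∣Z∣≡ 𝓒-clique

    -- `γ₁` and `γ₂` stand for the diversities of the model families, of which only these bounds
    -- matter. In the clique case the claim about equality holds because its premise (a) fails for
    -- `𝓕`.
    dichotomy : u ≢ 3 ⊎ v ≢ 3 → ∀ {γ₁ γ₂} → card-missing u ≤ γ₁ → card-missing v ≤ γ₂ → γ₁ ≤ t * c 2 →
      ((γ t 𝓕? ≤ γ₁ × γ t 𝓖? ≤ γ₂) ⊎ Confined-to-𝓐) ×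
      (γ t 𝓕? ≤ γ₁ × γ t 𝓖? ≤ γ₂ → γ t 𝓕? ≡ γ₁ ⊎ γ t 𝓖? ≡ γ₂ → Extremal 𝓕 𝓖 u v)
    dichotomy ≢3 {γ₁} {γ₂} ≤γ₁ ≤γ₂ γ₁≤ = conclude (star-or-clique-case ≢3)
      where
      conclude : Star-case ⊎ Clique-case →
        ((γ t 𝓕? ≤ γ₁ × γ t 𝓖? ≤ γ₂) ⊎ Confined-to-𝓐) ×
        (γ t 𝓕? ≤ γ₁ × γ t 𝓖? ≤ γ₂ → γ t 𝓕? ≡ γ₁ ⊎ γ t 𝓖? ≡ γ₂ → Extremal 𝓕 𝓖 u v)
      conclude (inj₁ ((γ𝓕≤ , γ𝓖≤) , equality)) =
        inj₁ (≤-trans γ𝓕≤ ≤γ₁ , ≤-trans γ𝓖≤ ≤γ₂) ,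
        λ _ eq → equality (Sum.map (λ e → ≤-trans ≤γ₁ (≤-reflexive (sym e))) (λ e → ≤-trans ≤γ₂ (≤-reflexive (sym e))) eq)
      conclude (inj₂ (in-𝓐 , γ-large)) =
        inj₂ in-𝓐 , λ (γ𝓕≤ , _) _ → contradiction (≤-trans γ𝓕≤ γ₁≤) γ-large

  module _ {u v : ℕ} (3≤u : 3 ≤ u) (t+u≤1+k : t + u ≤ suc k) (3≤v : 3 ≤ v) (t+v≤1+k : t + v ≤ suc k) where

    private
      1+k≤n : suc k ≤ n
      1+k≤n = ≤-trans (≤-trans (+-monoˡ-≤ k (≤-trans (s≤s z≤n) 5≤k)) (+-monoʳ-≤ k (m≤m+n k (5 * k)))) 7*k≤n
      X = initial n t
      U = initial n (t + u)
      V = initial n (t + v)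
      ∣X∣≡t : ∣ X ∣ ≡ t
      ∣X∣≡t = ∣initial∣≡ n t (≤-trans t≤k k≤n)
      X⊆U : X ⊆ U
      X⊆U = initial-mono n (m≤m+n t u)
      X⊆V : X ⊆ V
      X⊆V = initial-mono n (m≤m+n t v)
      ∣U∣≡ : ∣ U ∣ ≡ t + u
      ∣U∣≡ = ∣initial∣≡ n (t + u) (≤-trans t+u≤1+k 1+k≤n)
      ∣V∣≡ : ∣ V ∣ ≡ t + v
      ∣V∣≡ = ∣initial∣≡ n (t + v) (≤-trans t+v≤1+k 1+k≤n)

    initial-card-≥ : card-hit v + card-missing u ≤ card 𝓛[ n , k , t , u , v ]?
    initial-card-≥ = card-𝓛-≥ ∣X∣≡t X⊆U X⊆V ∣U∣≡ ∣V∣≡ 3≤u t+u≤1+k 3≤v t+v≤1+k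

    initial-large : Large 𝓛[ n , k , t , u , v ]? v
    initial-large = card-𝓛-large ∣X∣≡t X⊆U X⊆V ∣U∣≡ ∣V∣≡ 3≤u t+u≤1+k 3≤v t+v≤1+k

    initial-γ-≤ : γ t 𝓛[ n , k , t , u , v ]? ≤ t * c 2
    initial-γ-≤ = γ-𝓛-≤ ∣X∣≡t X⊆U X⊆V ∣U∣≡ ∣V∣≡ 3≤u t+u≤1+k 3≤v t+v≤1+k

    initial-γ-≥ : card-missing u ≤ γ t 𝓛[ n , k , t , u , v ]?
    initial-γ-≥ = card-missing≤γ-𝓛 ∣X∣≡t X⊆U X⊆V ∣U∣≡ ∣V∣≡ 3≤u t+u≤1+k 3≤v t+v≤1+k

-- From the numerical hypotheses to `Range` and `Situation`

t+3≤k-of-parameters : ∀ {k t u v} → 3 ≤ u → u ≤ k ∸ t + 1 → 3 ≤ v → v ≤ k ∸ t + 1 → u ≢ 3 ⊎ v ≢ 3 → t + 3 ≤ k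
t+3≤k-of-parameters {k} {t} 3≤u u≤ 3≤v v≤ ≢3 = ≤-trans (+-monoʳ-≤ t 3≤k∸t) (≤-reflexive (m+[n∸m]≡n
  (<⇒≤ (3≤k∸t⇒t<k 3≤k∸t))))
  where
  3≤k∸t⇒t<k : 3 ≤ k ∸ t → t < k
  3≤k∸t⇒t<k 3≤ = ≰⇒> λ k≤t → <⇒≱ (s≤s z≤n) (subst (3 ≤_) (m≤n⇒m∸n≡0 k≤t) 3≤)
  3≤k∸t : 3 ≤ k ∸ t
  3≤k∸t = ≤-pred (subst (4 ≤_) (+-comm (k ∸ t) 1) ([ (λ u≢3 → ≤-trans (≤∧≢⇒< 3≤u (u≢3 ∘ sym)) u≤) , (λ v≢3 → ≤-trans (≤∧≢⇒< 3≤v (v≢3 ∘ sym)) v≤) ]′ ≢3))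

≢[3,3]⇒ : ∀ u v → (u , v) ≢ (3 , 3) → u ≢ 3 ⊎ v ≢ 3
≢[3,3]⇒ u v uv≢ with u ≟ 3
... | no u≢3 = inj₁ u≢3
... | yes refl = inj₂ λ { refl → uv≢ refl }

theorem1p12 :
    ∀ (n k t : ℕ) → k ≥ t + 2 → t + 2 ≥ 4 → n ≥ 7 * (k ∸ t + 1) * k ^ 2 →
    ∀ (𝓕 𝓖 : Family n) (𝓕? : Decidable 𝓕) (𝓖? : Decidable 𝓖) →
    𝓕 ⊆ᶠ Sized k → 𝓖 ⊆ᶠ Sized k → CrossIntersecting t 𝓕 𝓖 →
    ∀ (u v : ℕ) → 3 ≤ u → u ≤ k ∸ t + 1 → 3 ≤ v → v ≤ k ∸ t + 1 → (u , v) ≢ (3 , 3) →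
    card 𝓕? ≥ card 𝓛[ n , k , t , u , v ]? →
    card 𝓖? ≥ card 𝓛[ n , k , t , v , u ]? →
    let caseA = γ t 𝓕? ≤ γ t 𝓛[ n , k , t , u , v ]? × γ t 𝓖? ≤ γ t 𝓛[ n , k , t , v , u ]?
        caseB = u ≤ t + 2 × v ≤ t + 2 × ∃ λ (Z : Subset n) → Sized (t + 2) Z × 𝓕 ⊆ᶠ 𝓐 k t Z × 𝓖 ⊆ᶠ 𝓐 k t Z
    in
    (caseA ⊎ caseB)
    × (caseA →
       γ t 𝓕? ≡ γ t 𝓛[ n , k , t , u , v ]? ⊎ γ t 𝓖? ≡ γ t 𝓛[ n , k , t , v , u ]? →
       ∃ λ (X : Subset n) → ∃ λ (U : Subset n) → ∃ λ (V : Subset n) →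
         Sized t X × Sized (t + u) U × Sized (t + v) V × X ⊆ U ∩ V × ∣ U ∩ V ∣ ≥ t + 2
         × 𝓕 ≐ 𝓛 k X U V × 𝓖 ≐ 𝓛 k X V U)
theorem1p12 n k t t+2≤k 4≤t+2 n-large 𝓕 𝓖 𝓕? 𝓖? 𝓕-sized 𝓖-sized cross u v 3≤u u≤ 3≤v v≤ uv≢ 𝓕-≥ 𝓖-≥ =
  dichotomy situation u∨v≢3 γᵤᵥ-≥ γᵥᵤ-≥ (initial-γ-≤ 3≤u (t+≤1+k u≤) 3≤v (t+≤1+k v≤))
  where
  u∨v≢3 : u ≢ 3 ⊎ v ≢ 3
  u∨v≢3 = ≢[3,3]⇒ u v uv≢

  range : Range n k t
  range = record
    { 2≤t = +-cancelʳ-≤ 2 2 t 4≤t+2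
    ; t+3≤k = t+3≤k-of-parameters 3≤u u≤ 3≤v v≤ u∨v≢3
    ; large = ≤-trans (≤-reflexive (lem k (k ∸ t))) n-large }
    where
    lem : ∀ k s → 7 * (k * k) * suc s ≡ 7 * (s + 1) * (k * (k * 1))
    lem = solve-∀

  open Assembly range
  open Counting range using (c; card-missing; t≤k)

  t+≤1+k : ∀ {w} → w ≤ k ∸ t + 1 → t + w ≤ suc k
  t+≤1+k {w} w≤ = ≤-trans (+-monoʳ-≤ t w≤) (≤-reflexive (trans (sym (+-assoc t (k ∸ t) 1))
    (trans (cong (_+ 1) (m+[n∸m]≡n t≤k)) (+-comm k 1))))

  situation : Situation 𝓕? 𝓖? u v
  situation = record
    { 𝓕-sized = 𝓕-sized ; 𝓖-sized = 𝓖-sized ; cross = cross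
    ; 3≤u = 3≤u ; t+u≤1+k = t+≤1+k u≤ ; 3≤v = 3≤v ; t+v≤1+k = t+≤1+k v≤
    ; 𝓕-≥ = ≤-trans (initial-card-≥ 3≤u (t+≤1+k u≤) 3≤v (t+≤1+k v≤)) 𝓕-≥
    ; 𝓖-≥ = ≤-trans (initial-card-≥ 3≤v (t+≤1+k v≤) 3≤u (t+≤1+k u≤)) 𝓖-≥
    ; 𝓕-large = ≤-trans (initial-large 3≤u (t+≤1+k u≤) 3≤v (t+≤1+k v≤)) (+-monoˡ-≤ (c 1) (*-monoʳ-≤ 14 𝓕-≥))
    ; 𝓖-large = ≤-trans (initial-large 3≤v (t+≤1+k v≤) 3≤u (t+≤1+k u≤)) (+-monoˡ-≤ (c 1) (*-monoʳ-≤ 14 𝓖-≥)) }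

  γᵤᵥ-≥ : card-missing u ≤ γ t 𝓛[ n , k , t , u , v ]?
  γᵤᵥ-≥ = initial-γ-≥ 3≤u (t+≤1+k u≤) 3≤v (t+≤1+k v≤)

  γᵥᵤ-≥ : card-missing v ≤ γ t 𝓛[ n , k , t , v , u ]?
  γᵥᵤ-≥ = initial-γ-≥ 3≤v (t+≤1+k v≤) 3≤u (t+≤1+k u≤)
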